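{- Let $(k_n)_{n\geq 1}$ be a sequence of positive integers such that $k_n\leq n$ for all $n$. Then, as $n\to\infty$, $$\mathbb{E}\big[\mathcal{L}_{<}(S_{k_n;n})\big]=2\sqrt{nk_n}-k_n+o(\sqrt{nk_n}).$$
   Context: For positive integers $k,n$, a $k$-multiset permutation of size $n$ is a word $s=(s(1),\dots,s(kn))$ with letters in $\{1,\dots,n\}$ in which each letter appears exactly $k$ times; it is identified with the point set $\{(i,s(i)) : 1\leq i\leq kn\}\subset[0,\infty)^2$. $S_{k;n}$ denotes a $k$-multiset permutation of size $n$ chosen uniformly at random among the $\frac{(kn)!}{(k!)^n}$ possibilities. For points of the plane write $(x,y)\prec(x',y')$ if $x<x'$ and $y<y'$. For a finite point set $\mathcal{P}$, $\mathcal{L}_<(\mathcal{P})$ is the largest $L$ such that there exist $P_1\prec P_2\prec\cdots\prec P_L$ with all $P_i\in\mathcal{P}$ (the length of the longest increasing subsequence). -}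

module Defs where

open import Data.Nat as ℕ using (ℕ; zero; suc; _⊔_)
open import Data.Fin as Fin using (Fin)
open import Data.Fin.Properties as FinP using ()
open import Data.List using (List; []; _∷_; [_]; _++_; map; concatMap; filter; length; foldr; allFin)
open import Data.Nat.ListAction using (sum)
open import Data.List.Relation.Unary.All using (All; all?)
open import Data.List.Relation.Unary.Linked using (Linked; linked?)
open import Data.Integer using (+_)
open import Data.Rational using (ℚ; 0ℚ; _/_; _≤_; _<_; _*_)
open import Data.Rational.Properties using (_≤?_)
open import Data.Product using (_×_)
open import Data.Sum using (_⊎_)
open import Relation.Nullary using (yes; no)
open import Relation.Binary.PropositionalEquality using (_≡_)

words : (n m : ℕ) → List (List (Fin n))
words n zero    = [ [] ]
words n (suc m) = concatMap (λ w → map (_∷ w) (allFin n)) (words n m)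

count : ∀ {n} → Fin n → List (Fin n) → ℕ
count a w = length (filter (λ b → a Fin.≟ b) w)

IsMultPerm : (k n : ℕ) → List (Fin n) → Set
IsMultPerm k n w = All (λ a → count a w ≡ k) (allFin n)

multPerms : (k n : ℕ) → List (List (Fin n))
multPerms k n = filter (λ w → all? (λ a → count a w ℕ.≟ k) (allFin n)) (words n (k ℕ.* n))

-- All subsequences (sublists) of a word, i.e. all subsets of its point set,
-- listed in increasing order of position.
sublists : ∀ {A : Set} → List A → List (List A)
sublists []       = [ [] ]
sublists (x ∷ xs) = map (x ∷_) (sublists xs) ++ sublists xs

-- A subsequence (taken in increasing position order, so x-coordinates strictly
-- increase) is a ≺-chain iff its values strictly increase.
IsChain : ∀ {n} → List (Fin n) → Set
IsChain = Linked Fin._<_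

LIS : ∀ {n} → List (Fin n) → ℕ
LIS w = foldr _⊔_ 0 (map length (filter (linked? FinP._<?_) (sublists w)))

-- arithmetic mean (the list is never empty in the cases of interest)
mean : ℕ → ℕ → ℚ
mean s zero    = 0ℚ
mean s (suc c) = (+ s) / suc c

expectedLIS : (k n : ℕ) → ℚ
expectedLIS k n = mean (sum (map LIS (multPerms k n))) (length (multPerms k n))

ℕ→ℚ : ℕ → ℚ
ℕ→ℚ n = (+ n) / 1

-- Comparisons of a rational x with the real number c·√m (c ∈ ℚ, m ∈ ℕ), written
-- without real numbers.
-- x ≤ c·√m
_≤[_√_] : ℚ → ℚ → ℕ → Set
x ≤[ c √ m ] with 0ℚ ≤? c
... | yes _ = x ≤ 0ℚ ⊎ x * x ≤ c * c * ℕ→ℚ m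
... | no  _ = x ≤ 0ℚ × c * c * ℕ→ℚ m ≤ x * x

[_√_]≤_ : ℚ → ℕ → ℚ → Set
[ c √ m ]≤ x with 0ℚ ≤? c
... | yes _ = 0ℚ ≤ x × c * c * ℕ→ℚ m ≤ x * x
... | no  _ = 0ℚ ≤ x ⊎ x * x ≤ c * c * ℕ→ℚ m

{-# OPTIONS --safe #-}
module Submission where

-- Add m letters 0 ("particles") to the multiset permutation and read it row by row: row i rotates the letters 0 and i
-- by one step among the positions they occupy. This is Hammersley's process on a ring; it preserves the uniform
-- distribution, so a particle crosses the origin in a given row with probability k / (m + k), and the number N of
-- crossings has mean n k / (m + k). Discarding sources and sinks shows E LIS ≤ m + n k / (m + k), and m + k ≈ √(n k),
-- possible because k ≤ n, gives the upper bound 2 √(n k) − k.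
--
-- For the lower bound let F m be the mean length of the longest chain which may first collect particles. Crossings in
-- different rows are negatively correlated, so Var N ≤ n k / (m + k). If m + k exceeds √(n k) by a factor 1 + δ, the
-- maximal chain in the ring is with high probability not one that uses sinks: otherwise the ring with only √(n k) − k
-- particles, which has more sinks, would have a chain as long, contradicting Chebyshev's inequality. Hence
-- F m = m + n k / (m + k) − O(δ⁻⁴). Since F is convex in m and nearly flat near this m, F 0 = E LIS is not much smaller.

-- With `M = m + k` and `Q = n k`, the ring bound plus `k` is `M + Q / M`, minimal at `M = √Q` with
-- value `2 √Q`. The derivative vanishes there; this makes the slope of `F` small just beyond the
-- optimum, and convexity hands this slope down to all smaller `m`. At the optimum itself sources
-- and sinks are balanced, and nothing shows that the sources alone reach the maximum. The
-- comparison is therefore made at `M = R + D` with `D ≈ R / T`, where the mean exceeds the minimum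
-- by at least `D / (6 T)` while the fluctuations are only of order `√R`. The resulting loss depends
-- on `T` alone, so it vanishes against `R`. A ring, unlike an interval with random boundary
-- sources, keeps the number of particles fixed: words stay uniform with prescribed content, and
-- couplings are recolourings of the letters of one word. Square roots never occur: `R` is the
-- integer part of `√Q`, `T` is a multiple of 20 with `T ε ≥ 20`, and the estimates are multiplied
-- out.

-- Natural numbers inside the rationals, and order lemmas.

module Rationals where

  open import Defs using (ℕ→ℚ)
  open import Data.Integer as ℤ using (+_)
  open import Data.Integer.Properties as ℤₚ using ()
  open import Data.Nat as ℕ using (ℕ; suc; z≤n; s≤s)
  open import Data.Nat.Properties as ℕₚ using ()
  open import Data.Rational
  open import Data.Rational.Properties
  open import Data.Rational.Solver using (module +-*-Solver)
  open import Data.Rational.Unnormalised as ℚᵘ using (mkℚᵘ; *≡*; *≤*)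
  open import Data.Rational.Unnormalised.Properties as ℚᵘₚ using ()
  open import Data.Sum using (inj₁; inj₂)
  open import Relation.Binary.PropositionalEquality

  open +-*-Solver

  -- ι is opaque so that unification never unfolds the normalisation of a fraction.
  opaque
    ι : ℕ → ℚ
    ι = ℕ→ℚ

    ι≡ℕ→ℚ : ∀ n → ι n ≡ ℕ→ℚ n
    ι≡ℕ→ℚ n = refl

    ι-toℚᵘ : ∀ n → toℚᵘ (ι n) ℚᵘ.≃ mkℚᵘ (+ n) 0
    ι-toℚᵘ n = toℚᵘ-fromℚᵘ (mkℚᵘ (+ n) 0)

  ι-+ : ∀ m n → ι (m ℕ.+ n) ≡ ι m + ι n
  ι-+ m n = toℚᵘ-injective (begin
    toℚᵘ (ι (m ℕ.+ n))             ≈⟨ ι-toℚᵘ (m ℕ.+ n) ⟩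
    mkℚᵘ (+ (m ℕ.+ n)) 0             ≈⟨ *≡* (cong (ℤ._* + 1) (sym (cong₂ ℤ._+_ (ℤₚ.*-identityʳ (+ m)) (ℤₚ.*-identityʳ (+ n))))) ⟩
    mkℚᵘ (+ m) 0 ℚᵘ.+ mkℚᵘ (+ n) 0   ≈⟨ ℚᵘₚ.+-cong (ι-toℚᵘ m) (ι-toℚᵘ n) ⟨
    toℚᵘ (ι m) ℚᵘ.+ toℚᵘ (ι n)   ≈⟨ toℚᵘ-homo-+ (ι m) (ι n) ⟨
    toℚᵘ (ι m + ι n)             ∎)
    where open ℚᵘₚ.≃-Reasoning

  ι-* : ∀ m n → ι (m ℕ.* n) ≡ ι m * ι n
  ι-* m n = toℚᵘ-injective (begin
    toℚᵘ (ι (m ℕ.* n))             ≈⟨ ι-toℚᵘ (m ℕ.* n) ⟩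
    mkℚᵘ (+ (m ℕ.* n)) 0             ≈⟨ *≡* (cong (ℤ._* + 1) (ℤₚ.pos-* m n)) ⟩
    mkℚᵘ (+ m) 0 ℚᵘ.* mkℚᵘ (+ n) 0   ≈⟨ ℚᵘₚ.*-cong (ι-toℚᵘ m) (ι-toℚᵘ n) ⟨
    toℚᵘ (ι m) ℚᵘ.* toℚᵘ (ι n)   ≈⟨ toℚᵘ-homo-* (ι m) (ι n) ⟨
    toℚᵘ (ι m * ι n)             ∎)
    where open ℚᵘₚ.≃-Reasoning

  ι-mono : ∀ {m n} → m ℕ.≤ n → ι m ≤ ι n
  ι-mono {m} {n} m≤n = toℚᵘ-cancel-≤ (begin
    toℚᵘ (ι m)   ≃⟨ ι-toℚᵘ m ⟩
    mkℚᵘ (+ m) 0   ≤⟨ *≤* (ℤₚ.*-monoʳ-≤-nonNeg (+ 1) (ℤ.+≤+ m≤n)) ⟩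
    mkℚᵘ (+ n) 0   ≃⟨ ι-toℚᵘ n ⟨
    toℚᵘ (ι n)   ∎)
    where open ℚᵘₚ.≤-Reasoning

  ι-0 : ι 0 ≡ 0ℚ
  ι-0 = ι≡ℕ→ℚ 0

  ι-1 : ι 1 ≡ 1ℚ
  ι-1 = ι≡ℕ→ℚ 1

  0≤ι : ∀ n → 0ℚ ≤ ι n
  0≤ι n = subst (_≤ ι n) ι-0 (ι-mono {0} {n} z≤n)

  ι-suc : ∀ n → ι (suc n) ≡ 1ℚ + ι n
  ι-suc n = trans (ι-+ 1 n) (cong (_+ ι n) ι-1)

  0<ι-suc : ∀ n → 0ℚ < ι (suc n)
  0<ι-suc n = <-≤-trans (subst (0ℚ <_) (sym ι-1) (*<* (ℤ.+<+ (s≤s z≤n)))) (ι-mono {1} {suc n} (s≤s z≤n))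

  inv : ℕ → ℚ
  inv n = + 1 / suc n

  ι*inv : ∀ n → ι (suc n) * inv n ≡ 1ℚ
  ι*inv n = toℚᵘ-injective (begin
    toℚᵘ (ι (suc n) * inv n)             ≈⟨ toℚᵘ-homo-* (ι (suc n)) (inv n) ⟩
    toℚᵘ (ι (suc n)) ℚᵘ.* toℚᵘ (inv n)   ≈⟨ ℚᵘₚ.*-cong (ι-toℚᵘ (suc n)) (toℚᵘ-fromℚᵘ (mkℚᵘ (+ 1) n)) ⟩
    mkℚᵘ (+ suc n) 0 ℚᵘ.* mkℚᵘ (+ 1) n     ≈⟨ *≡* (trans (ℤₚ.*-identityʳ _) (trans (ℤₚ.*-identityʳ (+ suc n)) (sym (trans (ℤₚ.*-identityˡ _) (cong +_ (ℕₚ.*-identityˡ (suc n))))))) ⟩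
    mkℚᵘ (+ 1) 0                           ∎)
    where open ℚᵘₚ.≃-Reasoning

  *-cancel-0< : ∀ {r x y} → 0ℚ < r → r * x ≡ r * y → x ≡ y
  *-cancel-0< {r} {x} {y} 0<r eq = ≤-antisym
    (*-cancelˡ-≤-pos r {{positive 0<r}} (≤-reflexive eq))
    (*-cancelˡ-≤-pos r {{positive 0<r}} (≤-reflexive (sym eq)))

  *-cancel-≤-0< : ∀ {r x y} → 0ℚ < r → r * x ≤ r * y → x ≤ y
  *-cancel-≤-0< {r} 0<r = *-cancelˡ-≤-pos r {{positive 0<r}}

  *-monoˡ : ∀ {r x y} → 0ℚ ≤ r → x ≤ y → r * x ≤ r * y
  *-monoˡ {r} 0≤r = *-monoˡ-≤-nonNeg r {{nonNegative 0≤r}}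

  *-monoʳ : ∀ {r x y} → 0ℚ ≤ r → x ≤ y → x * r ≤ y * r
  *-monoʳ {r} 0≤r = *-monoʳ-≤-nonNeg r {{nonNegative 0≤r}}

  0≤+ : ∀ {x y} → 0ℚ ≤ x → 0ℚ ≤ y → 0ℚ ≤ x + y
  0≤+ = +-mono-≤

  0≤* : ∀ {x y} → 0ℚ ≤ x → 0ℚ ≤ y → 0ℚ ≤ x * y
  0≤* {x} 0≤x 0≤y = ≤-trans (≤-reflexive (sym (*-zeroʳ x))) (*-monoˡ 0≤x 0≤y)

  0≤sq : ∀ x → 0ℚ ≤ x * x
  0≤sq x with ≤-total 0ℚ x
  ... | inj₁ 0≤x = 0≤* 0≤x 0≤x
  ... | inj₂ x≤0 = ≤-trans (0≤* (neg-antimono-≤ x≤0) (neg-antimono-≤ x≤0))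
                     (≤-reflexive (solve 1 (λ a → (:- a) :* (:- a) := a :* a) refl x))

  ≤⇒0≤- : ∀ {x y} → x ≤ y → 0ℚ ≤ y - x
  ≤⇒0≤- {x} {y} x≤y = ≤-trans (≤-reflexive (sym (+-inverseʳ x))) (+-monoˡ-≤ (- x) x≤y)

  by-diff : ∀ {x y d} → 0ℚ ≤ d → y ≡ x + d → x ≤ y
  by-diff {x} 0≤d refl = ≤-trans (≤-reflexive (sym (+-identityʳ x))) (+-monoʳ-≤ x 0≤d)

  square-mono : ∀ {x y} → 0ℚ ≤ x → x ≤ y → x * x ≤ y * y
  square-mono 0≤x x≤y = ≤-trans (*-monoˡ 0≤x x≤y) (*-monoʳ (≤-trans 0≤x x≤y) x≤y)

-- Means over words with prescribed letter multiplicities.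

module Expectation where

  open Rationals
  open import Data.Fin using (Fin; zero; suc)
  open import Data.List using (List; []; _∷_; _∷ʳ_; length)
  open import Data.Nat as ℕ using (ℕ; zero; suc; pred)
  open import Data.Nat.Properties as ℕₚ using ()
  open import Data.Rational
  open import Data.Rational.Properties
  open import Data.Rational.Solver using (module +-*-Solver)
  open import Data.Vec using (Vec; []; _∷_; lookup; sum)
  open import Relation.Binary.PropositionalEquality

  open +-*-Solver

  ∑ : ∀ {r} → (Fin r → ℚ) → ℚ
  ∑ {zero}  g = 0ℚ
  ∑ {suc r} g = g zero + ∑ (λ a → g (suc a))

  ∑-cong : ∀ {r} {g h : Fin r → ℚ} → (∀ a → g a ≡ h a) → ∑ g ≡ ∑ h
  ∑-cong {zero}  eq = refl
  ∑-cong {suc r} eq = cong₂ _+_ (eq zero) (∑-cong (λ a → eq (suc a)))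

  ∑-mono : ∀ {r} {g h : Fin r → ℚ} → (∀ a → g a ≤ h a) → ∑ g ≤ ∑ h
  ∑-mono {zero}  le = ≤-refl
  ∑-mono {suc r} le = +-mono-≤ (le zero) (∑-mono (λ a → le (suc a)))

  ∑-+ : ∀ {r} (g h : Fin r → ℚ) → ∑ (λ a → g a + h a) ≡ ∑ g + ∑ h
  ∑-+ {zero}  g h = refl
  ∑-+ {suc r} g h = trans (cong (g zero + h zero +_) (∑-+ (λ a → g (suc a)) (λ a → h (suc a))))
    (solve 4 (λ a b c d → a :+ b :+ (c :+ d) := a :+ c :+ (b :+ d)) refl (g zero) (h zero) _ _)

  ∑-* : ∀ {r} c (g : Fin r → ℚ) → ∑ (λ a → c * g a) ≡ c * ∑ g
  ∑-* {zero}  c g = sym (*-zeroʳ c)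
  ∑-* {suc r} c g = trans (cong (c * g zero +_) (∑-* c (λ a → g (suc a)))) (sym (*-distribˡ-+ c _ _))

  ∑-0 : ∀ {r} → ∑ {r} (λ _ → 0ℚ) ≡ 0ℚ
  ∑-0 {zero}  = refl
  ∑-0 {suc r} = trans (+-identityˡ _) (∑-0 {r})

  ∑-swap : ∀ {r s} (g : Fin r → Fin s → ℚ) → ∑ (λ a → ∑ (g a)) ≡ ∑ (λ b → ∑ (λ a → g a b))
  ∑-swap {zero}  {s} g = sym (∑-0 {s})
  ∑-swap {suc r} g = trans (cong (∑ (g zero) +_) (∑-swap (λ a → g (suc a)))) (sym (∑-+ (g zero) _))

  Content : ℕ → Set
  Content r = Vec ℕ r

  Word : ℕ → Set
  Word r = List (Fin r)

  dec : ∀ {r} → Content r → Fin r → Content r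
  dec (c ∷ C) zero    = pred c ∷ C
  dec (c ∷ C) (suc a) = c ∷ dec C a

  sum-dec : ∀ {r} (C : Content r) a {c} → lookup C a ≡ suc c → sum C ≡ suc (sum (dec C a))
  sum-dec (_ ∷ C) zero    refl = refl
  sum-dec (c ∷ C) (suc a) eq   = trans (cong (c ℕ.+_) (sum-dec C a eq)) (ℕₚ.+-suc c _)

  ∑-lookup : ∀ {r} (C : Content r) → ∑ (λ a → ι (lookup C a)) ≡ ι (sum C)
  ∑-lookup []      = sym ι-0
  ∑-lookup (c ∷ C) = trans (cong (ι c +_) (∑-lookup C)) (sym (ι-+ c (sum C)))

  lookup≤sum : ∀ {r} (C : Content r) a → lookup C a ℕ.≤ sum C
  lookup≤sum (c ∷ C) zero    = ℕₚ.m≤m+n c _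
  lookup≤sum (c ∷ C) (suc a) = ℕₚ.≤-trans (lookup≤sum C a) (ℕₚ.m≤n+m _ c)

  lookup≡0 : ∀ {r} (C : Content r) → sum C ≡ 0 → ∀ a → lookup C a ≡ 0
  lookup≡0 C eq a = ℕₚ.n≤0⇒n≡0 (subst (lookup C a ℕ.≤_) eq (lookup≤sum C a))

  dec-comm : ∀ {r} (C : Content r) a b → dec (dec C a) b ≡ dec (dec C b) a
  dec-comm (c ∷ C) zero    zero    = refl
  dec-comm (c ∷ C) zero    (suc b) = refl
  dec-comm (c ∷ C) (suc a) zero    = refl
  dec-comm (c ∷ C) (suc a) (suc b) = cong (c ∷_) (dec-comm C a b)

  lookup-dec-comm : ∀ {r} (C : Content r) a b →
    lookup C a ℕ.* lookup (dec C a) b ≡ lookup C b ℕ.* lookup (dec C b) a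
  lookup-dec-comm (c ∷ C) zero    zero    = refl
  lookup-dec-comm (c ∷ C) zero    (suc b) = ℕₚ.*-comm c _
  lookup-dec-comm (c ∷ C) (suc a) zero    = ℕₚ.*-comm _ c
  lookup-dec-comm (c ∷ C) (suc a) (suc b) = lookup-dec-comm C a b

  weight-0 : ∀ x → ι 0 * x ≡ 0ℚ
  weight-0 x = trans (cong (_* x) ι-0) (*-zeroˡ x)

  -- For a letter of multiplicity 0 the truncated `pred` in `dec` produces a meaningless content,
  -- but its weight vanishes. Inductions over contents therefore only have to treat letters that are
  -- really present.
  weight-cong : ∀ c {x y} → (∀ {c′} → c ≡ suc c′ → x ≡ y) → ι c * x ≡ ι c * y
  weight-cong zero    {x} {y} eq = trans (weight-0 x) (sym (weight-0 y))
  weight-cong (suc c)         eq = cong (ι (suc c) *_) (eq refl)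

  weight-mono : ∀ c {x y} → (∀ {c′} → c ≡ suc c′ → x ≤ y) → ι c * x ≤ ι c * y
  weight-mono zero    {x} {y} le = ≤-reflexive (trans (weight-0 x) (sym (weight-0 y)))
  weight-mono (suc c)         le = *-monoˡ (0≤ι (suc c)) (le refl)

  -- The support of the mean over `C`. The rules follow the draw letter by letter, so that pointwise
  -- hypotheses restricted to the support pass through the recursion of `𝔼`.
  data _∋_ {r} : Content r → Word r → Set where
    nil  : ∀ {C} → sum C ≡ 0 → C ∋ []
    cons : ∀ {C a w c} → lookup C a ≡ suc c → dec C a ∋ w → C ∋ (a ∷ w)

  ∋⇒length : ∀ {r} {C : Content r} {w} → C ∋ w → length w ≡ sum C
  ∋⇒length (nil eq)                = sym eq
  ∋⇒length (cons {C} {a} eq C∋w) = trans (cong suc (∋⇒length C∋w)) (sym (sum-dec C a eq))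

  -- The mean over the words with content C, drawn letter by letter without replacement; only meaningful for M = sum C.
  mean-upto : ∀ {r} → ℕ → Content r → (Word r → ℚ) → ℚ
  mean-upto zero    C F = F []
  mean-upto (suc M) C F = inv M * ∑ (λ a → ι (lookup C a) * mean-upto M (dec C a) (λ w → F (a ∷ w)))

  𝔼 : ∀ {r} → Content r → (Word r → ℚ) → ℚ
  𝔼 C = mean-upto (sum C) C

  𝔼-nil : ∀ {r} (C : Content r) F → sum C ≡ 0 → 𝔼 C F ≡ F []
  𝔼-nil C F eq rewrite eq = refl

  -- Multiplied by `sum C`, the recursion holds for the empty content too, where both sides are 0.
  -- Most inductions use this form and cancel the factor instead of handling `inv`.
  𝔼-cons : ∀ {r} (C : Content r) F →
    ι (sum C) * 𝔼 C F ≡ ∑ (λ a → ι (lookup C a) * 𝔼 (dec C a) (λ w → F (a ∷ w)))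
  𝔼-cons {r} C F = go (sum C) refl
    where
    go : ∀ M → sum C ≡ M → ι M * mean-upto M C F ≡ ∑ (λ a → ι (lookup C a) * 𝔼 (dec C a) (λ w → F (a ∷ w)))
    go zero    eq = trans (weight-0 (F [])) (sym (trans
      (∑-cong (λ a → trans (cong (λ c → ι c * 𝔼 (dec C a) (λ w → F (a ∷ w))) (lookup≡0 C eq a)) (weight-0 _))) (∑-0 {r})))
    go (suc M) eq = begin
      ι (suc M) * (inv M * S)                                                ≡⟨ *-assoc (ι (suc M)) (inv M) S ⟨
      ι (suc M) * inv M * S                                                  ≡⟨ cong (_* S) (ι*inv M) ⟩
      1ℚ * S                                                                   ≡⟨ *-identityˡ S ⟩
      S                                                                        ≡⟨ ∑-cong (λ a → weight-cong (lookup C a) (λ eqₐ →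
                                                                                    cong (λ N → mean-upto N (dec C a) (λ w → F (a ∷ w)))
                                                                                      (ℕₚ.suc-injective (trans (sym eq) (sum-dec C a eqₐ))))) ⟩
      ∑ (λ a → ι (lookup C a) * 𝔼 (dec C a) (λ w → F (a ∷ w)))               ∎
      where
      open ≡-Reasoning
      S = ∑ (λ a → ι (lookup C a) * mean-upto M (dec C a) (λ w → F (a ∷ w)))

  0<sum : ∀ {r} (C : Content r) {M} → sum C ≡ suc M → 0ℚ < ι (sum C)
  0<sum C {M} eq rewrite eq = 0<ι-suc M

  𝔼-mono-∋ : ∀ {r} M (C : Content r) {F G} → sum C ≡ M → (∀ {w} → C ∋ w → F w ≤ G w) → 𝔼 C F ≤ 𝔼 C G
  𝔼-mono-∋ zero    C {F} {G} eq le = subst₂ _≤_ (sym (𝔼-nil C F eq)) (sym (𝔼-nil C G eq)) (le (nil eq))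
  𝔼-mono-∋ (suc M) C {F} {G} eq le = *-cancel-≤-0< (0<sum C eq) (subst₂ _≤_ (sym (𝔼-cons C F)) (sym (𝔼-cons C G))
    (∑-mono (λ a → weight-mono (lookup C a) (λ eqₐ →
      𝔼-mono-∋ M (dec C a) (ℕₚ.suc-injective (trans (sym (sum-dec C a eqₐ)) eq)) (λ C∋w → le (cons eqₐ C∋w))))))

  𝔼-cong-∋ : ∀ {r} (C : Content r) {F G} → (∀ {w} → C ∋ w → F w ≡ G w) → 𝔼 C F ≡ 𝔼 C G
  𝔼-cong-∋ C eq = ≤-antisym (𝔼-mono-∋ _ C refl (λ C∋w → ≤-reflexive (eq C∋w)))
                            (𝔼-mono-∋ _ C refl (λ C∋w → ≤-reflexive (sym (eq C∋w))))

  𝔼-mono : ∀ {r} (C : Content r) {F G} → (∀ w → F w ≤ G w) → 𝔼 C F ≤ 𝔼 C G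
  𝔼-mono C le = 𝔼-mono-∋ _ C refl (λ {w} _ → le w)

  𝔼-cong : ∀ {r} (C : Content r) {F G} → (∀ w → F w ≡ G w) → 𝔼 C F ≡ 𝔼 C G
  𝔼-cong C eq = 𝔼-cong-∋ C (λ {w} _ → eq w)

  𝔼-+ : ∀ {r} (C : Content r) F G → 𝔼 C (λ w → F w + G w) ≡ 𝔼 C F + 𝔼 C G
  𝔼-+ C F G = go (sum C) C F G
    where
    go : ∀ {r} M (C : Content r) F G → mean-upto M C (λ w → F w + G w) ≡ mean-upto M C F + mean-upto M C G
    go zero    C F G = refl
    go (suc M) C F G = trans (cong (inv M *_) (trans (∑-cong (λ a → trans
        (cong (ι (lookup C a) *_) (go M (dec C a) (λ w → F (a ∷ w)) (λ w → G (a ∷ w))))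
        (*-distribˡ-+ (ι (lookup C a)) (mean-upto M (dec C a) (λ w → F (a ∷ w))) (mean-upto M (dec C a) (λ w → G (a ∷ w))))))
      (∑-+ (λ a → ι (lookup C a) * mean-upto M (dec C a) (λ w → F (a ∷ w))) (λ a → ι (lookup C a) * mean-upto M (dec C a) (λ w → G (a ∷ w))))))
      (*-distribˡ-+ (inv M) _ _)

  𝔼-* : ∀ {r} (C : Content r) c F → 𝔼 C (λ w → c * F w) ≡ c * 𝔼 C F
  𝔼-* C c F = go (sum C) C F
    where
    swap : ∀ x y → x * (c * y) ≡ c * (x * y)
    swap x y = solve 3 (λ a b d → a :* (b :* d) := b :* (a :* d)) refl x c y
    go : ∀ {r} M (C : Content r) F → mean-upto M C (λ w → c * F w) ≡ c * mean-upto M C F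
    go zero    C F = refl
    go (suc M) C F = trans (cong (inv M *_) (trans (∑-cong (λ a → trans
        (cong (ι (lookup C a) *_) (go M (dec C a) (λ w → F (a ∷ w)))) (swap (ι (lookup C a)) _)))
        (∑-* c (λ a → ι (lookup C a) * mean-upto M (dec C a) (λ w → F (a ∷ w))))))
      (swap (inv M) _)

  𝔼-const : ∀ {r} (C : Content r) c → 𝔼 C (λ _ → c) ≡ c
  𝔼-const C c = go (sum C) C refl
    where
    go : ∀ {r} M (C : Content r) → sum C ≡ M → 𝔼 C (λ _ → c) ≡ c
    go zero    C eq = 𝔼-nil C _ eq
    go (suc M) C eq = *-cancel-0< (0<sum C eq) (begin
      ι (sum C) * 𝔼 C (λ _ → c)                                   ≡⟨ 𝔼-cons C _ ⟩
      ∑ (λ a → ι (lookup C a) * 𝔼 (dec C a) (λ _ → c))            ≡⟨ ∑-cong (λ a → trans (weight-cong (lookup C a) (λ eqₐ →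
                                                                         go M (dec C a) (ℕₚ.suc-injective (trans (sym (sum-dec C a eqₐ)) eq))))
                                                                         (*-comm (ι (lookup C a)) c)) ⟩
      ∑ (λ a → c * ι (lookup C a))                                ≡⟨ ∑-* c (λ a → ι (lookup C a)) ⟩
      c * ∑ (λ a → ι (lookup C a))                                ≡⟨ cong (c *_) (∑-lookup C) ⟩
      c * ι (sum C)                                               ≡⟨ *-comm c _ ⟩
      ι (sum C) * c                                               ∎)
      where open ≡-Reasoning

  -- The draw is exchangeable. Taking off the first letter `a` and, by induction, the last letter
  -- `b` gives a double sum that is symmetric by `dec-comm` and `lookup-dec-comm`. The ring needs
  -- this, since it feeds the last letter back to the front.
  𝔼-snoc : ∀ {r} (C : Content r) F →
    ι (sum C) * 𝔼 C F ≡ ∑ (λ a → ι (lookup C a) * 𝔼 (dec C a) (λ w → F (w ∷ʳ a)))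
  𝔼-snoc C F = go (sum C) C F refl
    where
    open ≡-Reasoning
    go : ∀ {r} M (C : Content r) F → sum C ≡ M →
      ι (sum C) * 𝔼 C F ≡ ∑ (λ a → ι (lookup C a) * 𝔼 (dec C a) (λ w → F (w ∷ʳ a)))
    go {r} zero C F eq = trans (trans (cong (λ c → ι c * 𝔼 C F) eq) (weight-0 (𝔼 C F))) (sym (trans
      (∑-cong (λ a → trans (cong (λ c → ι c * 𝔼 (dec C a) (λ w → F (w ∷ʳ a))) (lookup≡0 C eq a)) (weight-0 _))) (∑-0 {r})))
    -- A single letter is first and last at once; the general case needs a letter at either end.
    go (suc zero) C F eq = trans (𝔼-cons C F) (∑-cong (λ a → weight-cong (lookup C a) (λ eqₐ →
      let z = ℕₚ.suc-injective (trans (sym (sum-dec C a eqₐ)) eq) in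
      trans (𝔼-nil (dec C a) (λ w → F (a ∷ w)) z) (sym (𝔼-nil (dec C a) (λ w → F (w ∷ʳ a)) z)))))
    go {r} (suc (suc M)) C F eq = *-cancel-0< (0<ι-suc M) (begin
      ι (suc M) * (ι (sum C) * 𝔼 C F)
        ≡⟨ cong (ι (suc M) *_) (𝔼-cons C F) ⟩
      ι (suc M) * ∑ (λ a → ι (lookup C a) * 𝔼 (dec C a) (λ w → F (a ∷ w)))
        ≡⟨ expand (λ a w → F (a ∷ w)) {λ a b → ι (lookup (dec C a) b) * 𝔼 (dec (dec C a) b) (λ w → F (a ∷ w ∷ʳ b))} (λ a eqₐ → go (suc M) (dec C a) _ (below a eqₐ)) ⟩
      ∑ (λ a → ∑ (λ b → ι (lookup C a) * (ι (lookup (dec C a) b) * 𝔼 (dec (dec C a) b) (λ w → F (a ∷ w ∷ʳ b)))))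
        ≡⟨ ∑-swap (λ a b → ι (lookup C a) * (ι (lookup (dec C a) b) * 𝔼 (dec (dec C a) b) (λ w → F (a ∷ w ∷ʳ b)))) ⟩
      ∑ (λ b → ∑ (λ a → ι (lookup C a) * (ι (lookup (dec C a) b) * 𝔼 (dec (dec C a) b) (λ w → F (a ∷ w ∷ʳ b)))))
        ≡⟨ ∑-cong (λ b → ∑-cong (λ a → exchange a b (λ w → F (a ∷ w ∷ʳ b)))) ⟩
      ∑ (λ b → ∑ (λ a → ι (lookup C b) * (ι (lookup (dec C b) a) * 𝔼 (dec (dec C b) a) (λ w → F (a ∷ w ∷ʳ b)))))
        ≡⟨ expand (λ b w → F (w ∷ʳ b)) {λ b a → ι (lookup (dec C b) a) * 𝔼 (dec (dec C b) a) (λ w → F (a ∷ w ∷ʳ b))} (λ b _ → 𝔼-cons (dec C b) (λ w → F (w ∷ʳ b))) ⟨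
      ι (suc M) * ∑ (λ b → ι (lookup C b) * 𝔼 (dec C b) (λ w → F (w ∷ʳ b))) ∎)
      where
      below : ∀ a {c} → lookup C a ≡ suc c → sum (dec C a) ≡ suc M
      below a eqₐ = ℕₚ.suc-injective (trans (sym (sum-dec C a eqₐ)) eq)
      expand : ∀ (G : Fin r → Word r → ℚ) {t : Fin r → Fin r → ℚ} →
        (∀ a {c} → lookup C a ≡ suc c → ι (sum (dec C a)) * 𝔼 (dec C a) (G a) ≡ ∑ (t a)) →
        ι (suc M) * ∑ (λ a → ι (lookup C a) * 𝔼 (dec C a) (G a)) ≡ ∑ (λ a → ∑ (λ b → ι (lookup C a) * t a b))
      expand G {t} h = trans (sym (∑-* (ι (suc M)) (λ a → ι (lookup C a) * 𝔼 (dec C a) (G a)))) (∑-cong (λ a → begin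
        ι (suc M) * (ι (lookup C a) * 𝔼 (dec C a) (G a))
          ≡⟨ solve 3 (λ x y z → x :* (y :* z) := y :* (x :* z)) refl (ι (suc M)) (ι (lookup C a)) (𝔼 (dec C a) (G a)) ⟩
        ι (lookup C a) * (ι (suc M) * 𝔼 (dec C a) (G a))
          ≡⟨ weight-cong (lookup C a) (λ eqₐ → trans (cong (λ N → ι N * 𝔼 (dec C a) (G a)) (sym (below a eqₐ))) (h a eqₐ)) ⟩
        ι (lookup C a) * ∑ (t a)
          ≡⟨ ∑-* (ι (lookup C a)) (t a) ⟨
        ∑ (λ b → ι (lookup C a) * t a b) ∎))
      exchange : ∀ a b G →
        ι (lookup C a) * (ι (lookup (dec C a) b) * 𝔼 (dec (dec C a) b) G) ≡
        ι (lookup C b) * (ι (lookup (dec C b) a) * 𝔼 (dec (dec C b) a) G)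
      exchange a b G = begin
        ι (lookup C a) * (ι (lookup (dec C a) b) * 𝔼 (dec (dec C a) b) G)
          ≡⟨ *-assoc (ι (lookup C a)) (ι (lookup (dec C a) b)) _ ⟨
        ι (lookup C a) * ι (lookup (dec C a) b) * 𝔼 (dec (dec C a) b) G
          ≡⟨ cong (_* 𝔼 (dec (dec C a) b) G) (ι-* (lookup C a) (lookup (dec C a) b)) ⟨
        ι (lookup C a ℕ.* lookup (dec C a) b) * 𝔼 (dec (dec C a) b) G
          ≡⟨ cong₂ (λ N D → ι N * 𝔼 D G) (lookup-dec-comm C a b) (dec-comm C a b) ⟩
        ι (lookup C b ℕ.* lookup (dec C b) a) * 𝔼 (dec (dec C b) a) G
          ≡⟨ cong (_* 𝔼 (dec (dec C b) a) G) (ι-* (lookup C b) (lookup (dec C b) a)) ⟩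
        ι (lookup C b) * ι (lookup (dec C b) a) * 𝔼 (dec (dec C b) a) G
          ≡⟨ *-assoc (ι (lookup C b)) (ι (lookup (dec C b) a)) _ ⟩
        ι (lookup C b) * (ι (lookup (dec C b) a) * 𝔼 (dec (dec C b) a) G) ∎

-- Couplings by deleting, joining and splitting letters.

module Recolouring where

  open Rationals
  open Expectation
  open import Data.Fin using (Fin; zero; suc)
  open import Data.Fin.Patterns using (0F; 1F)
  open import Data.List using ([]; _∷_)
  open import Data.Nat as ℕ using (ℕ; zero; suc; pred)
  open import Data.Nat.Properties as ℕₚ using ()
  open import Data.Rational
  open import Data.Rational.Properties
  open import Data.Rational.Solver using (module +-*-Solver)
  open import Data.Vec using ([]; _∷_; lookup; sum)
  open import Relation.Binary.PropositionalEquality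

  open +-*-Solver

  delete₁ : ∀ {n} → Word (2 ℕ.+ n) → Word (1 ℕ.+ n)
  delete₁ []                = []
  delete₁ (0F ∷ w)          = 0F ∷ delete₁ w
  delete₁ (1F ∷ w)          = delete₁ w
  delete₁ (suc (suc a) ∷ w) = suc a ∷ delete₁ w

  join₀₁ : ∀ {n} → Word (2 ℕ.+ n) → Word (1 ℕ.+ n)
  join₀₁ []                = []
  join₀₁ (0F ∷ w)          = 0F ∷ join₀₁ w
  join₀₁ (1F ∷ w)          = 0F ∷ join₀₁ w
  join₀₁ (suc (suc a) ∷ w) = suc a ∷ join₀₁ w

  embed : ∀ {n} → Fin 2 → Fin (2 ℕ.+ n)
  embed 0F = 0F
  embed 1F = 1F

  -- Meant for words u with as many letters as s has 0s; superfluous 0s of s are dropped.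
  merge : ∀ {n} → Word (1 ℕ.+ n) → Word 2 → Word (2 ℕ.+ n)
  merge []          u       = []
  merge (0F ∷ s)    (b ∷ u) = embed b ∷ merge s u
  merge (0F ∷ s)    []      = merge s []
  merge (suc a ∷ s) u       = suc (suc a) ∷ merge s u

  sum-join : ∀ m k c → m ℕ.+ (k ℕ.+ c) ≡ (m ℕ.+ k) ℕ.+ c
  sum-join m k c = sym (ℕₚ.+-assoc m k c)

  private
    below : ∀ {r} (C : Content r) a {c M} → lookup C a ≡ suc c → sum C ≡ suc M → sum (dec C a) ≡ M
    below C a eqₐ eq = ℕₚ.suc-injective (trans (sym (sum-dec C a eqₐ)) eq)

  -- Drawing a 1 does not change what `G` sees. These terms give `k` times the same mean, the others
  -- are the recursion for `m ∷ C`, and the factors add up to the full length.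
  𝔼-delete₁ : ∀ {n} m k (C : Content n) G → 𝔼 (m ∷ k ∷ C) (λ w → G (delete₁ w)) ≡ 𝔼 (m ∷ C) G
  𝔼-delete₁ m k C G = go (m ℕ.+ (k ℕ.+ sum C)) m k C G refl
    where
    open ≡-Reasoning
    go : ∀ {n} M m k (C : Content n) G → sum (m ∷ k ∷ C) ≡ M → 𝔼 (m ∷ k ∷ C) (λ w → G (delete₁ w)) ≡ 𝔼 (m ∷ C) G
    go zero m k C G eq = trans (𝔼-nil (m ∷ k ∷ C) (λ w → G (delete₁ w)) eq)
      (sym (𝔼-nil (m ∷ C) G (cong₂ ℕ._+_ (ℕₚ.m+n≡0⇒m≡0 m eq) (ℕₚ.m+n≡0⇒n≡0 k (ℕₚ.m+n≡0⇒n≡0 m eq)))))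
    go (suc M) m k C G eq = *-cancel-0< (0<sum (m ∷ k ∷ C) eq) (begin
      ι (sum (m ∷ k ∷ C)) * 𝔼 (m ∷ k ∷ C) (λ w → G (delete₁ w))
        ≡⟨ 𝔼-cons (m ∷ k ∷ C) (λ w → G (delete₁ w)) ⟩
      ι m * 𝔼 (pred m ∷ k ∷ C) (λ w → G (0F ∷ delete₁ w))
        + (ι k * 𝔼 (m ∷ pred k ∷ C) (λ w → G (delete₁ w))
        + ∑ (λ a → ι (lookup C a) * 𝔼 (m ∷ k ∷ dec C a) (λ w → G (suc a ∷ delete₁ w))))
        ≡⟨ cong₂ _+_ (weight-cong m (λ { refl → go M (pred m) k C (λ w → G (0F ∷ w)) (below (m ∷ k ∷ C) 0F refl eq) }))
           (cong₂ _+_ (weight-cong k (λ { refl → go M m (pred k) C G (below (m ∷ k ∷ C) 1F refl eq) }))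
             (∑-cong (λ a → weight-cong (lookup C a) (λ eqₐ → go M m k (dec C a) (λ w → G (suc a ∷ w)) (below (m ∷ k ∷ C) (suc (suc a)) eqₐ eq))))) ⟩
      ι m * 𝔼 (pred m ∷ C) (λ w → G (0F ∷ w))
        + (ι k * 𝔼 (m ∷ C) G
        + ∑ (λ a → ι (lookup C a) * 𝔼 (m ∷ dec C a) (λ w → G (suc a ∷ w))))
        ≡⟨ solve 3 (λ a b c → a :+ (b :+ c) := b :+ (a :+ c)) refl (ι m * 𝔼 (pred m ∷ C) (λ w → G (0F ∷ w))) (ι k * 𝔼 (m ∷ C) G)
             (∑ (λ a → ι (lookup C a) * 𝔼 (m ∷ dec C a) (λ w → G (suc a ∷ w)))) ⟩
      ι k * 𝔼 (m ∷ C) G + (ι m * 𝔼 (pred m ∷ C) (λ w → G (0F ∷ w))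
        + ∑ (λ a → ι (lookup C a) * 𝔼 (m ∷ dec C a) (λ w → G (suc a ∷ w))))
        ≡⟨ cong (ι k * 𝔼 (m ∷ C) G +_) (𝔼-cons (m ∷ C) G) ⟨
      ι k * 𝔼 (m ∷ C) G + ι (m ℕ.+ sum C) * 𝔼 (m ∷ C) G
        ≡⟨ *-distribʳ-+ (𝔼 (m ∷ C) G) (ι k) (ι (m ℕ.+ sum C)) ⟨
      (ι k + ι (m ℕ.+ sum C)) * 𝔼 (m ∷ C) G
        ≡⟨ cong (_* 𝔼 (m ∷ C) G) (trans (sym (ι-+ k (m ℕ.+ sum C))) (cong ι (trans (sym (ℕₚ.+-assoc k m (sum C)))
             (trans (cong (ℕ._+ sum C) (ℕₚ.+-comm k m)) (ℕₚ.+-assoc m k (sum C)))))) ⟩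
      ι (sum (m ∷ k ∷ C)) * 𝔼 (m ∷ C) G ∎)

  -- A possible draw of a 0 or of a 1 leaves `pred m + k` or `m + pred k`, which is the same number
  -- once the two letters are identified.
  𝔼-join₀₁ : ∀ {n} m k (C : Content n) G → 𝔼 (m ∷ k ∷ C) (λ w → G (join₀₁ w)) ≡ 𝔼 (m ℕ.+ k ∷ C) G
  𝔼-join₀₁ m k C G = go (m ℕ.+ (k ℕ.+ sum C)) m k C G refl
    where
    open ≡-Reasoning
    go : ∀ {n} M m k (C : Content n) G → sum (m ∷ k ∷ C) ≡ M → 𝔼 (m ∷ k ∷ C) (λ w → G (join₀₁ w)) ≡ 𝔼 (m ℕ.+ k ∷ C) G
    go zero m k C G eq = trans (𝔼-nil (m ∷ k ∷ C) (λ w → G (join₀₁ w)) eq)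
      (sym (𝔼-nil (m ℕ.+ k ∷ C) G (trans (sym (sum-join m k (sum C))) eq)))
    go (suc M) m k C G eq = *-cancel-0< (0<sum (m ∷ k ∷ C) eq) (begin
      ι (sum (m ∷ k ∷ C)) * 𝔼 (m ∷ k ∷ C) (λ w → G (join₀₁ w))
        ≡⟨ 𝔼-cons (m ∷ k ∷ C) (λ w → G (join₀₁ w)) ⟩
      ι m * 𝔼 (pred m ∷ k ∷ C) (λ w → G (0F ∷ join₀₁ w))
        + (ι k * 𝔼 (m ∷ pred k ∷ C) (λ w → G (0F ∷ join₀₁ w))
        + ∑ (λ a → ι (lookup C a) * 𝔼 (m ∷ k ∷ dec C a) (λ w → G (suc a ∷ join₀₁ w))))
        ≡⟨ cong₂ _+_ (weight-cong m (λ { refl → go M (pred m) k C G₀ (below (m ∷ k ∷ C) 0F refl eq) }))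
           (cong₂ _+_ (weight-cong k (λ { refl → trans (go M m (pred k) C G₀ (below (m ∷ k ∷ C) 1F refl eq))
                                                  (cong (λ j → 𝔼 (j ∷ C) G₀) (cong pred (sym (ℕₚ.+-suc m (pred k))))) }))
             (∑-cong (λ a → weight-cong (lookup C a) (λ eqₐ → go M m k (dec C a) (λ w → G (suc a ∷ w)) (below (m ∷ k ∷ C) (suc (suc a)) eqₐ eq))))) ⟩
      ι m * 𝔼 (pred (m ℕ.+ k) ∷ C) G₀ + (ι k * 𝔼 (pred (m ℕ.+ k) ∷ C) G₀ + S)
        ≡⟨ solve 4 (λ a b c d → a :* c :+ (b :* c :+ d) := (a :+ b) :* c :+ d) refl (ι m) (ι k) (𝔼 (pred (m ℕ.+ k) ∷ C) G₀) S ⟩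
      (ι m + ι k) * 𝔼 (pred (m ℕ.+ k) ∷ C) G₀ + S
        ≡⟨ cong (λ x → x * 𝔼 (pred (m ℕ.+ k) ∷ C) G₀ + S) (ι-+ m k) ⟨
      ι (m ℕ.+ k) * 𝔼 (pred (m ℕ.+ k) ∷ C) G₀ + S
        ≡⟨ 𝔼-cons (m ℕ.+ k ∷ C) G ⟨
      ι (m ℕ.+ k ℕ.+ sum C) * 𝔼 (m ℕ.+ k ∷ C) G
        ≡⟨ cong (λ x → ι x * 𝔼 (m ℕ.+ k ∷ C) G) (sum-join m k (sum C)) ⟨
      ι (sum (m ∷ k ∷ C)) * 𝔼 (m ℕ.+ k ∷ C) G ∎)
      where
      G₀ = λ w → G (0F ∷ w)
      S = ∑ (λ a → ι (lookup C a) * 𝔼 (m ℕ.+ k ∷ dec C a) (λ w → G (suc a ∷ w)))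

  𝔼-cons₂ : ∀ m k F → ι (m ℕ.+ k) * 𝔼 (m ∷ k ∷ []) F ≡
    ι m * 𝔼 (pred m ∷ k ∷ []) (λ u → F (0F ∷ u)) + ι k * 𝔼 (m ∷ pred k ∷ []) (λ u → F (1F ∷ u))
  𝔼-cons₂ m k F = trans (cong (λ j → ι (m ℕ.+ j) * 𝔼 (m ∷ k ∷ []) F) (sym (ℕₚ.+-identityʳ k)))
    (trans (𝔼-cons (m ∷ k ∷ []) F) (cong (ι m * 𝔼 (pred m ∷ k ∷ []) (λ u → F (0F ∷ u)) +_) (+-identityʳ _)))

  -- Each 0 of the skeleton `s` is coloured by the next letter of an independent two-letter word.
  -- One row of the process acts on the two-letter word alone, with the skeleton held fixed.
  𝔼-merge : ∀ {n} m k (C : Content n) F →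
    𝔼 (m ∷ k ∷ C) F ≡ 𝔼 (m ℕ.+ k ∷ C) (λ s → 𝔼 (m ∷ k ∷ []) (λ u → F (merge s u)))
  𝔼-merge m k C F = go (m ℕ.+ (k ℕ.+ sum C)) m k C F refl
    where
    open ≡-Reasoning
    go : ∀ {n} M m k (C : Content n) F → sum (m ∷ k ∷ C) ≡ M →
      𝔼 (m ∷ k ∷ C) F ≡ 𝔼 (m ℕ.+ k ∷ C) (λ s → 𝔼 (m ∷ k ∷ []) (λ u → F (merge s u)))
    go zero m k C F eq = trans (𝔼-nil (m ∷ k ∷ C) F eq) (sym (trans
      (𝔼-nil (m ℕ.+ k ∷ C) (λ s → 𝔼 (m ∷ k ∷ []) (λ u → F (merge s u))) (trans (sym (sum-join m k (sum C))) eq))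
      (𝔼-const (m ∷ k ∷ []) (F []))))
    go (suc M) m k C F eq = *-cancel-0< (0<sum (m ∷ k ∷ C) eq) (begin
      ι (sum (m ∷ k ∷ C)) * 𝔼 (m ∷ k ∷ C) F
        ≡⟨ 𝔼-cons (m ∷ k ∷ C) F ⟩
      ι m * 𝔼 (pred m ∷ k ∷ C) (λ w → F (0F ∷ w))
        + (ι k * 𝔼 (m ∷ pred k ∷ C) (λ w → F (1F ∷ w))
        + ∑ (λ a → ι (lookup C a) * 𝔼 (m ∷ k ∷ dec C a) (λ w → F (suc (suc a) ∷ w))))
        ≡⟨ cong₂ _+_ (weight-cong m (λ { refl → go M (pred m) k C (λ w → F (0F ∷ w)) (below (m ∷ k ∷ C) 0F refl eq) }))
           (cong₂ _+_ (weight-cong k (λ { refl → trans (go M m (pred k) C (λ w → F (1F ∷ w)) (below (m ∷ k ∷ C) 1F refl eq))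
                                                  (cong (λ j → 𝔼 (j ∷ C) X₁) (cong pred (sym (ℕₚ.+-suc m (pred k))))) }))
             (∑-cong (λ a → weight-cong (lookup C a) (λ eqₐ → go M m k (dec C a) (λ w → F (suc (suc a) ∷ w)) (below (m ∷ k ∷ C) (suc (suc a)) eqₐ eq))))) ⟩
      ι m * 𝔼 D X₀ + (ι k * 𝔼 D X₁ + S)
        ≡⟨ trans (sym (+-assoc (ι m * 𝔼 D X₀) (ι k * 𝔼 D X₁) S)) (cong (_+ S) (sym (begin
             ι (m ℕ.+ k) * 𝔼 D X
               ≡⟨ 𝔼-* D (ι (m ℕ.+ k)) X ⟨
             𝔼 D (λ s → ι (m ℕ.+ k) * X s)
               ≡⟨ 𝔼-cong D (λ s → 𝔼-cons₂ m k (λ u → F (merge (0F ∷ s) u))) ⟩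
             𝔼 D (λ s → ι m * X₀ s + ι k * X₁ s)
               ≡⟨ 𝔼-+ D (λ s → ι m * X₀ s) (λ s → ι k * X₁ s) ⟩
             𝔼 D (λ s → ι m * X₀ s) + 𝔼 D (λ s → ι k * X₁ s)
               ≡⟨ cong₂ _+_ (𝔼-* D (ι m) X₀) (𝔼-* D (ι k) X₁) ⟩
             ι m * 𝔼 D X₀ + ι k * 𝔼 D X₁ ∎))) ⟩
      ι (m ℕ.+ k) * 𝔼 D X + S
        ≡⟨ 𝔼-cons (m ℕ.+ k ∷ C) (λ s → 𝔼 (m ∷ k ∷ []) (λ u → F (merge s u))) ⟨
      ι (m ℕ.+ k ℕ.+ sum C) * Y
        ≡⟨ cong (λ x → ι x * Y) (sum-join m k (sum C)) ⟨
      ι (sum (m ∷ k ∷ C)) * Y ∎)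
      where
      D = pred (m ℕ.+ k) ∷ C
      X₀ = λ s → 𝔼 (pred m ∷ k ∷ []) (λ u → F (0F ∷ merge s u))
      X₁ = λ s → 𝔼 (m ∷ pred k ∷ []) (λ u → F (1F ∷ merge s u))
      X = λ s → 𝔼 (m ∷ k ∷ []) (λ u → F (merge (0F ∷ s) u))
      S = ∑ (λ a → ι (lookup C a) * 𝔼 (m ℕ.+ k ∷ dec C a) (λ s → 𝔼 (m ∷ k ∷ []) (λ u → F (suc (suc a) ∷ merge s u))))
      Y = 𝔼 (m ℕ.+ k ∷ C) (λ s → 𝔼 (m ∷ k ∷ []) (λ u → F (merge s u)))

  ∑-flips : (Word 2 → ℚ) → Word 2 → ℚ
  ∑-flips K []       = 0ℚ
  ∑-flips K (0F ∷ t) = K (1F ∷ t) + ∑-flips (λ v → K (0F ∷ v)) t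
  ∑-flips K (1F ∷ t) = ∑-flips (λ v → K (1F ∷ v)) t

  -- Double counting: a word with `pred m` 0s and `suc k` 1s arises from `suc k` words by turning
  -- one 0 into a 1, and the ratio of the numbers of words converts `suc k` into `m`.
  𝔼-flips : ∀ m k K → 𝔼 (m ∷ k ∷ []) (∑-flips K) ≡ ι m * 𝔼 (pred m ∷ suc k ∷ []) K
  𝔼-flips m k K = go (m ℕ.+ k) m k K refl
    where
    open ≡-Reasoning
    go : ∀ M m k K → m ℕ.+ k ≡ M → 𝔼 (m ∷ k ∷ []) (∑-flips K) ≡ ι m * 𝔼 (pred m ∷ suc k ∷ []) K
    go zero zero zero K eq = sym (weight-0 (𝔼 (0 ∷ 1 ∷ []) K))
    go (suc M) zero (suc k) K eq = *-cancel-0< (0<ι-suc k) (begin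
      ι (suc k) * 𝔼 (0 ∷ suc k ∷ []) (∑-flips K)
        ≡⟨ 𝔼-cons₂ 0 (suc k) (∑-flips K) ⟩
      ι 0 * 𝔼 (0 ∷ suc k ∷ []) (λ u → ∑-flips K (0F ∷ u)) + ι (suc k) * 𝔼 (0 ∷ k ∷ []) (∑-flips (λ v → K (1F ∷ v)))
        ≡⟨ cong₂ (λ x y → x + ι (suc k) * y) (weight-0 _) (trans (go M zero k (λ v → K (1F ∷ v)) (ℕₚ.suc-injective eq)) (weight-0 _)) ⟩
      0ℚ + ι (suc k) * 0ℚ
        ≡⟨ +-identityˡ _ ⟩
      ι (suc k) * 0ℚ
        ≡⟨ cong (ι (suc k) *_) (weight-0 _) ⟨
      ι (suc k) * (ι 0 * 𝔼 (0 ∷ suc (suc k) ∷ []) K) ∎)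
    go (suc M) (suc m) k K eq = *-cancel-0< (0<ι-suc (m ℕ.+ k)) (begin
      ι (suc m ℕ.+ k) * 𝔼 (suc m ∷ k ∷ []) (∑-flips K)
        ≡⟨ 𝔼-cons₂ (suc m) k (∑-flips K) ⟩
      ι (suc m) * 𝔼 (m ∷ k ∷ []) (λ u → K₁ u + ∑-flips K₀ u) + ι k * 𝔼 (suc m ∷ pred k ∷ []) (∑-flips K₁)
        ≡⟨ cong₂ (λ x y → ι (suc m) * x + y)
             (trans (𝔼-+ (m ∷ k ∷ []) K₁ (∑-flips K₀))
               (cong (𝔼 (m ∷ k ∷ []) K₁ +_) (go M m k K₀ (ℕₚ.suc-injective eq))))
             (weight-cong k (λ { refl → go M (suc m) (pred k) K₁ (trans (sym (ℕₚ.+-suc m (pred k))) (ℕₚ.suc-injective eq)) })) ⟩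
      ι (suc m) * (A + ι m * B) + ι k * (ι (suc m) * 𝔼 (m ∷ suc (pred k) ∷ []) K₁)
        ≡⟨ cong (ι (suc m) * (A + ι m * B) +_) (weight-cong k (λ { refl → refl })) ⟩
      ι (suc m) * (A + ι m * B) + ι k * (ι (suc m) * A)
        ≡⟨ solve 5 (λ s a i b j → s :* (a :+ i :* b) :+ j :* (s :* a) := s :* (i :* b :+ (con 1ℚ :+ j) :* a)) refl
             (ι (suc m)) A (ι m) B (ι k) ⟩
      ι (suc m) * (ι m * B + (1ℚ + ι k) * A)
        ≡⟨ cong (λ x → ι (suc m) * (ι m * B + x * A)) (ι-suc k) ⟨
      ι (suc m) * (ι m * B + ι (suc k) * A)
        ≡⟨ cong (ι (suc m) *_) (𝔼-cons₂ m (suc k) K) ⟨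
      ι (suc m) * (ι (m ℕ.+ suc k) * 𝔼 (m ∷ suc k ∷ []) K)
        ≡⟨ cong (λ x → ι (suc m) * (ι x * 𝔼 (m ∷ suc k ∷ []) K)) (ℕₚ.+-suc m k) ⟩
      ι (suc m) * (ι (suc m ℕ.+ k) * 𝔼 (m ∷ suc k ∷ []) K)
        ≡⟨ solve 3 (λ a b c → a :* (b :* c) := b :* (a :* c)) refl (ι (suc m)) (ι (suc m ℕ.+ k)) (𝔼 (m ∷ suc k ∷ []) K) ⟩
      ι (suc m ℕ.+ k) * (ι (suc m) * 𝔼 (m ∷ suc k ∷ []) K) ∎)
      where
      K₀ = λ v → K (0F ∷ v)
      K₁ = λ v → K (1F ∷ v)
      A = 𝔼 (m ∷ k ∷ []) K₁
      B = 𝔼 (pred m ∷ suc k ∷ []) K₀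

-- Longest increasing subsequences when the lowest row is removed.

module Chains where

  open import Defs using (sublists; IsChain; LIS)
  open Expectation using (Word)
  open import Data.Fin using (Fin; zero; suc)
  open import Data.Fin.Properties as Finₚ using ()
  open import Data.List using (List; []; _∷_; map; filter; length; foldr)
  open import Data.List.Properties using (length-map)
  open import Data.List.Membership.Propositional using (_∈_)
  open import Data.List.Membership.Propositional.Properties using (∈-++⁺ˡ; ∈-++⁺ʳ; ∈-++⁻; ∈-map⁺; ∈-map⁻; ∈-filter⁺; ∈-filter⁻)
  open import Data.List.Relation.Unary.Any using (here; there)
  open import Data.List.Relation.Unary.Linked as Linked using (Linked; []; [-]; _∷_; linked?)
  open import Data.List.Relation.Unary.Linked.Properties using (map⁺; map⁻)
  open import Data.Nat using (ℕ; zero; suc; _+_; _≤_; _⊔_; z≤n; s≤s; s≤s⁻¹)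
  open import Data.Nat.Properties
  open import Data.Product using (∃-syntax; _×_; _,_)
  open import Data.Sum using (_⊎_; inj₁; inj₂)
  open import Relation.Binary.PropositionalEquality

  maximum-≤ : ∀ {b} (ns : List ℕ) → (∀ {n} → n ∈ ns → n ≤ b) → foldr _⊔_ 0 ns ≤ b
  maximum-≤ []       h = z≤n
  maximum-≤ (n ∷ ns) h = ⊔-lub (h (here refl)) (maximum-≤ ns (λ i → h (there i)))

  ≤-maximum : ∀ {n} (ns : List ℕ) → n ∈ ns → n ≤ foldr _⊔_ 0 ns
  ≤-maximum (n ∷ ns) (here refl) = m≤m⊔n n _
  ≤-maximum (m ∷ ns) (there i)   = ≤-trans (≤-maximum ns i) (m≤n⊔m m _)

  chain? : ∀ {n} (c : Word n) → _
  chain? {n} = linked? (Finₚ._<?_ {n} {n})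

  LIS-≤ : ∀ {n b} (w : Word n) → (∀ c → c ∈ sublists w → IsChain c → length c ≤ b) → LIS w ≤ b
  LIS-≤ {b = b} w h = maximum-≤ _ go
    where
    go : ∀ {m} → m ∈ map length (filter chain? (sublists w)) → m ≤ b
    go i with ∈-map⁻ length i
    ... | c , c∈ , refl with ∈-filter⁻ chain? {xs = sublists w} c∈
    ... | c∈′ , chain = h c c∈′ chain

  length≤LIS : ∀ {n} (w c : Word n) → c ∈ sublists w → IsChain c → length c ≤ LIS w
  length≤LIS w c c∈ chain = ≤-maximum _ (∈-map⁺ length (∈-filter⁺ chain? c∈ chain))

  []∈sublists : ∀ {A : Set} (w : List A) → [] ∈ sublists w
  []∈sublists []      = here refl
  []∈sublists (x ∷ w) = ∈-++⁺ʳ (map (x ∷_) (sublists w)) ([]∈sublists w)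

  keep : ∀ {A : Set} {x : A} {c} w → c ∈ sublists w → x ∷ c ∈ sublists (x ∷ w)
  keep {x = x} w i = ∈-++⁺ˡ (∈-map⁺ (x ∷_) i)

  skip : ∀ {A : Set} {x : A} {c} w → c ∈ sublists w → c ∈ sublists (x ∷ w)
  skip {x = x} w i = ∈-++⁺ʳ (map (x ∷_) (sublists w)) i

  sublists-cons⁻ : ∀ {A : Set} {x : A} {c} w → c ∈ sublists (x ∷ w) →
    (∃[ c′ ] c ≡ x ∷ c′ × c′ ∈ sublists w) ⊎ c ∈ sublists w
  sublists-cons⁻ {x = x} w i with ∈-++⁻ (map (x ∷_) (sublists w)) i
  ... | inj₂ j = inj₂ j
  ... | inj₁ j with ∈-map⁻ (x ∷_) j
  ... | c′ , c′∈ , eq = inj₁ (c′ , eq , c′∈)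

  -- The rows above row 0, renumbered in a smaller alphabet in which the next row is again the
  -- letter 0.
  positives : ∀ {n} → Word (1 + n) → Word n
  positives []          = []
  positives (zero ∷ w)  = positives w
  positives (suc a ∷ w) = a ∷ positives w

  positives⁺ : ∀ {n} (w : Word (1 + n)) c → c ∈ sublists (positives w) → map suc c ∈ sublists w
  positives⁺ []          .[] (here refl) = here refl
  positives⁺ (zero ∷ w)  c   i           = skip w (positives⁺ w c i)
  positives⁺ (suc a ∷ w) c   i with sublists-cons⁻ (positives w) i
  ... | inj₁ (c′ , refl , j) = keep w (positives⁺ w c′ j)
  ... | inj₂ j               = skip w (positives⁺ w c j)

  positives⁻ : ∀ {n} (w : Word (1 + n)) c → map suc c ∈ sublists w → c ∈ sublists (positives w)
  positives⁻ []          []      i = here refl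
  positives⁻ []          (_ ∷ _) (here ())
  positives⁻ (zero ∷ w)  c       i with sublists-cons⁻ w i
  positives⁻ (zero ∷ w)  []      i | inj₁ (_ , () , _)
  positives⁻ (zero ∷ w)  (_ ∷ _) i | inj₁ (_ , () , _)
  ... | inj₂ j = positives⁻ w c j
  positives⁻ (suc a ∷ w) c       i with sublists-cons⁻ w i
  positives⁻ (suc a ∷ w) (_ ∷ c) i | inj₁ (_ , refl , j) = keep (positives w) (positives⁻ w c j)
  ... | inj₂ j = skip (positives w) (positives⁻ w c j)

  chain⁺ : ∀ {n} {c : Word n} → IsChain c → IsChain (map suc c)
  chain⁺ chain = map⁺ (Linked.map s≤s chain)

  chain⁻ : ∀ {n} {c : Word n} → IsChain (map suc c) → IsChain c
  chain⁻ chain = Linked.map s≤s⁻¹ (map⁻ chain)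

  chain-tail : ∀ {n x} (c : Word (1 + n)) → IsChain (x ∷ c) → ∃[ c′ ] c ≡ map suc c′
  chain-tail []          chain        = [] , refl
  chain-tail (suc y ∷ c) (_ ∷ chain) with chain-tail c chain
  ... | c′ , refl = y ∷ c′ , refl

  LIS-skip : ∀ {n} x (w : Word n) → LIS w ≤ LIS (x ∷ w)
  LIS-skip x w = LIS-≤ w (λ c i → length≤LIS (x ∷ w) c (skip w i))

  LIS-positives : ∀ {n} (w : Word (1 + n)) → LIS (positives w) ≤ LIS w
  LIS-positives w = LIS-≤ (positives w) (λ c i chain →
    subst (_≤ LIS w) (length-map suc c) (length≤LIS w (map suc c) (positives⁺ w c i) (chain⁺ chain)))

  LIS-zero⁺ : ∀ {n} (w : Word (1 + n)) → suc (LIS (positives w)) ≤ LIS (zero ∷ w)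
  LIS-zero⁺ {n} w = go (LIS (zero ∷ w)) refl
    where
    longer : ∀ c → c ∈ sublists (positives w) → IsChain c → suc (length c) ≤ LIS (zero ∷ w)
    longer c i chain = subst (λ l → suc l ≤ LIS (zero ∷ w)) (length-map suc c)
      (length≤LIS (zero ∷ w) (zero ∷ map suc c) (keep w (positives⁺ w c i)) (zero∷ c chain))
      where
      zero∷ : ∀ c → IsChain c → IsChain (zero ∷ map suc c)
      zero∷ []      _     = [-]
      zero∷ (x ∷ c) chain = s≤s z≤n ∷ chain⁺ chain
    -- `LIS-≤` needs a bound without the `suc`. The right side is generalised to `b` so that 1 can
    -- be taken off; the one-letter chain rules out `b = 0`.
    go : ∀ b → LIS (zero ∷ w) ≡ b → suc (LIS (positives w)) ≤ LIS (zero ∷ w)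
    go zero    eq with () ← subst (1 ≤_) eq (longer [] ([]∈sublists (positives w)) [])
    go (suc b) eq = subst (suc (LIS (positives w)) ≤_) (sym eq)
      (s≤s (LIS-≤ (positives w) (λ c i chain → s≤s⁻¹ (subst (suc (length c) ≤_) eq (longer c i chain)))))

  -- Giving up the first entry of a chain suffices: all later entries are positive, whether the
  -- first one was the leading 0 or a letter of `w`.
  LIS-zero⁻ : ∀ {n} (w : Word (1 + n)) → LIS (zero ∷ w) ≤ suc (LIS (positives w))
  LIS-zero⁻ w = LIS-≤ (zero ∷ w) go
    where
    go : ∀ c → c ∈ sublists (zero ∷ w) → IsChain c → length c ≤ suc (LIS (positives w))
    go []      i chain = z≤n
    go (x ∷ c) i chain with chain-tail c chain
    ... | c′ , refl = s≤s (subst (_≤ LIS (positives w)) (sym (length-map suc c′))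
      (length≤LIS (positives w) c′ (positives⁻ w c′ (tail∈ (sublists-cons⁻ w i))) (chain⁻ (Linked.tail chain))))
      where
      drop-head : ∀ {A : Set} {y : A} {d} v → y ∷ d ∈ sublists v → d ∈ sublists v
      drop-head []      (here ())
      drop-head (z ∷ v) j with sublists-cons⁻ v j
      ... | inj₁ (_ , refl , j′) = skip v j′
      ... | inj₂ j′ = skip v (drop-head v j′)
      tail∈ : (∃[ d ] x ∷ map suc c′ ≡ zero ∷ d × d ∈ sublists w) ⊎ x ∷ map suc c′ ∈ sublists w → map suc c′ ∈ sublists w
      tail∈ (inj₁ (_ , refl , j)) = j
      tail∈ (inj₂ j)              = drop-head w j

  -- A chain through the leading `suc a` contains positive letters only and survives the
  -- renumbering; every other chain lies in `w`.
  LIS-suc⁻ : ∀ {n} a (w : Word (1 + n)) → LIS (suc a ∷ w) ≤ LIS (a ∷ positives w) ⊔ LIS w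
  LIS-suc⁻ a w = LIS-≤ (suc a ∷ w) go
    where
    go : ∀ c → c ∈ sublists (suc a ∷ w) → IsChain c → length c ≤ LIS (a ∷ positives w) ⊔ LIS w
    go c i chain with sublists-cons⁻ w i
    ... | inj₂ j = ≤-trans (length≤LIS w c j chain) (m≤n⊔m (LIS (a ∷ positives w)) (LIS w))
    ... | inj₁ (c₁ , refl , j) with chain-tail c₁ chain
    ... | c′ , refl = ≤-trans (subst (_≤ LIS (a ∷ positives w)) (cong suc (sym (length-map suc c′)))
      (length≤LIS (a ∷ positives w) (a ∷ c′) (keep (positives w) (positives⁻ w c′ j)) (chain⁻ chain))) (m≤m⊔n _ (LIS w))

-- Hammersley's process on a ring, for a fixed word.

module Hammersley where

  open import Defs using (LIS)
  open Expectation using (Word)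
  open Recolouring using (delete₁; join₀₁; embed; merge)
  open Chains
  open import Data.Fin using (Fin; zero; suc; toℕ)
  open import Data.Fin.Patterns using (0F; 1F)
  open import Data.List using ([]; _∷_; _∷ʳ_; _++_; map; length)
  open import Data.Nat using (ℕ; zero; suc; _+_; _∸_; _≤_; _⊔_; z≤n; s≤s)
  open import Data.Nat.Properties
  open import Data.Product using (_×_; _,_; proj₁; proj₂)
  open import Data.Sum using (_⊎_; inj₁; inj₂)
  open import Relation.Nullary using (contradiction)
  open import Relation.Binary.PropositionalEquality

  zeros : ∀ {n} → Word (1 + n) → ℕ
  zeros []          = 0
  zeros (zero ∷ w)  = suc (zeros w)
  zeros (suc a ∷ w) = zeros w

  -- The letters 0 are sources: a chain may first collect 0s, and then must increase strictly through positive letters.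
  f : ∀ {n} → Word (1 + n) → ℕ
  f []          = 0
  f (zero ∷ w)  = suc (f w)
  f (suc a ∷ w) = LIS (a ∷ positives w) ⊔ f w

  LIS≤f : ∀ {n} (w : Word (1 + n)) → LIS (positives w) ≤ f w
  LIS≤f []          = z≤n
  LIS≤f (zero ∷ w)  = ≤-trans (LIS≤f w) (n≤1+n _)
  LIS≤f (suc a ∷ w) = m≤m⊔n _ (f w)

  zeros≤f : ∀ {n} (w : Word (1 + n)) → zeros w ≤ f w
  zeros≤f []          = z≤n
  zeros≤f (zero ∷ w)  = s≤s (zeros≤f w)
  zeros≤f (suc a ∷ w) = ≤-trans (zeros≤f w) (m≤n⊔m (LIS (a ∷ positives w)) (f w))

  f-map-suc : ∀ {n} (w : Word n) → f (map suc w) ≡ LIS w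
  f-map-suc []      = refl
  f-map-suc (a ∷ w) = begin
    LIS (a ∷ positives (map suc w)) ⊔ f (map suc w) ≡⟨ cong₂ (λ v l → LIS (a ∷ v) ⊔ l) (positives-map-suc w) (f-map-suc w) ⟩
    LIS (a ∷ w) ⊔ LIS w                             ≡⟨ m≥n⇒m⊔n≡m (LIS-skip a w) ⟩
    LIS (a ∷ w)                                     ∎
    where
    open ≡-Reasoning
    positives-map-suc : ∀ {n} (w : Word n) → positives (map suc w) ≡ w
    positives-map-suc []      = refl
    positives-map-suc (a ∷ w) = cong (a ∷_) (positives-map-suc w)

  -- One row of Hammersley's process. The letters 0 are the particles, the letters 1 the points of the row;
  -- every 0 or 1 is replaced by the 0 or 1 preceding it (c at the start), then the 1s are dropped.
  emit : ∀ {n} → Fin 2 → Word (1 + n) → Word (1 + n)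
  emit 0F v = 0F ∷ v
  emit 1F v = v

  scan : ∀ {n} → Fin 2 → Word (2 + n) → Word (1 + n)
  scan c []                = []
  scan c (0F ∷ w)          = emit c (scan 0F w)
  scan c (1F ∷ w)          = emit c (scan 1F w)
  scan c (suc (suc a) ∷ w) = suc a ∷ scan c w

  final : ∀ {n} → Fin 2 → Word (2 + n) → Fin 2
  final c []                = c
  final c (0F ∷ w)          = final 0F w
  final c (1F ∷ w)          = final 1F w
  final c (suc (suc a) ∷ w) = final c w

  -- On a ring the register at the start is the one at the end.
  wrap : ∀ {n} → Word (2 + n) → Fin 2
  wrap w = final 0F w

  -- The number of rows in which a particle crosses the origin of the ring.
  N : ∀ n → Word (1 + n) → ℕ
  N zero    w = 0
  N (suc n) w = toℕ (wrap w) + N n (scan (wrap w) w)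

  -- The final register depends on the initial one only if no 0 or 1 occurs, and then it is passed
  -- through. So the register found from the arbitrary start `0F` is consistent on the ring.
  final-wrap : ∀ {n} (w : Word (2 + n)) → final (wrap w) w ≡ wrap w
  final-wrap = go 0F
    where
    go : ∀ {n} c (w : Word (2 + n)) → final (final c w) w ≡ final c w
    go c []                = refl
    go c (0F ∷ w)          = refl
    go c (1F ∷ w)          = refl
    go c (suc (suc a) ∷ w) = go c w

  positives-emit : ∀ {n} c (v : Word (1 + n)) → positives (emit c v) ≡ positives v
  positives-emit 0F v = refl
  positives-emit 1F v = refl

  positives-scan : ∀ {n} c (w : Word (2 + n)) → positives (scan c w) ≡ positives (positives w)
  positives-scan c []                = refl
  positives-scan c (0F ∷ w)          = trans (positives-emit c (scan 0F w)) (positives-scan 0F w)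
  positives-scan c (1F ∷ w)          = trans (positives-emit c (scan 1F w)) (positives-scan 1F w)
  positives-scan c (suc (suc a) ∷ w) = cong (a ∷_) (positives-scan c w)

  -- Conservation of particles, the register included: it holds a particle when it is `0F`, which is
  -- what `1 ∸ toℕ c` counts. On the ring the two register terms cancel.
  zeros-scan : ∀ {n} c (w : Word (2 + n)) → zeros (scan c w) + (1 ∸ toℕ (final c w)) ≡ zeros w + (1 ∸ toℕ c)
  zeros-scan c  []                = refl
  zeros-scan 0F (0F ∷ w)          = cong suc (zeros-scan 0F w)
  zeros-scan 1F (0F ∷ w)          = trans (zeros-scan 0F w) (+-suc (zeros w) 0)
  zeros-scan 0F (1F ∷ w)          = trans (cong suc (zeros-scan 1F w)) (sym (+-suc (zeros w) 0))
  zeros-scan 1F (1F ∷ w)          = zeros-scan 1F w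
  zeros-scan c  (suc (suc a) ∷ w) = zeros-scan c w

  zeros-wrap : ∀ {n} (w : Word (2 + n)) → zeros (scan (wrap w) w) ≡ zeros w
  zeros-wrap w = +-cancelʳ-≡ (1 ∸ toℕ (wrap w)) _ _
    (trans (cong (λ c → zeros (scan (wrap w) w) + (1 ∸ toℕ c)) (sym (final-wrap w))) (zeros-scan (wrap w) w))

  -- One row contributes at most one point to a chain. If that point is met with register `0F`, the
  -- output gains a source there; with `1F` the summand `toℕ c` pays for it. Hence the induction
  -- over all registers.
  f≤scan : ∀ {n} c (w : Word (2 + n)) → f w ≤ toℕ c + f (scan c w)
  f≤scan c  []       = z≤n
  f≤scan 0F (0F ∷ w) = s≤s (f≤scan 0F w)
  f≤scan 1F (0F ∷ w) = s≤s (f≤scan 0F w)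
  f≤scan c  (1F ∷ w) = ≤-trans (⊔-lub
      (≤-trans (LIS-zero⁻ (positives w)) (s≤s (≤-trans (≤-reflexive (cong LIS (sym (positives-scan 1F w)))) (LIS≤f (scan 1F w)))))
      (f≤scan 1F w))
    (emitted c)
    where
    emitted : ∀ c → suc (f (scan 1F w)) ≤ toℕ c + f (emit c (scan 1F w))
    emitted 0F = ≤-refl
    emitted 1F = ≤-refl
  f≤scan c (suc (suc a) ∷ w) = ⊔-lub
    (≤-trans (LIS-suc⁻ a (positives w)) (⊔-lub
      (≤-trans (≤-reflexive (cong (λ v → LIS (a ∷ v)) (sym (positives-scan c w))))
        (≤-trans (m≤m⊔n _ (f (scan c w))) (m≤n+m _ (toℕ c))))
      (≤-trans (LIS≤f w) tail)))
    tail
    where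
    tail : f w ≤ toℕ c + f (suc a ∷ scan c w)
    tail = ≤-trans (f≤scan c w) (+-monoʳ-≤ (toℕ c) (m≤n⊔m (LIS (a ∷ positives (scan c w))) _))

  f≤zeros+N : ∀ n (w : Word (1 + n)) → f w ≤ zeros w + N n w
  f≤zeros+N zero w = ≤-trans (f≤zeros w) (m≤m+n _ 0)
    where
    f≤zeros : (w : Word 1) → f w ≤ zeros w
    f≤zeros []       = z≤n
    f≤zeros (0F ∷ w) = s≤s (f≤zeros w)
  f≤zeros+N (suc n) w = begin
    f w                                        ≤⟨ f≤scan c w ⟩
    toℕ c + f (scan c w)                       ≤⟨ +-monoʳ-≤ (toℕ c) (f≤zeros+N n (scan c w)) ⟩
    toℕ c + (zeros (scan c w) + N n (scan c w)) ≡⟨ cong (λ z → toℕ c + (z + N n (scan c w))) (zeros-wrap w) ⟩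
    toℕ c + (zeros w + N n (scan c w))         ≡⟨ +-assoc (toℕ c) (zeros w) _ ⟨
    toℕ c + zeros w + N n (scan c w)           ≡⟨ cong (_+ N n (scan c w)) (+-comm (toℕ c) (zeros w)) ⟩
    zeros w + toℕ c + N n (scan c w)           ≡⟨ +-assoc (zeros w) (toℕ c) _ ⟩
    zeros w + (toℕ c + N n (scan c w))         ∎
    where
    open ≤-Reasoning
    c = wrap w

  -- A converse of `f≤scan`. Register `1F` claims an extra unit, as if a point of the row stood to
  -- the left of `w`; the alternative `suc (LIS ...)` is the chain that starts at this imaginary
  -- point and uses no source. If a 1 is really there, as in `scan-one≤f`, the word contains that
  -- chain. Register `0F` claims nothing. The induction is mutual because each 0 or 1 changes the
  -- register.
  scan₁≤f : ∀ {n} (w : Word (2 + n)) → suc (f (scan 1F w)) ≤ f w ⊔ suc (LIS (positives (positives w)))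
  scan-one≤f : ∀ {n} (w : Word (2 + n)) → suc (f (scan 1F w)) ≤ f (1F ∷ w)
  scan₀≤f : ∀ {n} (w : Word (2 + n)) → f (scan 0F w) ≤ f w

  scan₁≤f []                = ≤-refl
  scan₁≤f (0F ∷ w)          = ≤-trans (s≤s (scan₀≤f w)) (m≤m⊔n (suc (f w)) (suc (LIS (positives (positives w)))))
  scan₁≤f (1F ∷ w)          = ≤-trans (scan-one≤f w) (m≤m⊔n (f (1F ∷ w)) (suc (LIS (positives (positives w)))))
  scan₁≤f (suc (suc a) ∷ w) = ⊔-lub
    (≤-trans (s≤s (≤-reflexive (cong (λ v → LIS (a ∷ v)) (positives-scan 1F w)))) (m≤n⊔m (f (suc (suc a) ∷ w)) _))
    (≤-trans (scan₁≤f w) (⊔-mono-≤ (m≤n⊔m (LIS (suc a ∷ positives w)) (f w)) (s≤s (LIS-skip a (positives (positives w))))))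

  scan-one≤f w = ≤-trans (scan₁≤f w) (⊔-lub (m≤n⊔m (LIS (0F ∷ positives w)) (f w))
    (≤-trans (LIS-zero⁺ (positives w)) (m≤m⊔n _ (f w))))

  scan₀≤f []                = z≤n
  scan₀≤f (0F ∷ w)          = s≤s (scan₀≤f w)
  scan₀≤f (1F ∷ w)          = scan-one≤f w
  scan₀≤f (suc (suc a) ∷ w) = ⊔-mono-≤
    (≤-trans (≤-reflexive (cong (λ v → LIS (a ∷ v)) (positives-scan 0F w))) (LIS-positives (suc a ∷ positives w)))
    (scan₀≤f w)

  -- Comparison with fewer particles.

  data _⊑_ {n} : Word (1 + n) → Word (1 + n) → Set where
    []   : [] ⊑ []
    _∷_  : ∀ x {v w} → v ⊑ w → (x ∷ v) ⊑ (x ∷ w)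
    drop : ∀ {v w} → v ⊑ w → v ⊑ (0F ∷ w)

  data _≼_ : Fin 2 → Fin 2 → Set where
    same : ∀ {c} → c ≼ c
    0≼1  : 0F ≼ 1F

  ≼⇒≤ : ∀ {c d} → c ≼ d → toℕ c ≤ toℕ d
  ≼⇒≤ same = ≤-refl
  ≼⇒≤ 0≼1  = z≤n

  positives-⊑ : ∀ {n} {v w : Word (1 + n)} → v ⊑ w → positives v ≡ positives w
  positives-⊑ []          = refl
  positives-⊑ (0F ∷ r)    = positives-⊑ r
  positives-⊑ (suc a ∷ r) = cong (a ∷_) (positives-⊑ r)
  positives-⊑ (drop r)    = positives-⊑ r

  emit-⊑ : ∀ {n c d} {v w : Word (1 + n)} → c ≼ d → v ⊑ w → emit d v ⊑ emit c w
  emit-⊑ {c = 0F} same r = 0F ∷ r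
  emit-⊑ {c = 1F} same r = r
  emit-⊑          0≼1  r = drop r

  -- Monotone coupling under the same row points: a missing particle is missing either from the
  -- output or from the register. The thinner word may thus have register `1F` against `0F`, never
  -- the reverse, and so it crosses the origin at least as often.
  scan-⊑ : ∀ {n c d} {v w : Word (2 + n)} → c ≼ d → v ⊑ w → (scan d v ⊑ scan c w) × (final c w ≼ final d v)
  scan-⊑ p [] = [] , p
  scan-⊑ p (0F ∷ r) with scan-⊑ (same {0F}) r
  ... | out , reg = emit-⊑ p out , reg
  scan-⊑ p (1F ∷ r) with scan-⊑ (same {1F}) r
  ... | out , reg = emit-⊑ p out , reg
  scan-⊑ p (suc (suc a) ∷ r) with scan-⊑ p r
  ... | out , reg = suc a ∷ out , reg
  scan-⊑ {c = 0F} same (drop r) with scan-⊑ (same {0F}) r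
  ... | out , reg = drop out , reg
  scan-⊑ {c = 1F} same (drop r) = scan-⊑ 0≼1 r
  scan-⊑ 0≼1 (drop r) with scan-⊑ 0≼1 r
  ... | out , reg = drop out , reg

  -- Either the sources or the sinks decide, and the number of sinks grows when sources are deleted.
  zeros+N≤ : ∀ n {v w : Word (1 + n)} → v ⊑ w → zeros w + N n w ≤ f w ⊔ (zeros v + N n v)
  zeros+N≤ zero {v} {w} r = ≤-trans (≤-reflexive (+-identityʳ (zeros w))) (≤-trans (zeros≤f w) (m≤m⊔n (f w) _))
  zeros+N≤ (suc n) {v} {w} r = go (wrap w) (wrap v) refl refl
    where
    open ≤-Reasoning
    go : ∀ c d → wrap w ≡ c → wrap v ≡ d → zeros w + N (suc n) w ≤ f w ⊔ (zeros v + N (suc n) v)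
    go c d refl refl = begin
      zeros w + (toℕ c + N n (scan c w))                             ≡⟨ rearrange w ⟩
      toℕ c + (zeros (scan c w) + N n (scan c w))                    ≤⟨ +-monoʳ-≤ (toℕ c) (zeros+N≤ n (proj₁ (scan-⊑ (proj₂ (scan-⊑ same r)) r))) ⟩
      toℕ c + (f (scan c w) ⊔ (zeros (scan d v) + N n (scan d v)))   ≤⟨ bound c refl (proj₂ (scan-⊑ same r)) ⟩
      f w ⊔ (toℕ d + (zeros (scan d v) + N n (scan d v)))            ≡⟨ cong (f w ⊔_) (rearrange v) ⟨
      f w ⊔ (zeros v + (toℕ d + N n (scan d v)))                     ∎
      where
      rearrange : ∀ (w : Word (2 + n)) → zeros w + (toℕ (wrap w) + N n (scan (wrap w) w)) ≡
        toℕ (wrap w) + (zeros (scan (wrap w) w) + N n (scan (wrap w) w))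
      rearrange w = trans (sym (+-assoc (zeros w) (toℕ (wrap w)) _)) (trans (cong (_+ N n (scan (wrap w) w)) (+-comm (zeros w) (toℕ (wrap w))))
        (trans (+-assoc (toℕ (wrap w)) (zeros w) _) (cong (λ z → toℕ (wrap w) + (z + N n (scan (wrap w) w))) (sym (zeros-wrap w)))))
      Y = zeros (scan d v) + N n (scan d v)
      bound : ∀ c′ → wrap w ≡ c′ → c′ ≼ d → toℕ c′ + (f (scan c′ w) ⊔ Y) ≤ f w ⊔ (toℕ d + Y)
      bound 0F eq p = ⊔-mono-≤ (scan₀≤f w) (m≤n+m Y (toℕ d))
      -- `scan₁≤f` may return a chain without sources. It lies in rows that `v` shares with `w`, so
      -- the bound for `v` covers it; the extra 1 is `toℕ d`, since `1F ≼ d` forces `d = 1F`.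
      bound 1F eq p = ⊔-lub (≤-trans (scan₁≤f w) (⊔-monoʳ-≤ (f w) (begin
          suc (LIS (positives (positives w)))  ≡⟨ cong (λ u → suc (LIS (positives u))) (positives-⊑ r) ⟨
          suc (LIS (positives (positives v)))  ≡⟨ cong (λ u → suc (LIS u)) (positives-scan d v) ⟨
          suc (LIS (positives (scan d v)))     ≤⟨ +-mono-≤ (≼⇒≤ p) (≤-trans (LIS≤f (scan d v)) (f≤zeros+N n (scan d v))) ⟩
          toℕ d + Y                            ∎)))
        (≤-trans (+-monoˡ-≤ Y (≼⇒≤ p)) (m≤n⊔m (f w) _))

  -- Effect of moving one particle to the left.

  data Insert {n} : Word (1 + n) → Word (1 + n) → Set where
    here  : ∀ {v} → Insert v (0F ∷ v)
    there : ∀ x {v w} → Insert v w → Insert (x ∷ v) (x ∷ w)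

  data First {n} : Word (1 + n) → Word (1 + n) → Set where
    here  : ∀ {v} → First v (0F ∷ v)
    there : ∀ a {v w} → First v w → First (suc a ∷ v) (suc a ∷ w)

  -- The second word arises from the first by moving a letter 0 to the left.
  data Move {n} : Word (1 + n) → Word (1 + n) → Set where
    same  : ∀ {w} → Move w w
    start : ∀ {v w} → Insert v w → Move w (0F ∷ v)
    there : ∀ x {v w} → Move v w → Move (x ∷ v) (x ∷ w)

  emit-Insert : ∀ {n} c {v w : Word (1 + n)} → Insert v w → Insert (emit c v) (emit c w)
  emit-Insert 0F i = there 0F i
  emit-Insert 1F i = i

  emit-Move : ∀ {n} c {v w : Word (1 + n)} → Move v w → Move (emit c v) (emit c w)
  emit-Move 0F m = there 0F m
  emit-Move 1F m = m

  -- From the first 0 or 1 on, the registers agree; the outputs differ only in what is emitted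
  -- there, a 0 or nothing. Without any 0 or 1 the registers stay different.
  scan₀₁ : ∀ {n} (w : Word (2 + n)) →
    (First (scan 1F w) (scan 0F w) × final 1F w ≡ final 0F w) ⊎
    (scan 1F w ≡ scan 0F w × final 1F w ≡ 1F × final 0F w ≡ 0F)
  scan₀₁ []       = inj₂ (refl , refl , refl)
  scan₀₁ (0F ∷ w) = inj₁ (here , refl)
  scan₀₁ (1F ∷ w) = inj₁ (here , refl)
  scan₀₁ (suc (suc a) ∷ w) with scan₀₁ w
  ... | inj₁ (fst , eq)  = inj₁ (there a fst , eq)
  ... | inj₂ (out , eqs) = inj₂ (cong (suc a ∷_) out , eqs)

  First⇒Insert : ∀ {n} {v w : Word (1 + n)} → First v w → Insert v w
  First⇒Insert here        = here
  First⇒Insert (there a i) = there (suc a) (First⇒Insert i)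

  scan-Insert : ∀ {n} {v w : Word (2 + n)} → Insert v w → ∀ c →
    (Insert (scan c v) (scan c w) × final c v ≡ final c w) ⊎
    (scan c v ≡ scan c w × final c v ≡ 1F × final c w ≡ 0F)
  scan-Insert here 0F = inj₁ (here , refl)
  scan-Insert {v = v} here 1F with scan₀₁ v
  ... | inj₁ (fst , eq) = inj₁ (First⇒Insert fst , eq)
  ... | inj₂ eqs        = inj₂ eqs
  scan-Insert (there 0F i) c with scan-Insert i 0F
  ... | inj₁ (out , eq)  = inj₁ (emit-Insert c out , eq)
  ... | inj₂ (out , eqs) = inj₂ (cong (emit c) out , eqs)
  scan-Insert (there 1F i) c with scan-Insert i 1F
  ... | inj₁ (out , eq)  = inj₁ (emit-Insert c out , eq)
  ... | inj₂ (out , eqs) = inj₂ (cong (emit c) out , eqs)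
  scan-Insert (there (suc (suc a)) i) c with scan-Insert i c
  ... | inj₁ (out , eq)  = inj₁ (there (suc a) out , eq)
  ... | inj₂ (out , eqs) = inj₂ (cong (suc a ∷_) out , eqs)

  -- In the second case the first system still carries the particle in its register (`0F`), while
  -- the second has already put it out, hence the `Insert`.
  Moved : ∀ {n} → Word (1 + n) → Word (1 + n) → Fin 2 → Fin 2 → Set
  Moved v w c d = (Move v w × c ≡ d) ⊎ (Insert v w × c ≡ 0F × d ≡ 1F)

  start-Moved : ∀ {n} {v w : Word (2 + n)} c → Insert v w → Moved (scan c w) (0F ∷ scan c v) (final c w) (final c v)
  start-Moved {v = v} c i with scan-Insert i c
  ... | inj₁ (out , eq)       = inj₁ (start out , sym eq)
  ... | inj₂ (out , eq₁ , eq₀) = inj₂ (subst (λ u → Insert u (0F ∷ scan c v)) out here , eq₀ , eq₁)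

  scan-start : ∀ {n} {v w : Word (2 + n)} → Insert v w → Moved (scan 1F w) (scan 0F v) (final 1F w) (final 0F v)
  scan-start here         = inj₁ (same , refl)
  scan-start (there 0F i) = start-Moved 0F i
  scan-start (there 1F i) = start-Moved 1F i
  scan-start (there (suc (suc a)) i) with scan-start i
  ... | inj₁ (m , eq)  = inj₁ (there (suc a) m , eq)
  ... | inj₂ (j , eqs) = inj₂ (there (suc a) j , eqs)

  scan-Move : ∀ {n} {v w : Word (2 + n)} → Move v w → ∀ c → Moved (scan c v) (scan c w) (final c v) (final c w)
  scan-Move same      c  = inj₁ (same , refl)
  scan-Move (start i) 0F = start-Moved 0F i
  scan-Move (start i) 1F = scan-start i
  scan-Move (there 0F m) c with scan-Move m 0F
  ... | inj₁ (m′ , eq) = inj₁ (emit-Move c m′ , eq)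
  ... | inj₂ (j , eqs) = inj₂ (emit-Insert c j , eqs)
  scan-Move (there 1F m) c with scan-Move m 1F
  ... | inj₁ (m′ , eq) = inj₁ (emit-Move c m′ , eq)
  ... | inj₂ (j , eqs) = inj₂ (emit-Insert c j , eqs)
  scan-Move (there (suc (suc a)) m) c with scan-Move m c
  ... | inj₁ (m′ , eq) = inj₁ (there (suc a) m′ , eq)
  ... | inj₂ (j , eqs) = inj₂ (there (suc a) j , eqs)

  -- Both `u` and `v` leave out one 0 of `w`, and `v` the foremost. Hence `u` is `v` with the 0 that
  -- `u` lacks moved to the place of the foremost one. This occurs when the moved particle goes
  -- round the ring.
  Insert-First : ∀ {n} {u v w : Word (1 + n)} → Insert u w → First v w → Move v u
  Insert-First here              here        = same
  Insert-First (there .0F i)     here        = start i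
  Insert-First (there (suc a) i) (there a j) = there (suc a) (Insert-First i j)

  -- When the moved particle wraps around the ring, the two words exchange their roles; this is why both bounds
  -- have to be proved together.
  N-Move : ∀ n {v w : Word (1 + n)} → Move v w → N n v ≤ N n w × N n w ≤ suc (N n v)
  N-Move zero    m = z≤n , z≤n
  N-Move (suc n) {v} {w} m with scan-Move m 0F
  ... | inj₁ (_ , eq) with scan-Move m (wrap v)
  ...   | inj₁ (m′ , _) rewrite sym eq with N-Move n m′
  ...     | lo , hi = +-monoʳ-≤ (toℕ (wrap v)) lo , ≤-trans (+-monoʳ-≤ (toℕ (wrap v)) hi) (≤-reflexive (+-suc (toℕ (wrap v)) _))
  -- Started from `0F` the runs end with equal registers, so `wrap v` and `wrap w` agree; started
  -- from this common fixed point they cannot end apart.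
  N-Move (suc n) {v} {w} m | inj₁ (_ , eq) | inj₂ (_ , eq₀ , eq₁)
    with () ← trans (sym (trans (sym (final-wrap v)) eq₀)) (trans eq (trans (sym (final-wrap w)) (trans (cong (λ c → final c w) (sym eq)) eq₁)))
  N-Move (suc n) {v} {w} m | inj₂ (i , eq₀ , eq₁) with scan₀₁ w
  ... | inj₂ (_ , _ , eq) = contradiction (trans (sym eq) eq₁) λ ()
  ... | inj₁ (fst , _) rewrite eq₀ | eq₁ with N-Move n (Insert-First i fst)
  ...   | lo , hi = hi , s≤s lo

  -- Adding families of sources.

  positives-delete₁ : ∀ {n} (w : Word (2 + n)) → positives (delete₁ w) ≡ positives (positives w)
  positives-delete₁ []                = refl
  positives-delete₁ (0F ∷ w)          = positives-delete₁ w
  positives-delete₁ (1F ∷ w)          = positives-delete₁ w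
  positives-delete₁ (suc (suc a) ∷ w) = cong (a ∷_) (positives-delete₁ w)

  positives-join₀₁ : ∀ {n} (w : Word (2 + n)) → positives (join₀₁ w) ≡ positives (positives w)
  positives-join₀₁ []                = refl
  positives-join₀₁ (0F ∷ w)          = positives-join₀₁ w
  positives-join₀₁ (1F ∷ w)          = positives-join₀₁ w
  positives-join₀₁ (suc (suc a) ∷ w) = cong (a ∷_) (positives-join₀₁ w)

  delete₁⊑join₀₁ : ∀ {n} (w : Word (2 + n)) → delete₁ w ⊑ join₀₁ w
  delete₁⊑join₀₁ []                = []
  delete₁⊑join₀₁ (0F ∷ w)          = 0F ∷ delete₁⊑join₀₁ w
  delete₁⊑join₀₁ (1F ∷ w)          = drop (delete₁⊑join₀₁ w)
  delete₁⊑join₀₁ (suc (suc a) ∷ w) = suc a ∷ delete₁⊑join₀₁ w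

  f-⊑ : ∀ {n} {v w : Word (1 + n)} → v ⊑ w → f v ≤ f w
  f-⊑ []          = z≤n
  f-⊑ (0F ∷ r)    = s≤s (f-⊑ r)
  f-⊑ (suc a ∷ r) = ⊔-mono-≤ (≤-reflexive (cong (λ u → LIS (a ∷ u)) (positives-⊑ r))) (f-⊑ r)
  f-⊑ (drop r)    = ≤-trans (f-⊑ r) (n≤1+n _)

  -- The map `l ⊔_` is convex and nondecreasing. Since `b` is the least of the four numbers and
  -- `c + d ≤ a + b` makes `a` the greatest, it preserves the inequality.
  ⊔-supermodular : ∀ l {a b c d} → b ≤ c → b ≤ d → c + d ≤ a + b → (l ⊔ c) + (l ⊔ d) ≤ (l ⊔ a) + (l ⊔ b)
  ⊔-supermodular l {a} {b} {c} {d} b≤c b≤d cd≤ab with ≤-total l b | ≤-total c l | ≤-total d l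
  ... | inj₁ l≤b | _ | _ = subst₂ _≤_
    (sym (cong₂ _+_ (m≤n⇒m⊔n≡n (≤-trans l≤b b≤c)) (m≤n⇒m⊔n≡n (≤-trans l≤b b≤d)))) refl
    (≤-trans cd≤ab (+-mono-≤ (m≤n⊔m l a) (m≤n⊔m l b)))
  ... | inj₂ b≤l | inj₁ c≤l | _ = subst₂ _≤_ (cong (_+ (l ⊔ d)) (sym (m≥n⇒m⊔n≡m c≤l))) (+-comm (l ⊔ b) (l ⊔ a))
    (+-mono-≤ (m≤m⊔n l b) (⊔-monoʳ-≤ l d≤a))
    where
    d≤a : d ≤ a
    d≤a = +-cancelˡ-≤ b d a (≤-trans (+-monoˡ-≤ d b≤c) (≤-trans cd≤ab (≤-reflexive (+-comm a b))))
  ... | inj₂ b≤l | inj₂ l≤c | inj₁ d≤l = subst (λ x → (l ⊔ c) + x ≤ (l ⊔ a) + (l ⊔ b)) (sym (m≥n⇒m⊔n≡m d≤l))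
    (+-mono-≤ (⊔-monoʳ-≤ l c≤a) (m≤m⊔n l b))
    where
    c≤a : c ≤ a
    c≤a = +-cancelʳ-≤ b c a (≤-trans (+-monoʳ-≤ c b≤d) cd≤ab)
  ... | inj₂ b≤l | inj₂ l≤c | inj₂ l≤d = subst₂ _≤_ (sym (cong₂ _+_ (m≤n⇒m⊔n≡n l≤c) (m≤n⇒m⊔n≡n l≤d))) refl
    (≤-trans cd≤ab (+-mono-≤ (m≤n⊔m l a) (m≤n⊔m l b)))

  -- Two families of sources, 1 and 2, added to the letters 0.
  f-supermodular : ∀ {n} (w : Word (3 + n)) →
    f (delete₁ (join₀₁ w)) + f (join₀₁ (delete₁ w)) ≤ f (join₀₁ (join₀₁ w)) + f (delete₁ (delete₁ w))
  f-supermodular w = proj₂ (go w)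
    where
    dj dd jd jj : ∀ {n} → Word (3 + n) → Word (1 + n)
    dj w = delete₁ (join₀₁ w)
    dd w = delete₁ (delete₁ w)
    jd w = join₀₁ (delete₁ w)
    jj w = join₀₁ (join₀₁ w)
    -- The first component is carried along because `⊔-supermodular` needs it as a hypothesis; its
    -- companion for `jd` is an instance of `f-⊑`. All four words have the same positive letters,
    -- hence the same `l` below.
    go : ∀ {n} (w : Word (3 + n)) → f (dd w) ≤ f (dj w) × f (dj w) + f (jd w) ≤ f (jj w) + f (dd w)
    go []       = z≤n , z≤n
    go (0F ∷ w) with go w
    ... | le , sm = s≤s le , s≤s (subst₂ _≤_ (sym (+-suc (f (dj w)) _)) (sym (+-suc (f (jj w)) _)) (s≤s sm))
    go (1F ∷ w) with go w
    ... | le , sm = ≤-trans le (n≤1+n _) , s≤s sm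
    go (suc (suc zero) ∷ w) with go w
    ... | le , sm = le , subst (_≤ suc (f (jj w) + f (dd w))) (sym (+-suc (f (dj w)) _)) (s≤s sm)
    go (suc (suc (suc a)) ∷ w) with go w
    ... | le , sm = ⊔-mono-≤ (≤-reflexive (trans eq-dd (sym eq-dj))) le ,
      subst₂ _≤_ (sym (cong₂ _+_ (cong (_⊔ f (dj w)) eq-dj) (cong (_⊔ f (jd w)) eq-jd)))
                 (sym (cong₂ _+_ (cong (_⊔ f (jj w)) eq-jj) (cong (_⊔ f (dd w)) eq-dd)))
        (⊔-supermodular l le (f-⊑ (delete₁⊑join₀₁ (delete₁ w))) sm)
      where
      l = LIS (a ∷ positives (positives (positives w)))
      eq-dj : LIS (a ∷ positives (dj w)) ≡ l
      eq-dj = cong (λ u → LIS (a ∷ u)) (trans (positives-delete₁ (join₀₁ w)) (cong positives (positives-join₀₁ w)))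
      eq-dd : LIS (a ∷ positives (dd w)) ≡ l
      eq-dd = cong (λ u → LIS (a ∷ u)) (trans (positives-delete₁ (delete₁ w)) (cong positives (positives-delete₁ w)))
      eq-jd : LIS (a ∷ positives (jd w)) ≡ l
      eq-jd = cong (λ u → LIS (a ∷ u)) (trans (positives-join₀₁ (delete₁ w)) (cong positives (positives-delete₁ w)))
      eq-jj : LIS (a ∷ positives (jj w)) ≡ l
      eq-jj = cong (λ u → LIS (a ∷ u)) (trans (positives-join₀₁ (join₀₁ w)) (cong positives (positives-join₀₁ w)))

  -- One row as a rotation of a two-letter word.

  lastOr : Fin 2 → Word 2 → Fin 2
  lastOr c []      = c
  lastOr c (b ∷ u) = lastOr b u

  lastOr-∷ʳ : ∀ c u b → lastOr c (u ∷ʳ b) ≡ b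
  lastOr-∷ʳ c []      b = refl
  lastOr-∷ʳ c (x ∷ u) b = lastOr-∷ʳ x u b

  final-merge : ∀ {n} c (s : Word (1 + n)) u → zeros s ≡ length u → final c (merge s u) ≡ lastOr c u
  final-merge c []          []       eq = refl
  final-merge c (0F ∷ s)    (0F ∷ u) eq = final-merge 0F s u (suc-injective eq)
  final-merge c (0F ∷ s)    (1F ∷ u) eq = final-merge 1F s u (suc-injective eq)
  final-merge c (suc a ∷ s) u        eq = final-merge c s u eq

  delete₁-embed : ∀ {n} c (v : Word (2 + n)) → delete₁ (embed c ∷ v) ≡ emit c (delete₁ v)
  delete₁-embed 0F v = refl
  delete₁-embed 1F v = refl

  -- `scan` is a delay by one letter: `u` becomes `c ∷ u` without its last letter. The surplus
  -- letter disappears by itself, as `merge` stops at the end of the skeleton.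
  scan-merge : ∀ {n} c (s : Word (1 + n)) u → zeros s ≡ length u → scan c (merge s u) ≡ delete₁ (merge s (c ∷ u))
  scan-merge c []          []       eq = refl
  scan-merge c (0F ∷ s)    (0F ∷ u) eq = trans (cong (emit c) (scan-merge 0F s u (suc-injective eq))) (sym (delete₁-embed c _))
  scan-merge c (0F ∷ s)    (1F ∷ u) eq = trans (cong (emit c) (scan-merge 1F s u (suc-injective eq))) (sym (delete₁-embed c _))
  scan-merge c (suc a ∷ s) u        eq = cong (suc a ∷_) (scan-merge c s u eq)

  merge-++ : ∀ {n} (s : Word (1 + n)) u v → zeros s ≡ length u → merge s (u ++ v) ≡ merge s u
  merge-++ []          []      v eq = refl
  merge-++ (0F ∷ s)    (b ∷ u) v eq = cong (embed b ∷_) (merge-++ s u v (suc-injective eq))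
  merge-++ (suc a ∷ s) u       v eq = cong (suc (suc a) ∷_) (merge-++ s u v eq)

  Insert-merge : ∀ {n} (s : Word (1 + n)) t₁ t₂ → zeros s ≡ length (t₁ ++ 0F ∷ t₂) →
    Insert (delete₁ (merge s (t₁ ++ 1F ∷ t₂))) (delete₁ (merge s (t₁ ++ 0F ∷ t₂)))
  Insert-merge []          []        t₂ ()
  Insert-merge []          (_ ∷ _)   t₂ ()
  Insert-merge (0F ∷ s)    []        t₂ eq = here
  Insert-merge (0F ∷ s)    (0F ∷ t₁) t₂ eq = there 0F (Insert-merge s t₁ t₂ (suc-injective eq))
  Insert-merge (0F ∷ s)    (1F ∷ t₁) t₂ eq = Insert-merge s t₁ t₂ (suc-injective eq)
  Insert-merge (suc a ∷ s) t₁        t₂ eq = there (suc a) (Insert-merge s t₁ t₂ eq)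

  -- Once the 1s are dropped, exchanging a leading 1 with a later 0 appears as a particle moving
  -- left; this links `β-correlation` to `N-Move`.
  Move-merge : ∀ {n} (s : Word (1 + n)) t₁ t₂ → zeros s ≡ suc (length (t₁ ++ 0F ∷ t₂)) →
    Move (delete₁ (merge s (1F ∷ t₁ ++ 0F ∷ t₂))) (delete₁ (merge s (0F ∷ t₁ ++ 1F ∷ t₂)))
  Move-merge (0F ∷ s)    t₁ t₂ eq = start (Insert-merge s t₁ t₂ (suc-injective eq))
  Move-merge (suc a ∷ s) t₁ t₂ eq = there (suc a) (Move-merge s t₁ t₂ eq)

-- Mean and variance of the number of crossings.

module Crossings where

  open Rationals
  open Expectation
  open Recolouring
  open Hammersley
  open import Data.Fin using (Fin; zero; suc; toℕ)
  open import Data.Fin.Patterns using (0F; 1F)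
  open import Data.List using (List; []; _∷_; _∷ʳ_; length; _++_)
  open import Data.List.Properties using (length-++)
  open import Data.Nat as ℕ using (ℕ; zero; suc; pred)
  open import Data.Nat.Properties as ℕₚ using ()
  open import Data.Product using (proj₁)
  open import Data.Rational
  open import Data.Rational.Properties
  open import Data.Rational.Solver using (module +-*-Solver)
  open import Data.Vec using ([]; _∷_; lookup; sum; replicate)
  open import Relation.Binary.PropositionalEquality

  open +-*-Solver

  first : Word 2 → Fin 2
  first []      = 0F
  first (b ∷ u) = b

  ∋⇒zeros : ∀ {n m} {C : Content n} {w} → (m ∷ C) ∋ w → zeros w ≡ m
  ∋⇒zeros {m = m} (nil eq)            = sym (ℕₚ.m+n≡0⇒m≡0 m eq)
  ∋⇒zeros (cons {a = zero} refl C∋w)  = cong suc (∋⇒zeros C∋w)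
  ∋⇒zeros (cons {a = suc a} _ C∋w)    = ∋⇒zeros C∋w

  sum₂ : ∀ m k → sum (m ∷ k ∷ []) ≡ m ℕ.+ k
  sum₂ m k = cong (m ℕ.+_) (ℕₚ.+-identityʳ k)

  -- The map (w ↦ wrap w, scan w) rotates the two-letter word of the 0s and 1s of w, hence preserves the uniform distribution.
  𝔼-rotate : ∀ {n} m k (C : Content n) (Φ : Fin 2 → Word (1 ℕ.+ n) → ℚ) →
    𝔼 (m ∷ suc k ∷ C) (λ w → Φ (wrap w) (scan (wrap w) w)) ≡
    𝔼 (m ℕ.+ suc k ∷ C) (λ s → 𝔼 (m ∷ suc k ∷ []) (λ u → Φ (first u) (delete₁ (merge s u))))
  𝔼-rotate m k C Φ = trans (𝔼-merge m (suc k) C _) (𝔼-cong-∋ (m ℕ.+ suc k ∷ C) (λ {s} C∋s → per-skeleton s (∋⇒zeros C∋s)))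
    where
    open ≡-Reasoning
    D = m ∷ suc k ∷ []
    sum≡ : sum D ≡ suc (m ℕ.+ k)
    sum≡ = trans (sum₂ m (suc k)) (ℕₚ.+-suc m k)
    per-skeleton : ∀ s → zeros s ≡ m ℕ.+ suc k →
      𝔼 D (λ u → Φ (wrap (merge s u)) (scan (wrap (merge s u)) (merge s u))) ≡
      𝔼 D (λ u → Φ (first u) (delete₁ (merge s u)))
    per-skeleton s z = *-cancel-0< (0<sum D sum≡) (begin
      ι (sum D) * 𝔼 D (λ u → Φ (wrap (merge s u)) (scan (wrap (merge s u)) (merge s u)))
        -- The left side is expanded at its last letter, which is the one that wraps, and the right
        -- side at its first; the two sums then agree term by term.
        ≡⟨ 𝔼-snoc D (λ u → Φ (wrap (merge s u)) (scan (wrap (merge s u)) (merge s u))) ⟩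
      ∑ (λ b → ι (lookup D b) * 𝔼 (dec D b) (λ u → Φ (wrap (merge s (u ∷ʳ b))) (scan (wrap (merge s (u ∷ʳ b))) (merge s (u ∷ʳ b)))))
        ≡⟨ ∑-cong (λ b → weight-cong (lookup D b) (λ eqₐ → 𝔼-cong-∋ (dec D b) (λ {u} D∋u → step b u
             (trans z (trans (sym (sum₂ m (suc k))) (trans (sum-dec D b eqₐ) (cong suc (sym (∋⇒length D∋u))))))))) ⟩
      ∑ (λ b → ι (lookup D b) * 𝔼 (dec D b) (λ u → Φ b (delete₁ (merge s (b ∷ u)))))
        ≡⟨ 𝔼-cons D (λ u → Φ (first u) (delete₁ (merge s u))) ⟨
      ι (sum D) * 𝔼 D (λ u → Φ (first u) (delete₁ (merge s u))) ∎)
      where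
      step : ∀ b u → zeros s ≡ suc (length u) →
        Φ (wrap (merge s (u ∷ʳ b))) (scan (wrap (merge s (u ∷ʳ b))) (merge s (u ∷ʳ b))) ≡ Φ b (delete₁ (merge s (b ∷ u)))
      step b u eq = begin
        Φ (wrap (merge s (u ∷ʳ b))) (scan (wrap (merge s (u ∷ʳ b))) (merge s (u ∷ʳ b)))
          ≡⟨ cong (λ c → Φ c (scan c (merge s (u ∷ʳ b)))) (trans (final-merge 0F s (u ∷ʳ b) eq′) (lastOr-∷ʳ 0F u b)) ⟩
        Φ b (scan b (merge s (u ∷ʳ b)))
          ≡⟨ cong (Φ b) (trans (scan-merge b s (u ∷ʳ b) eq′) (cong delete₁ (merge-++ s (b ∷ u) (b ∷ []) eq))) ⟩
        Φ b (delete₁ (merge s (b ∷ u))) ∎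
        where
        eq′ : zeros s ≡ length (u ∷ʳ b)
        eq′ = trans eq (sym (trans (length-++ u) (ℕₚ.+-comm (length u) 1)))

  -- The probability that the first of m letters 0 and suc k letters 1 is a 1.
  p : ℕ → ℕ → ℚ
  p m k = ι (suc k) * inv (m ℕ.+ k)

  ι*p : ∀ m k → ι (m ℕ.+ suc k) * p m k ≡ ι (suc k)
  ι*p m k = begin
    ι (m ℕ.+ suc k) * (ι (suc k) * inv (m ℕ.+ k)) ≡⟨ cong (λ x → ι x * p m k) (ℕₚ.+-suc m k) ⟩
    ι (suc (m ℕ.+ k)) * (ι (suc k) * inv (m ℕ.+ k)) ≡⟨ solve 3 (λ a b c → a :* (b :* c) := b :* (a :* c)) refl (ι (suc (m ℕ.+ k))) (ι (suc k)) (inv (m ℕ.+ k)) ⟩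
    ι (suc k) * (ι (suc (m ℕ.+ k)) * inv (m ℕ.+ k)) ≡⟨ cong (ι (suc k) *_) (ι*inv (m ℕ.+ k)) ⟩
    ι (suc k) * 1ℚ                                  ≡⟨ *-identityʳ (ι (suc k)) ⟩
    ι (suc k)                                       ∎
    where open ≡-Reasoning

  0<ι+ : ∀ m k → 0ℚ < ι (m ℕ.+ suc k)
  0<ι+ m k = subst (λ x → 0ℚ < ι x) (sym (ℕₚ.+-suc m k)) (0<ι-suc (m ℕ.+ k))

  0≤p : ∀ m k → 0ℚ ≤ p m k
  0≤p m k = *-cancel-≤-0< (0<ι+ m k) (subst₂ _≤_ (sym (*-zeroʳ (ι (m ℕ.+ suc k)))) (sym (ι*p m k)) (0≤ι (suc k)))

  β : Word 2 → ℚ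
  β u = ι (toℕ (first u))

  𝔼-β : ∀ m k → 𝔼 (m ∷ suc k ∷ []) β ≡ p m k
  𝔼-β m k = *-cancel-0< (0<ι+ m k) (begin
    ι (m ℕ.+ suc k) * 𝔼 (m ∷ suc k ∷ []) β
      ≡⟨ 𝔼-cons₂ m (suc k) β ⟩
    ι m * 𝔼 (pred m ∷ suc k ∷ []) (λ _ → ι 0) + ι (suc k) * 𝔼 (m ∷ k ∷ []) (λ _ → ι 1)
      ≡⟨ cong₂ (λ x y → ι m * x + ι (suc k) * y) (trans (𝔼-const (pred m ∷ suc k ∷ []) (ι 0)) ι-0) (trans (𝔼-const (m ∷ k ∷ []) (ι 1)) ι-1) ⟩
    ι m * 0ℚ + ι (suc k) * 1ℚ
      ≡⟨ solve 2 (λ a b → a :* con 0ℚ :+ b :* con 1ℚ := b) refl (ι m) (ι (suc k)) ⟩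
    ι (suc k)
      ≡⟨ ι*p m k ⟨
    ι (m ℕ.+ suc k) * p m k ∎)
    where open ≡-Reasoning

  ∑-flips-≥ : ∀ x K t → (∀ t₁ t₂ → t ≡ t₁ ++ 0F ∷ t₂ → x ≤ K (t₁ ++ 1F ∷ t₂)) → ι (zeros t) * x ≤ ∑-flips K t
  ∑-flips-≥ x K []       h = ≤-reflexive (weight-0 x)
  ∑-flips-≥ x K (0F ∷ t) h = begin
    ι (suc (zeros t)) * x              ≡⟨ cong (_* x) (ι-suc (zeros t)) ⟩
    (1ℚ + ι (zeros t)) * x             ≡⟨ solve 2 (λ a b → (con 1ℚ :+ a) :* b := b :+ a :* b) refl (ι (zeros t)) x ⟩
    x + ι (zeros t) * x                ≤⟨ +-mono-≤ (h [] t refl) (∑-flips-≥ x (λ v → K (0F ∷ v)) t (λ t₁ t₂ eq → h (0F ∷ t₁) t₂ (cong (0F ∷_) eq))) ⟩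
    K (1F ∷ t) + ∑-flips (λ v → K (0F ∷ v)) t ∎
    where open ≤-Reasoning
  ∑-flips-≥ x K (1F ∷ t) h = ∑-flips-≥ x (λ v → K (1F ∷ v)) t (λ t₁ t₂ eq → h (1F ∷ t₁) t₂ (cong (1F ∷_) eq))

  -- A leading 1 is exchanged with a uniformly chosen later 0, which moves that 0 to the front.
  β-correlation : ∀ m k (g : Word 2 → ℚ) →
    (∀ t₁ t₂ → suc (length (t₁ ++ 0F ∷ t₂)) ≡ m ℕ.+ suc k → g (1F ∷ t₁ ++ 0F ∷ t₂) ≤ g (0F ∷ t₁ ++ 1F ∷ t₂)) →
    𝔼 (m ∷ suc k ∷ []) (λ u → β u * g u) ≤ p m k * 𝔼 (m ∷ suc k ∷ []) g
  β-correlation m k g h = *-cancel-≤-0< (0<ι+ m k) (begin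
    ι (m ℕ.+ suc k) * 𝔼 D (λ u → β u * g u)
      ≡⟨ 𝔼-cons₂ m (suc k) (λ u → β u * g u) ⟩
    ι m * 𝔼 (pred m ∷ suc k ∷ []) (λ u → ι 0 * g (0F ∷ u)) + ι (suc k) * 𝔼 (m ∷ k ∷ []) (λ u → ι 1 * g (1F ∷ u))
      ≡⟨ cong₂ (λ x y → ι m * x + ι (suc k) * y)
           (trans (𝔼-cong (pred m ∷ suc k ∷ []) (λ u → weight-0 (g (0F ∷ u)))) (𝔼-const (pred m ∷ suc k ∷ []) 0ℚ))
           (𝔼-cong (m ∷ k ∷ []) (λ u → trans (cong (_* g (1F ∷ u)) ι-1) (*-identityˡ (g (1F ∷ u))))) ⟩
    ι m * 0ℚ + ι (suc k) * A₁
      ≡⟨ cong (λ x → ι m * 0ℚ + x * A₁) (ι*p m k) ⟨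
    ι m * 0ℚ + ι (m ℕ.+ suc k) * p m k * A₁
      ≡⟨ cong (λ x → ι m * 0ℚ + x * p m k * A₁) (ι-+ m (suc k)) ⟩
    ι m * 0ℚ + (ι m + ι (suc k)) * p m k * A₁
      ≡⟨ solve 4 (λ i j q a → i :* con 0ℚ :+ (i :+ j) :* q :* a := q :* (i :* a :+ j :* a)) refl (ι m) (ι (suc k)) (p m k) A₁ ⟩
    p m k * (ι m * A₁ + ι (suc k) * A₁)
      ≤⟨ *-monoˡ (0≤p m k) (+-monoˡ-≤ (ι (suc k) * A₁) swap) ⟩
    p m k * (ι m * A₀ + ι (suc k) * A₁)
      ≡⟨ cong (p m k *_) (𝔼-cons₂ m (suc k) g) ⟨
    p m k * (ι (m ℕ.+ suc k) * 𝔼 D g)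
      ≡⟨ solve 3 (λ a b c → a :* (b :* c) := b :* (a :* c)) refl (p m k) (ι (m ℕ.+ suc k)) (𝔼 D g) ⟩
    ι (m ℕ.+ suc k) * (p m k * 𝔼 D g) ∎)
    where
    open ≤-Reasoning
    D = m ∷ suc k ∷ []
    g₀ = λ u → g (0F ∷ u)
    g₁ = λ u → g (1F ∷ u)
    A₀ = 𝔼 (pred m ∷ suc k ∷ []) g₀
    A₁ = 𝔼 (m ∷ k ∷ []) g₁
    swap : ι m * A₁ ≤ ι m * A₀
    swap = begin
      ι m * A₁                                  ≡⟨ 𝔼-* (m ∷ k ∷ []) (ι m) g₁ ⟨
      𝔼 (m ∷ k ∷ []) (λ t → ι m * g₁ t)         ≤⟨ 𝔼-mono-∋ _ (m ∷ k ∷ []) refl (λ {t} C∋t →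
                                                     subst (λ z → ι z * g₁ t ≤ ∑-flips g₀ t) (∋⇒zeros C∋t)
                                                       (∑-flips-≥ (g₁ t) g₀ t (λ { t₁ t₂ refl → h t₁ t₂
                                                         (trans (cong suc (trans (∋⇒length C∋t) (sum₂ m k))) (sym (ℕₚ.+-suc m k))) }))) ⟩
      𝔼 (m ∷ k ∷ []) (∑-flips g₀)               ≡⟨ 𝔼-flips m k g₀ ⟩
      ι m * A₀                                  ∎

  rows : ℕ → ℕ → ∀ n → Content (1 ℕ.+ n)
  rows m k n = m ∷ replicate n (suc k)

  module _ {n} (m k : ℕ) (C : Content n) where

    -- The two stages of `𝔼-merge`: a skeleton, then an independent word of 0s and 1s that fills its
    -- 0s.
    𝔼² : (Word (1 ℕ.+ n) → Word 2 → ℚ) → ℚ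
    𝔼² F = 𝔼 (m ℕ.+ suc k ∷ C) (λ s → 𝔼 (m ∷ suc k ∷ []) (F s))

    𝔼²-+ : ∀ F G → 𝔼² (λ s u → F s u + G s u) ≡ 𝔼² F + 𝔼² G
    𝔼²-+ F G = trans (𝔼-cong (m ℕ.+ suc k ∷ C) (λ s → 𝔼-+ (m ∷ suc k ∷ []) (F s) (G s))) (𝔼-+ (m ℕ.+ suc k ∷ C) (λ s → 𝔼 (m ∷ suc k ∷ []) (F s)) (λ s → 𝔼 (m ∷ suc k ∷ []) (G s)))

    𝔼²-* : ∀ c F → 𝔼² (λ s u → c * F s u) ≡ c * 𝔼² F
    𝔼²-* c F = trans (𝔼-cong (m ℕ.+ suc k ∷ C) (λ s → 𝔼-* (m ∷ suc k ∷ []) c (F s))) (𝔼-* (m ℕ.+ suc k ∷ C) c (λ s → 𝔼 (m ∷ suc k ∷ []) (F s)))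

    𝔼²-const : ∀ c → 𝔼² (λ _ _ → c) ≡ c
    𝔼²-const c = trans (𝔼-cong (m ℕ.+ suc k ∷ C) (λ s → 𝔼-const (m ∷ suc k ∷ []) c)) (𝔼-const (m ℕ.+ suc k ∷ C) c)

    𝔼²-β : 𝔼² (λ _ u → β u) ≡ p m k
    𝔼²-β = trans (𝔼-cong (m ℕ.+ suc k ∷ C) (λ s → 𝔼-β m k)) (𝔼-const (m ℕ.+ suc k ∷ C) (p m k))

    𝔼²-thin : ∀ G → 𝔼² (λ s u → G (delete₁ (merge s u))) ≡ 𝔼 (m ∷ C) G
    𝔼²-thin G = trans (sym (𝔼-merge m (suc k) C (λ w → G (delete₁ w)))) (𝔼-delete₁ m (suc k) C G)

  -- After one row, the particles and the remaining rows are again uniformly distributed by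
  -- `𝔼²-thin`, so every row contributes the same `p m k`.
  𝔼-N : ∀ m k n → 𝔼 (rows m k n) (λ w → ι (N n w)) ≡ ι n * p m k
  𝔼-N m k zero    = trans (𝔼-const (rows m k 0) (ι 0)) (trans ι-0 (sym (weight-0 (p m k))))
  𝔼-N m k (suc n) = begin
    𝔼 (rows m k (suc n)) (λ w → ι (N (suc n) w))
      ≡⟨ 𝔼-rotate m k C (λ b v → ι (toℕ b ℕ.+ N n v)) ⟩
    𝔼² m k C (λ s u → ι (toℕ (first u) ℕ.+ N n (delete₁ (merge s u))))
      ≡⟨ 𝔼-cong (m ℕ.+ suc k ∷ C) (λ s → 𝔼-cong (m ∷ suc k ∷ []) (λ u → ι-+ (toℕ (first u)) (N n (delete₁ (merge s u))))) ⟩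
    𝔼² m k C (λ s u → β u + ι (N n (delete₁ (merge s u))))
      ≡⟨ 𝔼²-+ m k C (λ _ u → β u) (λ s u → ι (N n (delete₁ (merge s u)))) ⟩
    𝔼² m k C (λ _ u → β u) + 𝔼² m k C (λ s u → ι (N n (delete₁ (merge s u))))
      ≡⟨ cong₂ _+_ (𝔼²-β m k C) (trans (𝔼²-thin m k C (λ v → ι (N n v))) (𝔼-N m k n)) ⟩
    p m k + ι n * p m k
      ≡⟨ solve 2 (λ i q → q :+ i :* q := (con 1ℚ :+ i) :* q) refl (ι n) (p m k) ⟩
    (1ℚ + ι n) * p m k
      ≡⟨ cong (_* p m k) (ι-suc n) ⟨
    ι (suc n) * p m k ∎
    where
    open ≡-Reasoning
    C = replicate n (suc k)

  -- N is a sum of negatively correlated Bernoulli variables.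
  Var-N : ∀ m k n → 𝔼 (rows m k n) (λ w → (ι (N n w) - ι n * p m k) * (ι (N n w) - ι n * p m k)) ≤ ι n * p m k
  Var-N m k zero = ≤-reflexive (trans (𝔼-const (rows m k 0) ((ι 0 - ι 0 * p m k) * (ι 0 - ι 0 * p m k)))
    (trans (cong (λ x → (x - x * p m k) * (x - x * p m k)) ι-0)
      (trans (solve 1 (λ q → (con 0ℚ :- con 0ℚ :* q) :* (con 0ℚ :- con 0ℚ :* q) := con 0ℚ) refl (p m k)) (sym (weight-0 (p m k))))))
  Var-N m k (suc n) = begin
    𝔼 (rows m k (suc n)) (λ w → sq (ι (N (suc n) w) - ι (suc n) * q))
      ≡⟨ 𝔼-rotate m k C (λ b v → sq (ι (toℕ b ℕ.+ N n v) - ι (suc n) * q)) ⟩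
    𝔼² m k C (λ s u → sq (ι (toℕ (first u) ℕ.+ N n (delete₁ (merge s u))) - ι (suc n) * q))
      ≡⟨ 𝔼-cong (m ℕ.+ suc k ∷ C) (λ s → 𝔼-cong (m ∷ suc k ∷ []) (λ u → expand u (N n (delete₁ (merge s u))))) ⟩
    𝔼² m k C (λ s u → Y s u + (a * β u + (two * (β u * X s u) + (b * X s u + c))))
      ≡⟨ linear ⟩
    𝔼² m k C Y + (a * 𝔼² m k C (λ _ u → β u) + (two * 𝔼² m k C (λ s u → β u * X s u) + (b * 𝔼² m k C X + c)))
      ≡⟨ cong₂ (λ v rest → v + rest) (𝔼²-thin m k C (λ v → sq (ι (N n v) - μ)))
           (cong₂ (λ x y → a * x + (two * 𝔼² m k C (λ s u → β u * X s u) + (b * y + c))) (𝔼²-β m k C) 𝔼²-X) ⟩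
    V + (a * q + (two * 𝔼² m k C (λ s u → β u * X s u) + (b * μ + c)))
      ≤⟨ +-mono-≤ (Var-N m k n) (+-monoʳ-≤ (a * q) (+-monoˡ-≤ (b * μ + c) (*-monoˡ (0≤ι 2) correlation))) ⟩
    μ + (a * q + (two * (q * μ) + (b * μ + c)))
      -- `two` is the opaque `ι 2` and a variable for the solver; hence a factor `two - 1ℚ`, which
      -- is evaluated next.
      ≡⟨ solve 3 (λ t μ q → μ :+ ((con 1ℚ :- t :* q :- t :* μ) :* q :+ (t :* (q :* μ) :+ ((:- (t :* q)) :* μ :+ (q :* q :+ t :* (μ :* q)))))
           := (μ :+ q) :+ (:- ((t :- con 1ℚ) :* (q :* q)))) refl two μ q ⟩
    (μ + q) + - ((two - 1ℚ) * (q * q))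
      ≡⟨ cong (λ t → (μ + q) + - (t * (q * q))) (trans (cong (_- 1ℚ) (trans (ι-suc 1) (cong (1ℚ +_) ι-1))) refl) ⟩
    (μ + q) + - (1ℚ * (q * q))
      -- The exact variance `q - q²` of one crossing is relaxed to `q`.
      ≤⟨ +-monoʳ-≤ (μ + q) (neg-antimono-≤ (subst (0ℚ ≤_) (sym (*-identityˡ (q * q))) (0≤sq q))) ⟩
    (μ + q) + 0ℚ
      ≡⟨ solve 2 (λ i q → (i :* q :+ q) :+ con 0ℚ := (con 1ℚ :+ i) :* q) refl (ι n) q ⟩
    (1ℚ + ι n) * q
      ≡⟨ cong (_* q) (ι-suc n) ⟨
    ι (suc n) * q ∎
    where
    open ≤-Reasoning
    C = replicate n (suc k)
    q = p m k
    μ = ι n * q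
    two = ι 2
    sq : ℚ → ℚ
    sq x = x * x
    V = 𝔼 (rows m k n) (λ w → sq (ι (N n w) - μ))
    X Y : Word (1 ℕ.+ n) → Word 2 → ℚ
    X s u = ι (N n (delete₁ (merge s u)))
    Y s u = sq (X s u - μ)
    a = 1ℚ - two * q - two * μ
    b = - (two * q)
    c = q * q + two * (μ * q)
    bit² : ∀ d → ι (toℕ {2} d) * ι (toℕ d) ≡ ι (toℕ d)
    bit² 0F = trans (weight-0 (ι 0)) (sym ι-0)
    bit² 1F = trans (cong (_* ι 1) ι-1) (*-identityˡ (ι 1))
    expand : ∀ u N′ → sq (ι (toℕ (first u) ℕ.+ N′) - ι (suc n) * q) ≡
      sq (ι N′ - μ) + (a * β u + (two * (β u * ι N′) + (b * ι N′ + c)))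
    expand u N′ = begin-equality
      sq (ι (toℕ (first u) ℕ.+ N′) - ι (suc n) * q)
        ≡⟨ cong₂ (λ x y → sq (x - y * q)) (ι-+ (toℕ (first u)) N′) (ι-suc n) ⟩
      sq (β u + ι N′ - (1ℚ + ι n) * q)
        ≡⟨ solve 4 (λ b x i q → (b :+ x :- (con 1ℚ :+ i) :* q) :* (b :+ x :- (con 1ℚ :+ i) :* q) :=
             b :* b :+ ((x :- i :* q) :* (x :- i :* q) :+ (q :* q :+ (con 1ℚ :+ con 1ℚ) :* (b :* x) :- (con 1ℚ :+ con 1ℚ) :* (q :* b) :- (con 1ℚ :+ con 1ℚ) :* ((i :* q) :* b)
               :- (con 1ℚ :+ con 1ℚ) :* (q :* x) :+ (con 1ℚ :+ con 1ℚ) :* ((i :* q) :* q)))) refl (β u) (ι N′) (ι n) q ⟩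
      β u * β u + (sq (ι N′ - μ) + (q * q + 2ℚ * (β u * ι N′) - 2ℚ * (q * β u) - 2ℚ * (μ * β u) - 2ℚ * (q * ι N′) + 2ℚ * (μ * q)))
        ≡⟨ cong₂ (λ b₂ t → b₂ + (sq (ι N′ - μ) + (q * q + t * (β u * ι N′) - t * (q * β u) - t * (μ * β u) - t * (q * ι N′) + t * (μ * q))))
             (bit² (first u)) (sym two≡) ⟩
      β u + (sq (ι N′ - μ) + (q * q + two * (β u * ι N′) - two * (q * β u) - two * (μ * β u) - two * (q * ι N′) + two * (μ * q)))
        ≡⟨ solve 6 (λ b y x q μ t → b :+ (y :+ (q :* q :+ t :* (b :* x) :- t :* (q :* b) :- t :* (μ :* b) :- t :* (q :* x) :+ t :* (μ :* q))) :=
             y :+ ((con 1ℚ :- t :* q :- t :* μ) :* b :+ (t :* (b :* x) :+ ((:- (t :* q)) :* x :+ (q :* q :+ t :* (μ :* q))))))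
             refl (β u) (sq (ι N′ - μ)) (ι N′) q μ two ⟩
      sq (ι N′ - μ) + (a * β u + (two * (β u * ι N′) + (b * ι N′ + c))) ∎
      where
      2ℚ : ℚ
      2ℚ = 1ℚ + 1ℚ
      two≡ : two ≡ 2ℚ
      two≡ = trans (ι-suc 1) (cong (1ℚ +_) ι-1)
    linear : 𝔼² m k C (λ s u → Y s u + (a * β u + (two * (β u * X s u) + (b * X s u + c)))) ≡
      𝔼² m k C Y + (a * 𝔼² m k C (λ _ u → β u) + (two * 𝔼² m k C (λ s u → β u * X s u) + (b * 𝔼² m k C X + c)))
    linear = begin-equality
      𝔼² m k C (λ s u → Y s u + (a * β u + (two * (β u * X s u) + (b * X s u + c))))
        ≡⟨ 𝔼²-+ m k C Y (λ s u → a * β u + (two * (β u * X s u) + (b * X s u + c))) ⟩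
      𝔼² m k C Y + 𝔼² m k C (λ s u → a * β u + (two * (β u * X s u) + (b * X s u + c)))
        ≡⟨ cong (𝔼² m k C Y +_) (trans (𝔼²-+ m k C (λ _ u → a * β u) (λ s u → two * (β u * X s u) + (b * X s u + c)))
             (cong₂ _+_ (𝔼²-* m k C a (λ _ u → β u))
               (trans (𝔼²-+ m k C (λ s u → two * (β u * X s u)) (λ s u → b * X s u + c))
                 (cong₂ _+_ (𝔼²-* m k C two (λ s u → β u * X s u))
                   (trans (𝔼²-+ m k C (λ s u → b * X s u) (λ _ _ → c))
                     (cong₂ _+_ (𝔼²-* m k C b X) (𝔼²-const m k C c))))))) ⟩
      𝔼² m k C Y + (a * 𝔼² m k C (λ _ u → β u) + (two * 𝔼² m k C (λ s u → β u * X s u) + (b * 𝔼² m k C X + c))) ∎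
    𝔼²-X : 𝔼² m k C X ≡ μ
    𝔼²-X = trans (𝔼²-thin m k C (λ v → ι (N n v))) (𝔼-N m k n)
    correlation : 𝔼² m k C (λ s u → β u * X s u) ≤ q * μ
    correlation = begin
      𝔼² m k C (λ s u → β u * X s u)
        -- Exchanging the leading 1 of a crossing with a later 0 moves a particle to the left, which
        -- by the lower half of `N-Move` never decreases the crossings in later rows.
        ≤⟨ 𝔼-mono-∋ _ (m ℕ.+ suc k ∷ C) refl (λ {s} C∋s → β-correlation m k (X s) (λ t₁ t₂ eq →
             ι-mono (proj₁ (N-Move n (Move-merge s t₁ t₂ (trans (∋⇒zeros C∋s) (sym eq))))))) ⟩
      𝔼 (m ℕ.+ suc k ∷ C) (λ s → q * 𝔼 (m ∷ suc k ∷ []) (X s))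
        ≡⟨ 𝔼-* (m ℕ.+ suc k ∷ C) q (λ s → 𝔼 (m ∷ suc k ∷ []) (X s)) ⟩
      q * 𝔼² m k C X
        ≡⟨ cong (q *_) 𝔼²-X ⟩
      q * μ ∎

-- Mean chain lengths as functions of the number of sources.

module Boundary where

  open Rationals
  open Expectation
  open Recolouring
  open Hammersley
  open Crossings
  open import Data.List using ([]; _∷_)
  open import Data.Nat as ℕ using (ℕ; suc)
  open import Data.Rational
  open import Data.Rational.Properties
  open import Data.Rational.Solver using (module +-*-Solver)
  open import Data.Vec using ([]; _∷_; replicate)
  open import Relation.Binary.PropositionalEquality

  open +-*-Solver

  F : (m k n : ℕ) → ℚ
  F m k n = 𝔼 (rows m k n) (λ w → ι (f w))

  U : (m k n : ℕ) → ℚ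
  U m k n = ι m + ι n * p m k

  𝔼-zeros+N : ∀ m k n → 𝔼 (rows m k n) (λ w → ι (zeros w ℕ.+ N n w)) ≡ U m k n
  𝔼-zeros+N m k n = begin
    𝔼 (rows m k n) (λ w → ι (zeros w ℕ.+ N n w))
      ≡⟨ 𝔼-cong-∋ (rows m k n) (λ {w} C∋w → trans (ι-+ (zeros w) (N n w)) (cong (λ z → ι z + ι (N n w)) (∋⇒zeros C∋w))) ⟩
    𝔼 (rows m k n) (λ w → ι m + ι (N n w))
      ≡⟨ 𝔼-+ (rows m k n) (λ _ → ι m) (λ w → ι (N n w)) ⟩
    𝔼 (rows m k n) (λ _ → ι m) + 𝔼 (rows m k n) (λ w → ι (N n w))
      ≡⟨ cong₂ _+_ (𝔼-const (rows m k n) (ι m)) (𝔼-N m k n) ⟩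
    U m k n ∎
    where open ≡-Reasoning

  F≤U : ∀ m k n → F m k n ≤ U m k n
  F≤U m k n = ≤-trans (𝔼-mono (rows m k n) (λ w → ι-mono (f≤zeros+N n w))) (≤-reflexive (𝔼-zeros+N m k n))

  F-mono : ∀ m d k n → F m k n ≤ F (m ℕ.+ d) k n
  F-mono m d k n = begin
    F m k n                                               ≡⟨ 𝔼-delete₁ m d K (λ w → ι (f w)) ⟨
    𝔼 (m ∷ d ∷ K) (λ w → ι (f (delete₁ w)))               ≤⟨ 𝔼-mono (m ∷ d ∷ K) (λ w → ι-mono (f-⊑ (delete₁⊑join₀₁ w))) ⟩
    𝔼 (m ∷ d ∷ K) (λ w → ι (f (join₀₁ w)))                ≡⟨ 𝔼-join₀₁ m d K (λ w → ι (f w)) ⟩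
    F (m ℕ.+ d) k n                                       ∎
    where
    open ≤-Reasoning
    K = replicate n (suc k)

  -- One word with three kinds of sources realises all four means. The family `s` makes it
  -- worthwhile to leave the sources later, which can only increase what the family `t` adds. This
  -- is convexity in the number of sources.
  F-supermodular : ∀ a s t k n → F (a ℕ.+ s) k n + F (a ℕ.+ t) k n ≤ F (a ℕ.+ s ℕ.+ t) k n + F a k n
  F-supermodular a s t k n = begin
    F (a ℕ.+ s) k n + F (a ℕ.+ t) k n
      ≡⟨ cong₂ _+_ (trans (𝔼-join₀₁ a s (t ∷ K) (λ w → ι (f (delete₁ w)))) (𝔼-delete₁ (a ℕ.+ s) t K (λ w → ι (f w))))
                   (trans (𝔼-delete₁ a s (t ∷ K) (λ w → ι (f (join₀₁ w)))) (𝔼-join₀₁ a t K (λ w → ι (f w)))) ⟨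
    𝔼 C (λ w → ι (f (delete₁ (join₀₁ w)))) + 𝔼 C (λ w → ι (f (join₀₁ (delete₁ w))))
      ≡⟨ 𝔼-+ C (λ w → ι (f (delete₁ (join₀₁ w)))) (λ w → ι (f (join₀₁ (delete₁ w)))) ⟨
    𝔼 C (λ w → ι (f (delete₁ (join₀₁ w))) + ι (f (join₀₁ (delete₁ w))))
      ≤⟨ 𝔼-mono C (λ w → subst₂ _≤_ (ι-+ (f (delete₁ (join₀₁ w))) (f (join₀₁ (delete₁ w))))
           (ι-+ (f (join₀₁ (join₀₁ w))) (f (delete₁ (delete₁ w)))) (ι-mono (f-supermodular w))) ⟩
    𝔼 C (λ w → ι (f (join₀₁ (join₀₁ w))) + ι (f (delete₁ (delete₁ w))))
      ≡⟨ 𝔼-+ C (λ w → ι (f (join₀₁ (join₀₁ w)))) (λ w → ι (f (delete₁ (delete₁ w)))) ⟩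
    𝔼 C (λ w → ι (f (join₀₁ (join₀₁ w)))) + 𝔼 C (λ w → ι (f (delete₁ (delete₁ w))))
      ≡⟨ cong₂ _+_ (trans (𝔼-join₀₁ a s (t ∷ K) (λ w → ι (f (join₀₁ w)))) (𝔼-join₀₁ (a ℕ.+ s) t K (λ w → ι (f w))))
                   (trans (𝔼-delete₁ a s (t ∷ K) (λ w → ι (f (delete₁ w)))) (𝔼-delete₁ a t K (λ w → ι (f w)))) ⟩
    F (a ℕ.+ s ℕ.+ t) k n + F a k n ∎
    where
    open ≤-Reasoning
    K = replicate n (suc k)
    C = a ∷ s ∷ t ∷ K

  sq : ℚ → ℚ
  sq x = x * x

  Var-zeros+N : ∀ m k n → 𝔼 (rows m k n) (λ w → sq (ι (zeros w ℕ.+ N n w) - U m k n)) ≤ ι n * p m k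
  Var-zeros+N m k n = ≤-trans (≤-reflexive (𝔼-cong-∋ (rows m k n) (λ {w} C∋w → cong sq (begin
      ι (zeros w ℕ.+ N n w) - U m k n        ≡⟨ cong (λ x → x - U m k n) (trans (ι-+ (zeros w) (N n w)) (cong (λ z → ι z + ι (N n w)) (∋⇒zeros C∋w))) ⟩
      ι m + ι (N n w) - (ι m + ι n * p m k)  ≡⟨ solve 3 (λ a b c → a :+ b :- (a :+ c) := b :- c) refl (ι m) (ι (N n w)) (ι n * p m k) ⟩
      ι (N n w) - ι n * p m k                ∎))))
    (Var-N m k n)
    where open ≡-Reasoning

  -- For m = m′ + d the ring with m particles is decided by its sources, unless the ring with only m′ particles has at least
  -- as long a chain; the latter is excluded by Chebyshev's inequality.
  U-F≤ : ∀ m′ d k n c → 0ℚ ≤ c →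
    (∀ z x y → z ℕ.≤ x ℕ.⊔ y → ι z - ι x ≤ c * (sq (ι z - U (m′ ℕ.+ d) k n) + sq (ι y - U m′ k n))) →
    U (m′ ℕ.+ d) k n - F (m′ ℕ.+ d) k n ≤ c * (ι n * p (m′ ℕ.+ d) k + ι n * p m′ k)
  U-F≤ m′ d k n c 0≤c h = begin
    U m k n - F m k n
      ≡⟨ solve 2 (λ a b → a :- b := a :+ (:- con 1ℚ) :* b) refl (U m k n) (F m k n) ⟩
    U m k n + (- 1ℚ) * F m k n
      ≡⟨ cong₂ (λ x y → x + (- 1ℚ) * y) (trans (𝔼-join₀₁ m′ d K Z) (𝔼-zeros+N m k n)) (𝔼-join₀₁ m′ d K (λ w → ι (f w))) ⟨
    𝔼 C (λ w → Z (join₀₁ w)) + (- 1ℚ) * 𝔼 C (λ w → ι (f (join₀₁ w)))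
      ≡⟨ cong (𝔼 C (λ w → Z (join₀₁ w)) +_) (𝔼-* C (- 1ℚ) (λ w → ι (f (join₀₁ w)))) ⟨
    𝔼 C (λ w → Z (join₀₁ w)) + 𝔼 C (λ w → (- 1ℚ) * ι (f (join₀₁ w)))
      ≡⟨ 𝔼-+ C (λ w → Z (join₀₁ w)) (λ w → (- 1ℚ) * ι (f (join₀₁ w))) ⟨
    𝔼 C (λ w → Z (join₀₁ w) + (- 1ℚ) * ι (f (join₀₁ w)))
      ≤⟨ 𝔼-mono C (λ w → ≤-trans (≤-reflexive (solve 2 (λ a b → a :+ (:- con 1ℚ) :* b := a :- b) refl (Z (join₀₁ w)) (ι (f (join₀₁ w)))))
           (h (zeros (join₀₁ w) ℕ.+ N n (join₀₁ w)) (f (join₀₁ w)) (zeros (delete₁ w) ℕ.+ N n (delete₁ w)) (zeros+N≤ n (delete₁⊑join₀₁ w)))) ⟩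
    𝔼 C (λ w → c * (sq (Z (join₀₁ w) - U m k n) + sq (Z (delete₁ w) - U m′ k n)))
      ≡⟨ 𝔼-* C c (λ w → sq (Z (join₀₁ w) - U m k n) + sq (Z (delete₁ w) - U m′ k n)) ⟩
    c * 𝔼 C (λ w → sq (Z (join₀₁ w) - U m k n) + sq (Z (delete₁ w) - U m′ k n))
      ≡⟨ cong (c *_) (trans (𝔼-+ C (λ w → sq (Z (join₀₁ w) - U m k n)) (λ w → sq (Z (delete₁ w) - U m′ k n)))
           (cong₂ _+_ (𝔼-join₀₁ m′ d K (λ w → sq (Z w - U m k n))) (𝔼-delete₁ m′ d K (λ w → sq (Z w - U m′ k n))))) ⟩
    c * (𝔼 (rows m k n) (λ w → sq (Z w - U m k n)) + 𝔼 (rows m′ k n) (λ w → sq (Z w - U m′ k n)))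
      ≤⟨ *-monoˡ 0≤c (+-mono-≤ (Var-zeros+N m k n) (Var-zeros+N m′ k n)) ⟩
    c * (ι n * p m k + ι n * p m′ k) ∎
    where
    open ≤-Reasoning
    m = m′ ℕ.+ d
    K = replicate n (suc k)
    C = m′ ∷ d ∷ K
    Z : Word (1 ℕ.+ n) → ℚ
    Z w = ι (zeros w ℕ.+ N n w)

  0≤F : ∀ m k n → 0ℚ ≤ F m k n
  0≤F m k n = subst (_≤ F m k n) (𝔼-const (rows m k n) 0ℚ) (𝔼-mono (rows m k n) (λ w → 0≤ι (f w)))

-- The sequential mean as the average over all multiset permutations.

module Counting where

  open import Defs using (words; count; multPerms; LIS; mean; expectedLIS)
  open Rationals
  open Expectation
  open Hammersley using (f; f-map-suc)
  open Boundary using (F)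
  open import Data.Fin as Fin using (Fin; zero; suc)
  open import Data.Integer as ℤ using (+_)
  open import Data.Integer.Properties as ℤₚ using ()
  open import Data.List using (List; []; _∷_; _++_; map; concatMap; filter; length; allFin; tabulate)
  open import Data.Nat.ListAction using () renaming (sum to sumₗ)
  open import Data.List.Membership.Propositional.Properties using (∈-allFin)
  open import Data.List.Properties using (filter-accept; filter-reject)
  open import Data.List.Relation.Unary.All as All using (All; []; _∷_; all?)
  open import Data.List.Relation.Unary.All.Properties as Allₚ using ()
  open import Data.Nat as ℕ using (ℕ; zero; suc; pred; _!)
  open import Data.Nat.Properties as ℕₚ using ()
  open import Data.Rational
  open import Data.Rational.Properties
  open import Data.Rational.Solver using (module +-*-Solver)
  open import Data.Rational.Unnormalised as ℚᵘ using (mkℚᵘ; *≡*)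
  open import Data.Rational.Unnormalised.Properties as ℚᵘₚ using ()
  open import Data.Sum using (_⊎_; inj₁; inj₂)
  open import Data.Vec using (Vec; []; _∷_; lookup; sum; replicate)
  open import Data.Vec.Properties using (lookup-replicate)
  open import Relation.Nullary using (¬_; Dec; yes; no; contradiction)
  open import Relation.Unary using (Decidable)
  open import Relation.Binary.PropositionalEquality

  open +-*-Solver

  𝔼-map-suc : ∀ {r} (C : Content r) G → 𝔼 (0 ∷ C) G ≡ 𝔼 C (λ w → G (map suc w))
  𝔼-map-suc C G = go (sum C) C G refl
    where
    go : ∀ {r} M (C : Content r) G → sum C ≡ M → 𝔼 (0 ∷ C) G ≡ 𝔼 C (λ w → G (map suc w))
    go zero    C G eq = trans (𝔼-nil (0 ∷ C) G eq) (sym (𝔼-nil C (λ w → G (map suc w)) eq))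
    go (suc M) C G eq = *-cancel-0< (0<sum C eq) (begin
      ι (sum C) * 𝔼 (0 ∷ C) G
        ≡⟨ 𝔼-cons (0 ∷ C) G ⟩
      ι 0 * 𝔼 (0 ∷ C) (λ w → G (zero ∷ w)) + ∑ (λ a → ι (lookup C a) * 𝔼 (0 ∷ dec C a) (λ w → G (suc a ∷ w)))
        ≡⟨ cong₂ _+_ (weight-0 (𝔼 (0 ∷ C) (λ w → G (zero ∷ w)))) (∑-cong (λ a → weight-cong (lookup C a) (λ eqₐ →
             go M (dec C a) (λ w → G (suc a ∷ w)) (ℕₚ.suc-injective (trans (sym (sum-dec C a eqₐ)) eq))))) ⟩
      0ℚ + ∑ (λ a → ι (lookup C a) * 𝔼 (dec C a) (λ w → G (suc a ∷ map suc w)))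
        ≡⟨ +-identityˡ _ ⟩
      ∑ (λ a → ι (lookup C a) * 𝔼 (dec C a) (λ w → G (suc a ∷ map suc w)))
        ≡⟨ 𝔼-cons C (λ w → G (map suc w)) ⟨
      ι (sum C) * 𝔼 C (λ w → G (map suc w)) ∎)
      where open ≡-Reasoning

  ∑ₗ : ∀ {A : Set} → List A → (A → ℚ) → ℚ
  ∑ₗ []       G = 0ℚ
  ∑ₗ (x ∷ xs) G = G x + ∑ₗ xs G

  ∑ₗ-++ : ∀ {A : Set} (xs ys : List A) G → ∑ₗ (xs ++ ys) G ≡ ∑ₗ xs G + ∑ₗ ys G
  ∑ₗ-++ []       ys G = sym (+-identityˡ _)
  ∑ₗ-++ (x ∷ xs) ys G = trans (cong (λ s → G x + s) (∑ₗ-++ xs ys G)) (sym (+-assoc (G x) (∑ₗ xs G) (∑ₗ ys G)))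

  ∑ₗ-∑ : ∀ {A : Set} {r} (xs : List A) (g : A → Fin r → ℚ) → ∑ₗ xs (λ x → ∑ (g x)) ≡ ∑ (λ a → ∑ₗ xs (λ x → g x a))
  ∑ₗ-∑ {r = r} []       g = sym (∑-0 {r})
  ∑ₗ-∑         (x ∷ xs) g = trans (cong (λ s → ∑ (g x) + s) (∑ₗ-∑ xs g)) (sym (∑-+ (g x) (λ a → ∑ₗ xs (λ y → g y a))))

  ∑ₗ-* : ∀ {A : Set} c (xs : List A) G → ∑ₗ xs (λ x → c * G x) ≡ c * ∑ₗ xs G
  ∑ₗ-* c []       G = sym (*-zeroʳ c)
  ∑ₗ-* c (x ∷ xs) G = trans (cong (λ s → c * G x + s) (∑ₗ-* c xs G)) (sym (*-distribˡ-+ c (G x) (∑ₗ xs G)))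

  ∑ₗ-cong : ∀ {A : Set} (xs : List A) {G H} → (∀ x → G x ≡ H x) → ∑ₗ xs G ≡ ∑ₗ xs H
  ∑ₗ-cong []       eq = refl
  ∑ₗ-cong (x ∷ xs) eq = cong₂ _+_ (eq x) (∑ₗ-cong xs eq)

  ∑ₗ-ι : ∀ {A : Set} (xs : List A) (g : A → ℕ) → ∑ₗ xs (λ x → ι (g x)) ≡ ι (sumₗ (map g xs))
  ∑ₗ-ι []       g = sym ι-0
  ∑ₗ-ι (x ∷ xs) g = trans (cong (λ s → ι (g x) + s) (∑ₗ-ι xs g)) (sym (ι-+ (g x) (sumₗ (map g xs))))

  ∑ₗ-length : ∀ {A : Set} (xs : List A) → ∑ₗ xs (λ _ → 1ℚ) ≡ ι (length xs)
  ∑ₗ-length []       = sym ι-0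
  ∑ₗ-length (x ∷ xs) = trans (cong (λ s → 1ℚ + s) (∑ₗ-length xs)) (sym (ι-suc (length xs)))

  ∑ₗ-words : ∀ r M G → ∑ₗ (words r (suc M)) G ≡ ∑ₗ (words r M) (λ w → ∑ (λ a → G (a ∷ w)))
  ∑ₗ-words r M G = go (words r M)
    where
    over-tabulate : ∀ {s} w (φ : Fin s → Fin r) → ∑ₗ (map (_∷ w) (tabulate φ)) G ≡ ∑ (λ a → G (φ a ∷ w))
    over-tabulate {zero}  w φ = refl
    over-tabulate {suc s} w φ = cong (λ s → G (φ zero ∷ w) + s) (over-tabulate w (λ a → φ (suc a)))
    go : ∀ ws → ∑ₗ (concatMap (λ w → map (_∷ w) (allFin r)) ws) G ≡ ∑ₗ ws (λ w → ∑ (λ a → G (a ∷ w)))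
    go []       = refl
    go (w ∷ ws) = trans (∑ₗ-++ (map (_∷ w) (allFin r)) _ G) (cong₂ _+_ (over-tabulate w (λ a → a)) (go ws))

  words-length : ∀ r M → All (λ w → length w ≡ M) (words r M)
  words-length r zero    = refl ∷ []
  words-length r (suc M) = Allₚ.concat⁺ (Allₚ.map⁺ (All.map (λ {w} eq → Allₚ.map⁺ (All.universal (λ a → cong suc eq) (allFin r))) (words-length r M)))

  -- The number of ways to label the letters of w as the letters of C.
  χ : ∀ {r} → Content r → Word r → ℚ
  χ C []      = 1ℚ
  χ C (a ∷ w) = ι (lookup C a) * χ (dec C a) w

  factorials : ∀ {r} → Content r → ℕ
  factorials []      = 1
  factorials (c ∷ C) = c ! ℕ.* factorials C

  factorials-dec : ∀ {r} (C : Content r) a {c} → lookup C a ≡ suc c → lookup C a ℕ.* factorials (dec C a) ≡ factorials C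
  factorials-dec (suc c ∷ C) zero    refl = sym (ℕₚ.*-assoc (suc c) (c !) (factorials C))
  factorials-dec (c ∷ C)     (suc a) eq   = begin
    lookup C a ℕ.* (c ! ℕ.* factorials (dec C a))   ≡⟨ ℕₚ.*-assoc (lookup C a) (c !) _ ⟨
    lookup C a ℕ.* c ! ℕ.* factorials (dec C a)     ≡⟨ cong (ℕ._* factorials (dec C a)) (ℕₚ.*-comm (lookup C a) (c !)) ⟩
    c ! ℕ.* lookup C a ℕ.* factorials (dec C a)     ≡⟨ ℕₚ.*-assoc (c !) (lookup C a) _ ⟩
    c ! ℕ.* (lookup C a ℕ.* factorials (dec C a))   ≡⟨ cong (c ! ℕ.*_) (factorials-dec C a eq) ⟩
    c ! ℕ.* factorials C                            ∎
    where open ≡-Reasoning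

  factorials-empty : ∀ {r} (C : Content r) → sum C ≡ 0 → factorials C ≡ 1
  factorials-empty []         eq = refl
  factorials-empty (zero ∷ C) eq = trans (ℕₚ.*-identityˡ _) (factorials-empty C eq)

  factorials>0 : ∀ {r} (C : Content r) → 0 ℕ.< factorials C
  factorials>0 []      = ℕ.s≤s ℕ.z≤n
  factorials>0 (c ∷ C) = ℕₚ.*-mono-≤ (ℕₚ.1≤n! c) (factorials>0 C)

  -- A letter of multiplicity `c` contributes the factors `c`, `c - 1`, down to 1, in whatever order
  -- the letters come. The weight does not depend on `w`, which is why drawing without replacement
  -- is uniform.
  χ-∋ : ∀ {r} {C : Content r} {w} → C ∋ w → χ C w ≡ ι (factorials C)
  χ-∋ (nil {C} eq)          = sym (trans (cong ι (factorials-empty C eq)) ι-1)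
  χ-∋ (cons {C} {a} eq C∋w) = trans (cong (ι (lookup C a) *_) (χ-∋ C∋w))
    (trans (sym (ι-* (lookup C a) (factorials (dec C a)))) (cong ι (factorials-dec C a eq)))

  -- A word of the right length but the wrong content exhausts some letter and meets a factor 0, so
  -- a sum weighted by `χ` sees only the multiset permutations.
  ∋-or-χ≡0 : ∀ {r} (C : Content r) w → length w ≡ sum C → C ∋ w ⊎ χ C w ≡ 0ℚ
  ∋-or-χ≡0 C []      eq = inj₁ (nil (sym eq))
  ∋-or-χ≡0 C (a ∷ w) eq with lookup C a in eqₐ
  ... | zero  = inj₂ (weight-0 (χ (dec C a) w))
  ... | suc c with ∋-or-χ≡0 (dec C a) w (ℕₚ.suc-injective (trans eq (sum-dec C a eqₐ)))
  ...   | inj₁ C∋w = inj₁ (cons eqₐ C∋w)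
  ...   | inj₂ eq₀ = inj₂ (trans (cong (ι (suc c) *_) eq₀) (*-zeroʳ (ι (suc c))))

  lookup-dec-≡ : ∀ {r} (C : Content r) a → lookup (dec C a) a ≡ pred (lookup C a)
  lookup-dec-≡ (c ∷ C) zero    = refl
  lookup-dec-≡ (c ∷ C) (suc a) = lookup-dec-≡ C a

  lookup-dec-≢ : ∀ {r} (C : Content r) a b → b ≢ a → lookup (dec C a) b ≡ lookup C b
  lookup-dec-≢ (c ∷ C) zero    zero    b≢a = contradiction refl b≢a
  lookup-dec-≢ (c ∷ C) zero    (suc b) b≢a = refl
  lookup-dec-≢ (c ∷ C) (suc a) zero    b≢a = refl
  lookup-dec-≢ (c ∷ C) (suc a) (suc b) b≢a = lookup-dec-≢ C a b (λ { refl → b≢a refl })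

  count-≡ : ∀ {r} (a : Fin r) w → count a (a ∷ w) ≡ suc (count a w)
  count-≡ a w = cong length (filter-accept (a Fin.≟_) refl)

  count-≢ : ∀ {r} (a b : Fin r) w → b ≢ a → count b (a ∷ w) ≡ count b w
  count-≢ a b w b≢a = cong length (filter-reject (b Fin.≟_) b≢a)

  sum≡0 : ∀ {r} (C : Content r) → (∀ a → lookup C a ≡ 0) → sum C ≡ 0
  sum≡0 []      eq = refl
  sum≡0 (c ∷ C) eq = cong₂ ℕ._+_ (eq zero) (sum≡0 C (λ a → eq (suc a)))

  ∋⇒count : ∀ {r} {C : Content r} {w} → C ∋ w → ∀ b → count b w ≡ lookup C b
  ∋⇒count (nil {C} eq) b = sym (lookup≡0 C eq b)
  ∋⇒count (cons {C} {a} {w} eq C∋w) b = go (b Fin.≟ a)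
    where
    go : Dec (b ≡ a) → count b (a ∷ w) ≡ lookup C b
    go (yes refl) = trans (count-≡ a w) (trans (cong suc (trans (∋⇒count C∋w a) (trans (lookup-dec-≡ C a) (cong pred eq)))) (sym eq))
    go (no b≢a)   = trans (count-≢ a b w b≢a) (trans (∋⇒count C∋w b) (lookup-dec-≢ C a b b≢a))

  count⇒∋ : ∀ {r} (C : Content r) w → (∀ b → count b w ≡ lookup C b) → C ∋ w
  count⇒∋ C []      eq = nil (sum≡0 C (λ a → sym (eq a)))
  count⇒∋ C (a ∷ w) eq = cons (trans (sym (eq a)) (count-≡ a w)) (count⇒∋ (dec C a) w (λ b → go b (b Fin.≟ a)))
    where
    go : ∀ b → Dec (b ≡ a) → count b w ≡ lookup (dec C a) b
    go b (yes refl) = trans (cong pred (trans (sym (count-≡ a w)) (eq a))) (sym (lookup-dec-≡ C a))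
    go b (no b≢a)   = trans (sym (count-≢ a b w b≢a)) (trans (eq b) (sym (lookup-dec-≢ C a b b≢a)))

  ∑ₗ-χ : ∀ {r} M (C : Content r) G → sum C ≡ M → ∑ₗ (words r M) (λ w → χ C w * G w) ≡ ι (M !) * 𝔼 C G
  ∑ₗ-χ {r} zero C G eq = begin
    1ℚ * G [] + 0ℚ      ≡⟨ +-identityʳ _ ⟩
    1ℚ * G []           ≡⟨ cong₂ _*_ (sym ι-1) (sym (𝔼-nil C G eq)) ⟩
    ι 1 * 𝔼 C G         ∎
    where open ≡-Reasoning
  ∑ₗ-χ {r} (suc M) C G eq = begin
    ∑ₗ (words r (suc M)) (λ w → χ C w * G w)
      ≡⟨ ∑ₗ-words r M (λ w → χ C w * G w) ⟩
    ∑ₗ (words r M) (λ w → ∑ (λ a → ι (lookup C a) * χ (dec C a) w * G (a ∷ w)))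
      ≡⟨ ∑ₗ-∑ (words r M) (λ w a → ι (lookup C a) * χ (dec C a) w * G (a ∷ w)) ⟩
    ∑ (λ a → ∑ₗ (words r M) (λ w → ι (lookup C a) * χ (dec C a) w * G (a ∷ w)))
      ≡⟨ ∑-cong (λ a → trans (∑ₗ-cong (words r M) (λ w → *-assoc (ι (lookup C a)) (χ (dec C a) w) (G (a ∷ w))))
           (∑ₗ-* (ι (lookup C a)) (words r M) (λ w → χ (dec C a) w * G (a ∷ w)))) ⟩
    ∑ (λ a → ι (lookup C a) * ∑ₗ (words r M) (λ w → χ (dec C a) w * G (a ∷ w)))
      ≡⟨ ∑-cong (λ a → trans (weight-cong (lookup C a) (λ eqₐ →
             ∑ₗ-χ M (dec C a) (λ w → G (a ∷ w)) (ℕₚ.suc-injective (trans (sym (sum-dec C a eqₐ)) eq))))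
           (solve 3 (λ x y z → x :* (y :* z) := y :* (x :* z)) refl (ι (lookup C a)) (ι (M !)) (𝔼 (dec C a) (λ w → G (a ∷ w))))) ⟩
    ∑ (λ a → ι (M !) * (ι (lookup C a) * 𝔼 (dec C a) (λ w → G (a ∷ w))))
      ≡⟨ ∑-* (ι (M !)) (λ a → ι (lookup C a) * 𝔼 (dec C a) (λ w → G (a ∷ w))) ⟩
    ι (M !) * ∑ (λ a → ι (lookup C a) * 𝔼 (dec C a) (λ w → G (a ∷ w)))
      ≡⟨ cong (ι (M !) *_) (trans (sym (𝔼-cons C G)) (cong (λ s → ι s * 𝔼 C G) eq)) ⟩
    ι (M !) * (ι (suc M) * 𝔼 C G)
      ≡⟨ solve 3 (λ x y z → x :* (y :* z) := y :* x :* z) refl (ι (M !)) (ι (suc M)) (𝔼 C G) ⟩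
    ι (suc M) * ι (M !) * 𝔼 C G
      ≡⟨ cong (_* 𝔼 C G) (ι-* (suc M) (M !)) ⟨
    ι (suc M !) * 𝔼 C G ∎
    where open ≡-Reasoning

  ∑ₗ-filter : ∀ {A : Set} {P : A → Set} (P? : Decidable P) {h : A → ℚ} {c} G xs →
    All (λ x → (P x → h x ≡ c)) xs → All (λ x → (¬ P x → h x ≡ 0ℚ)) xs →
    ∑ₗ xs (λ x → h x * G x) ≡ c * ∑ₗ (filter P? xs) G
  ∑ₗ-filter P? {h} {c} G []       _            _            = sym (*-zeroʳ c)
  ∑ₗ-filter P? {h} {c} G (x ∷ xs) (yes! ∷ yess) (no! ∷ nos) with P? x
  ... | yes px = trans (cong₂ _+_ (cong (_* G x) (yes! px)) (∑ₗ-filter P? G xs yess nos)) (sym (*-distribˡ-+ c (G x) _))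
  ... | no ¬px = trans (cong₂ _+_ (trans (cong (_* G x) (no! ¬px)) (*-zeroˡ (G x))) (∑ₗ-filter P? G xs yess nos)) (+-identityˡ _)

  module _ (k n : ℕ) where

    private
      C : Content n
      C = replicate n k

    sum-rows : ∀ n → sum (replicate n k) ≡ k ℕ.* n
    sum-rows zero    = sym (ℕₚ.*-zeroʳ k)
    sum-rows (suc n) = trans (cong (k ℕ.+_) (sum-rows n)) (sym (ℕₚ.*-suc k n))

    isMultPerm : ∀ {w} → All (λ a → count a w ≡ k) (allFin n) → C ∋ w
    isMultPerm {w} all = count⇒∋ C w (λ b → trans (All.lookup all (∈-allFin b)) (sym (lookup-replicate b k)))

    -- Both sides sum `G` over the orderings of `k * n` labelled letters; each word comes from
    -- `factorials C` of them.
    ∑ₗ-multPerms : ∀ G → ι ((k ℕ.* n) !) * 𝔼 C G ≡ ι (factorials C) * ∑ₗ (multPerms k n) G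
    ∑ₗ-multPerms G = trans (sym (∑ₗ-χ (k ℕ.* n) C G (sum-rows n)))
      (∑ₗ-filter (λ w → all? (λ a → count a w ℕ.≟ k) (allFin n)) G (words n (k ℕ.* n))
        (All.universal (λ w all → χ-∋ (isMultPerm {w} all)) _)
        (All.map (λ {w} len ¬all → not w (trans len (sym (sum-rows n))) ¬all) (words-length n (k ℕ.* n))))
      where
      not : ∀ w → length w ≡ sum C → ¬ All (λ a → count a w ≡ k) (allFin n) → χ C w ≡ 0ℚ
      not w len ¬all with ∋-or-χ≡0 C w len
      ... | inj₁ C∋w = contradiction (All.universal (λ a → trans (∋⇒count C∋w a) (lookup-replicate a k)) (allFin n)) ¬all
      ... | inj₂ eq  = eq

  ι*mean : ∀ s c → ι (suc c) * mean s (suc c) ≡ ι s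
  ι*mean s c = toℚᵘ-injective (begin
    toℚᵘ (ι (suc c) * ((+ s) / suc c))             ≈⟨ toℚᵘ-homo-* (ι (suc c)) ((+ s) / suc c) ⟩
    toℚᵘ (ι (suc c)) ℚᵘ.* toℚᵘ ((+ s) / suc c)     ≈⟨ ℚᵘₚ.*-cong (ι-toℚᵘ (suc c)) (toℚᵘ-fromℚᵘ (mkℚᵘ (+ s) c)) ⟩
    mkℚᵘ (+ suc c) 0 ℚᵘ.* mkℚᵘ (+ s) c             ≈⟨ *≡* (trans (ℤₚ.*-identityʳ _) (trans (ℤₚ.*-comm (+ suc c) (+ s))
                                                        (cong (λ d → + s ℤ.* + d) (sym (ℕₚ.*-identityˡ (suc c)))))) ⟩
    mkℚᵘ (+ s) 0                                   ≈⟨ ι-toℚᵘ s ⟨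
    toℚᵘ (ι s)                                     ∎)
    where open ℚᵘₚ.≃-Reasoning

  0<ι : ∀ {n} → 0 ℕ.< n → 0ℚ < ι n
  0<ι {suc n} _ = 0<ι-suc n

  -- `∑ₗ-multPerms` for the constant 1 gives the number of words and for `LIS` their total; the
  -- common factor cancels in the quotient.
  expectedLIS≡F : ∀ k n → expectedLIS (suc k) n ≡ F 0 k n
  expectedLIS≡F k n = go (multPerms (suc k) n) (∑ₗ-multPerms (suc k) n)
    where
    C = replicate n (suc k)
    W = ι (factorials C)
    M! = ι ((suc k ℕ.* n) !)
    open ≡-Reasoning
    go : ∀ ws → (∀ G → M! * 𝔼 C G ≡ W * ∑ₗ ws G) → mean (sumₗ (map LIS ws)) (length ws) ≡ F 0 k n
    -- The empty list, on which `mean` takes its default value, is excluded by `h` for the constant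
    -- 1, as a factorial is not 0.
    go [] h = contradiction (begin
      0ℚ                    ≡⟨ *-zeroʳ W ⟨
      W * 0ℚ                ≡⟨ h (λ _ → 1ℚ) ⟨
      M! * 𝔼 C (λ _ → 1ℚ)   ≡⟨ cong (M! *_) (𝔼-const C 1ℚ) ⟩
      M! * 1ℚ               ≡⟨ *-identityʳ M! ⟩
      M!                    ∎) (<⇒≢ (0<ι (ℕₚ.1≤n! (suc k ℕ.* n))))
    go ws@(_ ∷ ws′) h = *-cancel-0< (0<ι-suc (length ws′)) (*-cancel-0< (0<ι (factorials>0 C)) (begin
      W * (ι (length ws) * mean (sumₗ (map LIS ws)) (length ws))   ≡⟨ cong (W *_) (ι*mean (sumₗ (map LIS ws)) (length ws′)) ⟩
      W * ι (sumₗ (map LIS ws))                                    ≡⟨ cong (W *_) (∑ₗ-ι ws LIS) ⟨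
      W * ∑ₗ ws (λ w → ι (LIS w))                                  ≡⟨ h (λ w → ι (LIS w)) ⟨
      M! * 𝔼 C (λ w → ι (LIS w))                                   ≡⟨ cong₂ _*_ total (sym F₀) ⟩
      W * ι (length ws) * F 0 k n                                  ≡⟨ *-assoc W (ι (length ws)) (F 0 k n) ⟩
      W * (ι (length ws) * F 0 k n)                                ∎))
      where
      total : M! ≡ W * ι (length ws)
      total = begin
        M!                    ≡⟨ *-identityʳ M! ⟨
        M! * 1ℚ               ≡⟨ cong (M! *_) (𝔼-const C 1ℚ) ⟨
        M! * 𝔼 C (λ _ → 1ℚ)   ≡⟨ h (λ _ → 1ℚ) ⟩
        W * ∑ₗ ws (λ _ → 1ℚ)  ≡⟨ cong (W *_) (∑ₗ-length ws) ⟩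
        W * ι (length ws)     ∎
      F₀ : F 0 k n ≡ 𝔼 C (λ w → ι (LIS w))
      F₀ = trans (𝔼-map-suc C (λ w → ι (f w))) (𝔼-cong C (λ w → cong ι (f-map-suc w)))

-- Inequalities for `M + Q / M` near its minimum.

module Estimates where

  open import Defs using (ℕ→ℚ)
  open Rationals
  open import Data.Nat using (ℕ)
  open import Data.Rational
  open import Data.Rational.Properties
  open import Data.Rational.Solver using (module +-*-Solver)
  open import Data.Sum using (inj₁; inj₂)
  open import Relation.Binary.PropositionalEquality

  open +-*-Solver

  infixr 8 #_
  #_ : ℕ → ℚ
  #_ = ℕ→ℚ

  c# : ∀ {m} → ℕ → Polynomial m
  c# n = con (ℕ→ℚ n)

  0≤# : ∀ n → 0ℚ ≤ # n
  0≤# n = subst (0ℚ ≤_) (ι≡ℕ→ℚ n) (0≤ι n)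

  -- Pointwise form of Chebyshev's inequality for two variables with centred values a, b and means at distance Δ.
  quadratic-bound : ∀ {c Δ u a b} → 0ℚ ≤ c → 0ℚ < Δ → Δ ≤ u → Δ ≤ b - a → # 2 * u ≤ c * (Δ * Δ) →
    u + a ≤ c * (a * a + b * b)
  quadratic-bound {c} {Δ} {u} {a} {b} 0≤c 0<Δ Δ≤u Δ≤b-a 2u≤ with ≤-total a 0ℚ
  -- Here only `u` has to be paid for: `2 (a² + b²) ≥ (b - a)² ≥ Δ²`.
  ... | inj₁ a≤0 = *-cancel-≤-0< {# 2} (positive⁻¹ (# 2)) (begin
    # 2 * (u + a)                                    ≤⟨ by-diff (0≤* (0≤# 2) (≤⇒0≤- a≤0)) (solve 2 (λ u a → c# 2 :* u := c# 2 :* (u :+ a) :+ c# 2 :* (con 0ℚ :- a)) refl u a) ⟩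
    # 2 * u                                          ≤⟨ 2u≤ ⟩
    c * (Δ * Δ)                                      ≤⟨ *-monoˡ 0≤c (square-mono (<⇒≤ 0<Δ) Δ≤b-a) ⟩
    c * ((b - a) * (b - a))                          ≤⟨ *-monoˡ 0≤c (by-diff (0≤sq (b + a))
                                                          (solve 2 (λ a b → c# 2 :* (a :* a :+ b :* b) := (b :- a) :* (b :- a) :+ (b :+ a) :* (b :+ a)) refl a b)) ⟩
    c * (# 2 * (a * a + b * b))                      ≡⟨ solve 2 (λ c s → c :* (c# 2 :* s) := c# 2 :* (c :* s)) refl c (a * a + b * b) ⟩
    # 2 * (c * (a * a + b * b))                      ∎)
    where open ≤-Reasoning
  -- Here `b ≥ a + Δ`, so `a² + b² ≥ Δ² + 2 Δ a`. The first term pays for `u`, the second for `a`,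
  -- because the hypotheses give `c Δ ≥ 2`.
  ... | inj₂ 0≤a = begin
    u + a                                            ≤⟨ by-diff (0≤+ 0≤u (0≤* (0≤# 3) 0≤a)) (solve 2 (λ u a → c# 2 :* u :+ c# 4 :* a := u :+ a :+ (u :+ c# 3 :* a)) refl u a) ⟩
    # 2 * u + # 4 * a                                ≤⟨ +-mono-≤ 2u≤ (*-monoʳ 0≤a (*-cancel-≤-0< 0<Δ 4Δ≤)) ⟩
    c * (Δ * Δ) + # 2 * (c * Δ) * a                  ≡⟨ solve 3 (λ c Δ a → c :* (Δ :* Δ) :+ c# 2 :* (c :* Δ) :* a := c :* (Δ :* Δ :+ c# 2 :* (Δ :* a))) refl c Δ a ⟩
    c * (Δ * Δ + # 2 * (Δ * a))                      ≤⟨ *-monoˡ 0≤c (by-diff (0≤+ (0≤sq a) (0≤sq a))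
                                                          (solve 2 (λ Δ a → a :* a :+ (a :+ Δ) :* (a :+ Δ) := Δ :* Δ :+ c# 2 :* (Δ :* a) :+ (a :* a :+ a :* a)) refl Δ a)) ⟩
    c * (a * a + (a + Δ) * (a + Δ))                  ≤⟨ *-monoˡ 0≤c (+-monoʳ-≤ (a * a) (square-mono (0≤+ 0≤a (<⇒≤ 0<Δ)) a+Δ≤b)) ⟩
    c * (a * a + b * b)                              ∎
    where
    open ≤-Reasoning
    0≤u = ≤-trans (<⇒≤ 0<Δ) Δ≤u
    a+Δ≤b : a + Δ ≤ b
    a+Δ≤b = by-diff (≤⇒0≤- Δ≤b-a) (solve 3 (λ a b Δ → b := a :+ Δ :+ (b :- a :- Δ)) refl a b Δ)
    4Δ≤ : Δ * # 4 ≤ Δ * (# 2 * (c * Δ))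
    4Δ≤ = begin
      Δ * # 4              ≡⟨ solve 1 (λ Δ → Δ :* c# 4 := c# 2 :* (c# 2 :* Δ)) refl Δ ⟩
      # 2 * (# 2 * Δ)      ≤⟨ *-monoˡ (0≤# 2) (≤-trans (*-monoˡ (0≤# 2) Δ≤u) 2u≤) ⟩
      # 2 * (c * (Δ * Δ))  ≡⟨ solve 2 (λ c Δ → c# 2 :* (c :* (Δ :* Δ)) := Δ :* (c# 2 :* (c :* Δ))) refl c Δ ⟩
      Δ * (# 2 * (c * Δ))  ∎

  -- M + Q / M for M = R, R + D, R + 2 D, where R is the integer part of √Q and D ≈ R / T.
  record IsScale (R D T Q K i j v₀ v₁ v₂ : ℚ) : Set where
    field
      2≤R : # 2 ≤ R
      4≤D : # 4 ≤ D
      2≤T : # 2 ≤ T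
      TD≤R : T * D ≤ R
      R≤TD+T : R ≤ T * (D + 1ℚ)
      R²≤Q : R * R ≤ Q
      Q≤R²+2R : Q ≤ R * (R + # 2)
      K≤R : K ≤ R
      0≤K : 0ℚ ≤ K
      iT : # 6 * T * i ≡ 1ℚ
      jD : D * j ≡ 1ℚ
      eq₀ : R * v₀ ≡ Q
      eq₁ : (R + D) * v₁ ≡ Q
      eq₂ : (R + # 2 * D) * v₂ ≡ Q

  module Scale {R D T Q K i j v₀ v₁ v₂ : ℚ} (scale : IsScale R D T Q K i j v₀ v₁ v₂) where

    open IsScale scale
    open ≤-Reasoning

    0≤R : 0ℚ ≤ R
    0≤R = ≤-trans (0≤# 2) 2≤R
    0≤D : 0ℚ ≤ D
    0≤D = ≤-trans (0≤# 4) 4≤D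
    0≤T : 0ℚ ≤ T
    0≤T = ≤-trans (0≤# 2) 2≤T
    0<R : 0ℚ < R
    0<R = <-≤-trans (positive⁻¹ (# 2)) 2≤R
    0<D : 0ℚ < D
    0<D = <-≤-trans (positive⁻¹ (# 4)) 4≤D
    0<T : 0ℚ < T
    0<T = <-≤-trans (positive⁻¹ (# 2)) 2≤T
    0<R+D : 0ℚ < R + D
    0<R+D = <-≤-trans 0<R (by-diff 0≤D refl)

    1≤T : 1ℚ ≤ T
    1≤T = ≤-trans (by-diff {1ℚ} (0≤# 1) refl) 2≤T

    D≤R : D ≤ R
    D≤R = ≤-trans (by-diff (0≤* (≤⇒0≤- 1≤T) 0≤D) (solve 2 (λ t d → t :* d := d :+ (t :- con 1ℚ) :* d) refl T D)) TD≤R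

    R≤2TD : R ≤ # 2 * (T * D)
    R≤2TD = ≤-trans R≤TD+T (by-diff (0≤* 0≤T (≤⇒0≤- (≤-trans (by-diff {1ℚ} (0≤# 3) refl) 4≤D)))
      (solve 2 (λ t d → c# 2 :* (t :* d) := t :* (d :+ con 1ℚ) :+ t :* (d :- con 1ℚ)) refl T D))

    quotient≤ : ∀ {M v} → R ≤ M → M * v ≡ Q → v ≤ R + # 2
    quotient≤ {M} {v} R≤M eq = *-cancel-≤-0< (<-≤-trans 0<R R≤M) (begin
      M * v           ≡⟨ eq ⟩
      Q               ≤⟨ Q≤R²+2R ⟩
      R * (R + # 2)   ≤⟨ *-monoʳ (0≤+ 0≤R (0≤# 2)) R≤M ⟩
      M * (R + # 2)   ∎)

    R≤R+D : R ≤ R + D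
    R≤R+D = by-diff 0≤D refl

    v₀≤ : v₀ ≤ R + # 2
    v₀≤ = quotient≤ ≤-refl eq₀

    v₁≤ : v₁ ≤ R + # 2
    v₁≤ = quotient≤ R≤R+D eq₁

    0≤v₀ : 0ℚ ≤ v₀
    0≤v₀ = *-cancel-≤-0< 0<R (subst₂ _≤_ (sym (*-zeroʳ R)) (sym eq₀) (≤-trans (0≤* 0≤R 0≤R) R²≤Q))

    Δ : ℚ
    Δ = D + v₁ - v₀

    -- Exactly, `Δ = D (R (R + D) - Q) / (R (R + D))`. As `Q` may exceed `R²` by `2 R`, only
    -- `Δ ≥ D (D - 2) / (R + D)` is certain, and `D ≥ 4` gives `D - 2 ≥ D / 2`.
    D²≤ : D * D ≤ # 2 * ((R + D) * Δ)
    D²≤ = begin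
      D * D
        ≤⟨ by-diff (0≤* 0≤D (≤⇒0≤- 4≤D)) (solve 1 (λ d → c# 2 :* (d :* (d :- c# 2)) := d :* d :+ d :* (d :- c# 4)) refl D) ⟩
      # 2 * (D * (D - # 2))
        ≤⟨ *-monoˡ (0≤# 2) (*-cancel-≤-0< 0<R (begin
             R * (D * (D - # 2))
               ≤⟨ by-diff (0≤* 0≤D (≤⇒0≤- Q≤R²+2R)) (solve 3 (λ r d q → r :* (d :* (r :+ d)) :- d :* q := r :* (d :* (d :- c# 2)) :+ d :* (r :* (r :+ c# 2) :- q)) refl R D Q) ⟩
             R * (D * (R + D)) - D * Q
               ≡⟨ solve 3 (λ r d q → r :* (d :* (r :+ d)) :- d :* q := r :* (d :* (r :+ d)) :+ r :* q :- (r :+ d) :* q) refl R D Q ⟩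
             R * (D * (R + D)) + R * Q - (R + D) * Q
               ≡⟨ cong₂ (λ x y → R * (D * (R + D)) + R * x - (R + D) * y) (sym eq₁) (sym eq₀) ⟩
             R * (D * (R + D)) + R * ((R + D) * v₁) - (R + D) * (R * v₀)
               ≡⟨ solve 4 (λ r d x y → r :* (d :* (r :+ d)) :+ r :* ((r :+ d) :* x) :- (r :+ d) :* (r :* y) := r :* ((r :+ d) :* (d :+ x :- y))) refl R D v₁ v₀ ⟩
             R * ((R + D) * Δ) ∎)) ⟩
      # 2 * ((R + D) * Δ) ∎

    0≤Δ : 0ℚ ≤ Δ
    0≤Δ = *-cancel-≤-0< 0<R+D (*-cancel-≤-0< (positive⁻¹ (# 2)) (subst (_≤ # 2 * ((R + D) * Δ))
      (solve 1 (λ s → con 0ℚ := c# 2 :* (s :* con 0ℚ)) refl (R + D)) (≤-trans (0≤* 0≤D 0≤D) D²≤)))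

    D≤6TΔ : D ≤ # 6 * T * Δ
    D≤6TΔ = *-cancel-≤-0< 0<D (begin
      D * D                    ≤⟨ D²≤ ⟩
      # 2 * ((R + D) * Δ)      ≤⟨ *-monoˡ (0≤# 2) (*-monoʳ 0≤Δ (+-mono-≤ R≤2TD (by-diff (0≤* (≤⇒0≤- 1≤T) 0≤D)
                                    (solve 2 (λ t d → t :* d := d :+ (t :- con 1ℚ) :* d) refl T D)))) ⟩
      # 2 * ((# 2 * (T * D) + T * D) * Δ) ≡⟨ solve 3 (λ t d e → c# 2 :* ((c# 2 :* (t :* d) :+ t :* d) :* e) := d :* (c# 6 :* t :* e)) refl T D Δ ⟩
      D * (# 6 * T * Δ)        ∎)

    -- `u` and `w` will be `U` one step beyond the optimum and at it, so `Δ = u - w`.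
    -- `Δ₀ = D / (6 T)` is a lower bound for `Δ` free of `v₀` and `v₁`. `c = 576 T³ / D` is chosen
    -- to make `c Δ₀² = 16 T D`, which is at least `2 u` because `u ≤ 4 R ≤ 8 T D`.
    u w Δ₀ c : ℚ
    u = R + D - K + v₁
    w = R - K + v₀
    Δ₀ = D * i
    c = # 576 * (T * T * T) * j

    0≤i : 0ℚ ≤ i
    0≤i = *-cancel-≤-0< 0<T (*-cancel-≤-0< (positive⁻¹ (# 6)) (begin
      # 6 * (T * 0ℚ)  ≡⟨ solve 1 (λ t → c# 6 :* (t :* con 0ℚ) := con 0ℚ) refl T ⟩
      0ℚ              ≤⟨ 0≤# 1 ⟩
      1ℚ              ≡⟨ iT ⟨
      # 6 * T * i     ≡⟨ *-assoc (# 6) T i ⟩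
      # 6 * (T * i)   ∎))

    0≤j : 0ℚ ≤ j
    0≤j = *-cancel-≤-0< 0<D (subst₂ _≤_ (sym (*-zeroʳ D)) (sym jD) (0≤# 1))

    Δ₀≤Δ : Δ₀ ≤ Δ
    Δ₀≤Δ = begin
      D * i               ≤⟨ *-monoʳ 0≤i D≤6TΔ ⟩
      # 6 * T * Δ * i     ≡⟨ solve 3 (λ t e i → c# 6 :* t :* e :* i := c# 6 :* t :* i :* e) refl T Δ i ⟩
      # 6 * T * i * Δ     ≡⟨ cong (_* Δ) iT ⟩
      1ℚ * Δ              ≡⟨ *-identityˡ Δ ⟩
      Δ                   ∎

    0<Δ₀ : 0ℚ < Δ₀
    0<Δ₀ = ≰⇒> λ Δ₀≤0 → <-irrefl refl (<-≤-trans 0<D (begin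
      D                   ≡⟨ *-identityˡ D ⟨
      1ℚ * D              ≡⟨ cong (_* D) iT ⟨
      # 6 * T * i * D     ≡⟨ solve 3 (λ t i d → c# 6 :* t :* i :* d := c# 6 :* t :* (d :* i)) refl T i D ⟩
      # 6 * T * Δ₀        ≤⟨ *-monoˡ (0≤* (0≤# 6) 0≤T) Δ₀≤0 ⟩
      # 6 * T * 0ℚ        ≡⟨ *-zeroʳ (# 6 * T) ⟩
      0ℚ                  ∎))

    u-w≡Δ : u - w ≡ Δ
    u-w≡Δ = solve 5 (λ r d k x y → r :+ d :- k :+ x :- (r :- k :+ y) := d :+ x :- y) refl R D K v₁ v₀

    Δ₀≤u : Δ₀ ≤ u
    Δ₀≤u = ≤-trans Δ₀≤Δ (by-diff (0≤+ (≤⇒0≤- K≤R) 0≤v₀)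
      (solve 5 (λ r d k x y → r :+ d :- k :+ x := d :+ x :- y :+ (r :- k :+ y)) refl R D K v₁ v₀))

    0≤c : 0ℚ ≤ c
    0≤c = 0≤* (0≤* (0≤# 576) (0≤* (0≤* 0≤T 0≤T) 0≤T)) 0≤j

    2u≤cΔ₀² : # 2 * u ≤ c * (Δ₀ * Δ₀)
    2u≤cΔ₀² = begin
      # 2 * u
        ≤⟨ *-monoˡ (0≤# 2) (begin
             R + D - K + v₁     ≤⟨ +-mono-≤ (by-diff {R + D - K} {R + D} 0≤K (solve 3 (λ r d k → r :+ d := r :+ d :- k :+ k) refl R D K)) v₁≤ ⟩
             R + D + (R + # 2)  ≤⟨ by-diff (0≤+ (≤⇒0≤- D≤R) (≤⇒0≤- 2≤R)) (solve 2 (λ r d → c# 4 :* r := r :+ d :+ (r :+ c# 2) :+ (r :- d :+ (r :- c# 2))) refl R D) ⟩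
             # 4 * R            ≤⟨ *-monoˡ (0≤# 4) R≤2TD ⟩
             # 4 * (# 2 * (T * D)) ∎) ⟩
      # 2 * (# 4 * (# 2 * (T * D)))
        ≡⟨ solve 2 (λ t d → c# 2 :* (c# 4 :* (c# 2 :* (t :* d))) := c# 16 :* t :* (con 1ℚ :* con 1ℚ) :* con 1ℚ :* d) refl T D ⟩
      # 16 * T * (1ℚ * 1ℚ) * 1ℚ * D
        ≡⟨ cong₂ (λ x y → # 16 * T * (x * x) * y * D) (sym iT) (sym jD) ⟩
      # 16 * T * ((# 6 * T * i) * (# 6 * T * i)) * (D * j) * D
        ≡⟨ solve 4 (λ t d i j → c# 16 :* t :* ((c# 6 :* t :* i) :* (c# 6 :* t :* i)) :* (d :* j) :* d :=
             c# 576 :* (t :* t :* t) :* j :* ((d :* i) :* (d :* i))) refl T D i j ⟩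
      c * (Δ₀ * Δ₀) ∎

    error : ℚ
    error = # 4608 * (T * T * (T * T))

    -- The variance bounds `v₁` and `v₀` add up to at most `4 R ≤ 8 T D`, and this `D` cancels the
    -- one in the denominator of `c`: the loss does not grow with `n`.
    cV≤error : c * (v₁ + v₀) ≤ error
    cV≤error = begin
      c * (v₁ + v₀)
        ≤⟨ *-monoˡ 0≤c (begin
             v₁ + v₀              ≤⟨ +-mono-≤ v₁≤ v₀≤ ⟩
             R + # 2 + (R + # 2)  ≤⟨ by-diff (0≤* (0≤# 2) (≤⇒0≤- 2≤R)) (solve 1 (λ r → c# 4 :* r := r :+ c# 2 :+ (r :+ c# 2) :+ c# 2 :* (r :- c# 2)) refl R) ⟩
             # 4 * R              ≤⟨ *-monoˡ (0≤# 4) R≤2TD ⟩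
             # 4 * (# 2 * (T * D)) ∎) ⟩
      c * (# 4 * (# 2 * (T * D)))
        ≡⟨ solve 3 (λ t d j → c# 576 :* (t :* t :* t) :* j :* (c# 4 :* (c# 2 :* (t :* d))) := c# 4608 :* (t :* t :* (t :* t)) :* (d :* j)) refl T D j ⟩
      error * (D * j)
        ≡⟨ trans (cong (error *_) jD) (*-identityʳ error) ⟩
      error ∎

    M₁ M₂ y : ℚ
    M₁ = R + D
    M₂ = R + # 2 * D
    y = D + v₂ - v₁

    R≤M₂ : R ≤ M₂
    R≤M₂ = by-diff (0≤* (0≤# 2) 0≤D) refl

    0<M₁M₂ : 0ℚ < M₁ * M₂
    0<M₁M₂ = <-≤-trans (subst (_< R * R) (*-zeroʳ R) (*-monoʳ-<-pos R {{positive 0<R}} 0<R))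
      (≤-trans (*-monoˡ 0≤R R≤M₂) (*-monoʳ (≤-trans 0≤R R≤M₂) R≤R+D))

    M₁M₂y : M₁ * M₂ * y ≡ D * (M₁ * M₂ - Q)
    M₁M₂y = trans (solve 4 (λ r d x z → (r :+ d) :* (r :+ c# 2 :* d) :* (d :+ z :- x) :=
        d :* ((r :+ d) :* (r :+ c# 2 :* d)) :+ ((r :+ d) :* ((r :+ c# 2 :* d) :* z) :- (r :+ c# 2 :* d) :* ((r :+ d) :* x))) refl R D v₁ v₂)
      (trans (cong₂ (λ a b → D * (M₁ * M₂) + (M₁ * a - M₂ * b)) eq₂ eq₁)
        (solve 3 (λ r d q → d :* ((r :+ d) :* (r :+ c# 2 :* d)) :+ ((r :+ d) :* q :- (r :+ c# 2 :* d) :* q) :=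
          d :* ((r :+ d) :* (r :+ c# 2 :* d) :- q)) refl R D Q))

    -- The flatness at the minimum. By `R² ≤ Q`, `M₁ M₂ - Q ≤ 3 R D + 2 D² ≤ 5 R D`, hence
    -- `y ≤ 5 D² / R ≤ 5 D / T`.
    Ty≤5D : T * y ≤ # 5 * D
    Ty≤5D = *-cancel-≤-0< 0<M₁M₂ (begin
      M₁ * M₂ * (T * y)
        ≡⟨ solve 3 (λ m t y → m :* (t :* y) := t :* (m :* y)) refl (M₁ * M₂) T y ⟩
      T * (M₁ * M₂ * y)
        ≡⟨ cong (T *_) M₁M₂y ⟩
      T * (D * (M₁ * M₂ - Q))
        ≤⟨ *-monoˡ 0≤T (*-monoˡ 0≤D (by-diff (0≤+ (≤⇒0≤- R²≤Q) (0≤* (0≤* (0≤# 2) 0≤D) (≤⇒0≤- D≤R)))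
             (solve 3 (λ r d q → c# 5 :* (r :* d) := (r :+ d) :* (r :+ c# 2 :* d) :- q :+ ((q :- r :* r) :+ c# 2 :* d :* (r :- d))) refl R D Q))) ⟩
      T * (D * (# 5 * (R * D)))
        ≡⟨ solve 3 (λ t d r → t :* (d :* (c# 5 :* (r :* d))) := (t :* d) :* (c# 5 :* (r :* d))) refl T D R ⟩
      T * D * (# 5 * (R * D))
        ≤⟨ *-monoʳ (0≤* (0≤# 5) (0≤* 0≤R 0≤D)) TD≤R ⟩
      R * (# 5 * (R * D))
        ≤⟨ by-diff (0≤* (0≤* (0≤# 5) 0≤D) (0≤* 0≤D (0≤+ (0≤* (0≤# 3) 0≤R) (0≤* (0≤# 2) 0≤D))))
             (solve 2 (λ r d → (r :+ d) :* (r :+ c# 2 :* d) :* (c# 5 :* d) := r :* (c# 5 :* (r :* d)) :+ c# 5 :* d :* (d :* (c# 3 :* r :+ c# 2 :* d))) refl R D) ⟩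
      M₁ * M₂ * (# 5 * D) ∎)

    -- The inequality of arithmetic and geometric means, `M + Q / M ≥ 2 √Q ≥ 2 R`, multiplied by
    -- `M`.
    2R≤M₁+v₁ : # 2 * R ≤ M₁ + v₁
    2R≤M₁+v₁ = *-cancel-≤-0< 0<R+D (begin
      M₁ * (# 2 * R)         ≤⟨ by-diff (0≤+ (0≤sq D) (≤⇒0≤- R²≤Q)) (solve 3 (λ r d q → (r :+ d) :* (r :+ d) :+ q := (r :+ d) :* (c# 2 :* r) :+ (d :* d :+ (q :- r :* r))) refl R D Q) ⟩
      M₁ * M₁ + Q            ≡⟨ cong (M₁ * M₁ +_) eq₁ ⟨
      M₁ * M₁ + M₁ * v₁      ≡⟨ *-distribˡ-+ M₁ M₁ v₁ ⟨
      M₁ * (M₁ + v₁)         ∎)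

-- Upper and lower bounds for the mean longest chain.

module Bounding where

  open import Defs using (ℕ→ℚ; _≤[_√_]; [_√_]≤_)
  open Rationals
  open Crossings using (p; ι*p)
  open Boundary
  open Estimates
  open import Data.Integer as ℤ using (-[1+_])
  open import Data.Integer.Properties as ℤₚ using ()
  open import Data.Nat as ℕ using (ℕ; zero; suc; pred)
  open import Data.Nat.Properties as ℕₚ using ()
  open import Data.Nat.Solver using () renaming (module +-*-Solver to ℕ-Solver)
  open import Data.Product using (∃-syntax; _×_; _,_)
  open import Data.Rational
  open import Data.Rational.Properties
  open import Data.Rational.Solver using (module +-*-Solver)
  open import Data.Rational.Unnormalised using (mkℚᵘ; *≤*)
  open import Data.Rational.Unnormalised.Properties as ℚᵘₚ using ()
  open import Data.Sum using (_⊎_; inj₁; inj₂)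
  open import Relation.Nullary using (yes; no; contradiction)
  open import Relation.Binary.PropositionalEquality

  open +-*-Solver

  ι*inv-pred : ∀ n → 0 ℕ.< n → ι n * inv (pred n) ≡ 1ℚ
  ι*inv-pred (suc n) _ = ι*inv n

  -- The witness comes from the denominator: a positive fraction is at least one over it.
  archimedean : ∀ ε → 0ℚ < ε → ∃[ d ] 1ℚ ≤ ι (suc d) * ε
  archimedean (mkℚ (ℤ.+ zero) d c)    0<ε = contradiction (positive 0<ε) λ ()
  archimedean (mkℚ -[1+ a ] d c)    0<ε = contradiction (positive 0<ε) λ ()
  archimedean ε@(mkℚ (ℤ.+ suc a) d c) 0<ε = d , subst (_≤ ι (suc d) * ε) (ι*inv d) (*-monoˡ (0≤ι (suc d)) (toℚᵘ-cancel-≤ (begin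
    toℚᵘ (inv d)      ≃⟨ toℚᵘ-fromℚᵘ (mkℚᵘ (ℤ.+ 1) d) ⟩
    mkℚᵘ (ℤ.+ 1) d      ≤⟨ *≤* (ℤₚ.*-monoʳ-≤-nonNeg (ℤ.+ suc d) (ℤ.+≤+ (ℕ.s≤s (ℕ.z≤n {a})))) ⟩
    mkℚᵘ (ℤ.+ suc a) d  ∎)))
    where open ℚᵘₚ.≤-Reasoning

  -- `r (r + 2) = (r + 1)² - 1`, so `r` is the integer part of the root.
  integer-sqrt : ∀ q → ∃[ r ] r ℕ.* r ℕ.≤ q × q ℕ.≤ r ℕ.* (r ℕ.+ 2)
  integer-sqrt zero = 0 , ℕ.z≤n , ℕ.z≤n
  integer-sqrt (suc q) with integer-sqrt q
  ... | r , r²≤q , q≤ with suc q ℕ.≤? r ℕ.* (r ℕ.+ 2)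
  ...   | yes q<  = r , ℕₚ.m≤n⇒m≤1+n r²≤q , q<
  ...   | no ¬q< = suc r , ℕₚ.≤-reflexive (trans [r+1]² (cong suc (sym q≡))) ,
      subst (λ s → suc s ℕ.≤ suc r ℕ.* (suc r ℕ.+ 2)) (sym q≡) (ℕₚ.≤-trans (ℕₚ.≤-reflexive (sym [r+1]²)) (ℕₚ.*-monoʳ-≤ (suc r) (ℕₚ.m≤m+n (suc r) 2)))
    where
    q≡ : q ≡ r ℕ.* (r ℕ.+ 2)
    q≡ = ℕₚ.≤-antisym q≤ (ℕ.s≤s⁻¹ (ℕₚ.≰⇒> ¬q<))
    [r+1]² : suc r ℕ.* suc r ≡ suc (r ℕ.* (r ℕ.+ 2))
    [r+1]² = ℕ-Solver.solve 1 (λ r → (con′ 1 :+′ r) :*′ (con′ 1 :+′ r) :=′ con′ 1 :+′ r :*′ (r :+′ con′ 2)) refl r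
      where open ℕ-Solver using () renaming (con to con′; _:+_ to _:+′_; _:*_ to _:*′_; _:=_ to _:=′_)

  ≤[√]-intro : ∀ x c m → 0ℚ ≤ c → x * x ≤ c * c * ℕ→ℚ m → x ≤[ c √ m ]
  ≤[√]-intro x c m 0≤c le with 0ℚ ≤? c
  ... | yes _  = inj₂ le
  ... | no 0≰c = contradiction 0≤c 0≰c

  -- For negative `c`, which occurs when `ε > 2`, nonnegativity of `x` is enough; so the comparison
  -- of squares may assume `0 ≤ c`.
  [√]≤-intro : ∀ x c m → 0ℚ ≤ x → (0ℚ ≤ c → c * c * ℕ→ℚ m ≤ x * x) → [ c √ m ]≤ x
  [√]≤-intro x c m 0≤x le with 0ℚ ≤? c
  ... | yes 0≤c = 0≤x , le 0≤c
  ... | no _    = inj₁ 0≤x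

  -- `m′` is the number of particles that makes `m′ + suc k` the integer root of `n * suc k`; `m₁`
  -- and `m₂` below lie one and two steps `d ≈ r / t` beyond it.
  module Bounds (t n k m′ d : ℕ) (2≤r : 2 ℕ.≤ m′ ℕ.+ suc k) (4≤d : 4 ℕ.≤ d) (2≤t : 2 ℕ.≤ t) (t≤d : t ℕ.≤ d)
    (td≤r : t ℕ.* d ℕ.≤ m′ ℕ.+ suc k) (r≤ : m′ ℕ.+ suc k ℕ.≤ t ℕ.* (d ℕ.+ 1))
    (r²≤q : (m′ ℕ.+ suc k) ℕ.* (m′ ℕ.+ suc k) ℕ.≤ n ℕ.* suc k)
    (q≤ : n ℕ.* suc k ℕ.≤ (m′ ℕ.+ suc k) ℕ.* (m′ ℕ.+ suc k ℕ.+ 2)) where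

    r q : ℕ
    r = m′ ℕ.+ suc k
    q = n ℕ.* suc k

    R D T Q K x : ℚ
    R = ι r
    D = ι d
    T = ι t
    Q = ι q
    K = ι (suc k)
    x = F 0 k n + K

    v : ℕ → ℚ
    v m = ι n * p m k

    m₁ m₂ : ℕ
    m₁ = m′ ℕ.+ d
    m₂ = m₁ ℕ.+ d

    v-eq : ∀ m → ι (m ℕ.+ suc k) * v m ≡ Q
    v-eq m = trans (solve 3 (λ a b c → a :* (b :* c) := b :* (a :* c)) refl (ι (m ℕ.+ suc k)) (ι n) (p m k))
      (trans (cong (ι n *_) (ι*p m k)) (sym (ι-* n (suc k))))

    shift : ∀ m → ι (m ℕ.+ d ℕ.+ suc k) ≡ ι (m ℕ.+ suc k) + D
    shift m = trans (cong ι (trans (ℕₚ.+-assoc m d (suc k)) (trans (cong (m ℕ.+_) (ℕₚ.+-comm d (suc k))) (sym (ℕₚ.+-assoc m (suc k) d))))) (ι-+ (m ℕ.+ suc k) d)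

    ι-# : ∀ {a b} → a ℕ.≤ b → # a ≤ ι b
    ι-# {a} {b} a≤b = subst (_≤ ι b) (ι≡ℕ→ℚ a) (ι-mono a≤b)

    ι-+# : ∀ a b → ι (a ℕ.+ b) ≡ ι a + # b
    ι-+# a b = trans (ι-+ a b) (cong (ι a +_) (ι≡ℕ→ℚ b))

    i j : ℚ
    i = inv (pred (6 ℕ.* t))
    j = inv (pred d)

    TD≤R : T * D ≤ R
    TD≤R = subst (_≤ R) (ι-* t d) (ι-mono td≤r)

    R²≤Q : R * R ≤ Q
    R²≤Q = subst (_≤ Q) (ι-* r r) (ι-mono r²≤q)

    Q≤R²+2R : Q ≤ R * (R + # 2)
    Q≤R²+2R = subst (Q ≤_) (trans (ι-* r (r ℕ.+ 2)) (cong (R *_) (ι-+# r 2))) (ι-mono q≤)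

    scale : IsScale R D T Q K i j (v m′) (v m₁) (v m₂)
    scale = record
      { 2≤R     = ι-# 2≤r
      ; 4≤D     = ι-# 4≤d
      ; 2≤T     = ι-# 2≤t
      ; TD≤R    = TD≤R
      ; R≤TD+T  = subst (R ≤_) (trans (ι-* t (d ℕ.+ 1)) (cong (T *_) (ι-+# d 1))) (ι-mono r≤)
      ; R²≤Q    = R²≤Q
      ; Q≤R²+2R = Q≤R²+2R
      ; K≤R     = ι-mono (ℕₚ.m≤n+m (suc k) m′)
      ; 0≤K     = 0≤ι (suc k)
      ; iT      = trans (cong (λ s → s * T * i) (sym (ι≡ℕ→ℚ 6))) (trans (cong (_* i) (sym (ι-* 6 t)))
                    (ι*inv-pred (6 ℕ.* t) (ℕₚ.≤-trans (ℕₚ.≤-trans (ℕ.s≤s ℕ.z≤n) 2≤t) (ℕₚ.m≤n*m t 6))))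
      ; jD      = ι*inv-pred d (ℕₚ.≤-trans (ℕ.s≤s ℕ.z≤n) 4≤d)
      ; eq₀     = v-eq m′
      ; eq₁     = trans (cong (_* v m₁) (sym (shift m′))) (v-eq m₁)
      ; eq₂     = trans (cong (_* v m₂) (trans (solve 2 (λ r d → r :+ c# 2 :* d := r :+ d :+ d) refl R D)
                    (sym (trans (shift m₁) (cong (_+ D) (shift m′)))))) (v-eq m₂)
      }

    u w c error y : ℚ
    u = Scale.u scale
    w = Scale.w scale
    c = Scale.c scale
    error = Scale.error scale
    y = Scale.y scale

    0≤R : 0ℚ ≤ R
    0≤R = 0≤ι r

    0≤D : 0ℚ ≤ D
    0≤D = 0≤ι d

    0≤T : 0ℚ ≤ T
    0≤T = 0≤ι t

    R≡ : R ≡ ι m′ + K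
    R≡ = ι-+ m′ (suc k)

    U₀≡w : U m′ k n ≡ w
    U₀≡w = trans (solve 3 (λ m k v → m :+ v := m :+ k :- k :+ v) refl (ι m′) K (v m′)) (cong (λ s → s - K + v m′) (sym R≡))

    U₁≡u : U m₁ k n ≡ u
    U₁≡u = trans (cong (_+ v m₁) (ι-+ m′ d)) (trans (solve 4 (λ m d k v → m :+ d :+ v := m :+ k :+ d :- k :+ v) refl (ι m′) D K (v m₁))
      (cong (λ s → s + D - K + v m₁) (sym R≡)))

    x≤ : x ≤ # 2 * R + # 2
    x≤ = begin
      F 0 k n + K                ≤⟨ +-monoˡ-≤ K (≤-trans (F-mono 0 m′ k n) (F≤U m′ k n)) ⟩
      ι m′ + v m′ + K            ≡⟨ solve 3 (λ m v k → m :+ v :+ k := m :+ k :+ v) refl (ι m′) (v m′) K ⟩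
      ι m′ + K + v m′            ≡⟨ cong (_+ v m′) R≡ ⟨
      R + v m′                   ≤⟨ +-monoʳ-≤ R (Scale.v₀≤ scale) ⟩
      R + (R + # 2)              ≡⟨ solve 1 (λ r → r :+ (r :+ c# 2) := c# 2 :* r :+ c# 2) refl R ⟩
      # 2 * R + # 2              ∎
      where open ≤-Reasoning

    -- If `x` is the maximum, nothing is lost. Otherwise `z ≤ y` although the mean `u` belonging to
    -- `z` exceeds the mean `w` belonging to `y` by `Δ`; so `B - A ≥ Δ`, and `quadratic-bound`
    -- covers the whole of `z`, which is `u + A`.
    pointwise : ∀ z x y → z ℕ.≤ x ℕ.⊔ y → ι z - ι x ≤ c * (sq (ι z - U m₁ k n) + sq (ι y - U m′ k n))
    pointwise z x y z≤ = subst₂ (λ a b → ι z - ι x ≤ c * (sq (ι z - a) + sq (ι y - b))) (sym U₁≡u) (sym U₀≡w) (go (ℕₚ.≤-total x y))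
      where
      open ≤-Reasoning
      A B : ℚ
      A = ι z - u
      B = ι y - w
      go : x ℕ.≤ y ⊎ y ℕ.≤ x → ι z - ι x ≤ c * (sq A + sq B)
      go (inj₂ y≤x) = begin
        ι z - ι x            ≤⟨ +-monoˡ-≤ (- ι x) (ι-mono (subst (z ℕ.≤_) (ℕₚ.m≥n⇒m⊔n≡m y≤x) z≤)) ⟩
        ι x - ι x            ≡⟨ +-inverseʳ (ι x) ⟩
        0ℚ                   ≤⟨ 0≤* (Scale.0≤c scale) (0≤+ (0≤sq A) (0≤sq B)) ⟩
        c * (sq A + sq B)    ∎
      go (inj₁ x≤y) = begin
        ι z - ι x            ≤⟨ by-diff {ι z - ι x} {u + A} (0≤ι x) (solve 3 (λ z u x → u :+ (z :- u) := z :- x :+ x) refl (ι z) u (ι x)) ⟩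
        u + A                ≤⟨ quadratic-bound {c} {Scale.Δ₀ scale} {u} {A} {B} (Scale.0≤c scale) (Scale.0<Δ₀ scale) (Scale.Δ₀≤u scale) (≤-trans (Scale.Δ₀≤Δ scale) (≤-trans (≤-reflexive (sym (Scale.u-w≡Δ scale)))
                                  (by-diff (≤⇒0≤- (ι-mono (subst (z ℕ.≤_) (ℕₚ.m≤n⇒m⊔n≡n x≤y) z≤)))
                                    (solve 4 (λ y z u w → y :- w :- (z :- u) := u :- w :+ (y :- z)) refl (ι y) (ι z) u w)))) (Scale.2u≤cΔ₀² scale) ⟩
        c * (sq A + sq B)    ∎

    F₁≥ : U m₁ k n - F m₁ k n ≤ error
    F₁≥ = ≤-trans (U-F≤ m′ d k n c (Scale.0≤c scale) pointwise) (Scale.cV≤error scale)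

    δ : ℚ
    δ = F m₂ k n - F m₁ k n

    0≤δ : 0ℚ ≤ δ
    0≤δ = ≤⇒0≤- (F-mono m₁ d k n)

    -- `F` lies below `U` at `m₂`, and at most `error` below it at `m₁`; the increment of `U`
    -- between them is `y`.
    δ≤ : δ ≤ y + error
    δ≤ = begin
      F m₂ k n - F m₁ k n
        ≤⟨ +-mono-≤ (F≤U m₂ k n) (by-diff (≤⇒0≤- F₁≥) (solve 3 (λ a b e → e :- a := :- b :+ (e :- (a :- b))) refl (U m₁ k n) (F m₁ k n) error)) ⟩
      ι (m₁ ℕ.+ d) + v m₂ + (error - (ι m₁ + v m₁))
        ≡⟨ cong (λ s → s + v m₂ + (error - (ι m₁ + v m₁))) (ι-+ m₁ d) ⟩
      ι m₁ + D + v m₂ + (error - (ι m₁ + v m₁))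
        ≡⟨ solve 5 (λ m d a e b → m :+ d :+ a :+ (e :- (m :+ b)) := d :+ a :- b :+ e) refl (ι m₁) D (v m₂) error (v m₁) ⟩
      y + error ∎
      where open ≤-Reasoning

    -- Convexity of F in the number of sources.
    increment≤δ : ∀ a s b → s ℕ.≤ d → a ℕ.+ b ≡ m₁ → F (a ℕ.+ s) k n ≤ F a k n + δ
    increment≤δ a s b s≤d eq = begin
      F (a ℕ.+ s) k n
        ≤⟨ by-diff (≤⇒0≤- (subst (_≤ F (a ℕ.+ b ℕ.+ s) k n + F a k n) (+-comm (F (a ℕ.+ b) k n) (F (a ℕ.+ s) k n)) (F-supermodular a b s k n))) (solve 4 (λ p q r s → s :+ (r :- q) := p :+ (r :+ s :- (p :+ q))) refl (F (a ℕ.+ s) k n) (F (a ℕ.+ b) k n) (F (a ℕ.+ b ℕ.+ s) k n) (F a k n)) ⟩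
      F a k n + (F (a ℕ.+ b ℕ.+ s) k n - F (a ℕ.+ b) k n)
        ≡⟨ cong (λ m → F a k n + (F (m ℕ.+ s) k n - F m k n)) eq ⟩
      F a k n + (F (m₁ ℕ.+ s) k n - F m₁ k n)
        ≤⟨ +-monoʳ-≤ (F a k n) (+-monoˡ-≤ (- F m₁ k n) (subst (λ m → F (m₁ ℕ.+ s) k n ≤ F m k n)
             (trans (ℕₚ.+-assoc m₁ s (d ℕ.∸ s)) (cong (m₁ ℕ.+_) (ℕₚ.m+[n∸m]≡n s≤d))) (F-mono (m₁ ℕ.+ s) (d ℕ.∸ s) k n))) ⟩
      F a k n + δ ∎
      where open ≤-Reasoning

    -- At most `h` steps of length at most `d` lead from 0 to `j`, and by convexity none gains more
    -- than the step beyond `m₁`. The step starting at 0 may be shorter than `d`.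
    F-steps : ∀ h j → j ℕ.≤ h ℕ.* d → j ℕ.≤ m₁ → F j k n ≤ F 0 k n + ι h * δ
    F-steps zero    zero j≤ _ = ≤-reflexive (sym (trans (cong (F 0 k n +_) (weight-0′ δ)) (+-identityʳ _)))
      where
      weight-0′ : ∀ x → ι 0 * x ≡ 0ℚ
      weight-0′ x = trans (cong (_* x) ι-0) (*-zeroˡ x)
    F-steps (suc h) j j≤ j≤m₁ = go (ℕₚ.≤-total j d)
      where
      open ≤-Reasoning
      split : ι (suc h) * δ ≡ δ + ι h * δ
      split = trans (cong (_* δ) (ι-suc h)) (solve 2 (λ h e → (con 1ℚ :+ h) :* e := e :+ h :* e) refl (ι h) δ)
      go : j ℕ.≤ d ⊎ d ℕ.≤ j → F j k n ≤ F 0 k n + ι (suc h) * δ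
      go (inj₁ j≤d) = begin
        F j k n                        ≤⟨ increment≤δ 0 j m₁ j≤d refl ⟩
        F 0 k n + δ                    ≤⟨ by-diff (0≤* (0≤ι h) 0≤δ) (trans (cong (F 0 k n +_) split) (sym (+-assoc (F 0 k n) δ _))) ⟩
        F 0 k n + ι (suc h) * δ        ∎
      go (inj₂ d≤j) = begin
        F j k n                        ≡⟨ cong (λ i → F i k n) (ℕₚ.m∸n+n≡m d≤j) ⟨
        F (j ℕ.∸ d ℕ.+ d) k n          ≤⟨ increment≤δ (j ℕ.∸ d) d (m₁ ℕ.∸ (j ℕ.∸ d)) ℕₚ.≤-refl (ℕₚ.m+[n∸m]≡n j-d≤m₁) ⟩
        F (j ℕ.∸ d) k n + δ            ≤⟨ +-monoˡ-≤ δ (F-steps h (j ℕ.∸ d) (ℕₚ.m≤n+o⇒m∸n≤o j d j≤) j-d≤m₁) ⟩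
        F 0 k n + ι h * δ + δ          ≡⟨ trans (solve 3 (λ f a e → f :+ a :+ e := f :+ (e :+ a)) refl (F 0 k n) (ι h * δ) δ) (cong (F 0 k n +_) (sym split)) ⟩
        F 0 k n + ι (suc h) * δ        ∎
        where
        j-d≤m₁ : j ℕ.∸ d ℕ.≤ m₁
        j-d≤m₁ = ℕₚ.≤-trans (ℕₚ.m∸n≤m j d) j≤m₁

    -- One of the two extra steps covers the rounding in `r ≤ t * (d + 1)`, the other leads from
    -- `m′` to `m₁`.
    m₁≤ : m₁ ℕ.≤ (t ℕ.+ 2) ℕ.* d
    m₁≤ = begin
      m′ ℕ.+ d                        ≤⟨ ℕₚ.+-monoˡ-≤ d (ℕₚ.≤-trans (ℕₚ.m≤m+n m′ (suc k)) r≤) ⟩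
      t ℕ.* (d ℕ.+ 1) ℕ.+ d           ≡⟨ cong (ℕ._+ d) (trans (ℕₚ.*-distribˡ-+ t d 1) (cong (t ℕ.* d ℕ.+_) (ℕₚ.*-identityʳ t))) ⟩
      t ℕ.* d ℕ.+ t ℕ.+ d             ≤⟨ ℕₚ.+-monoˡ-≤ d (ℕₚ.+-monoʳ-≤ (t ℕ.* d) t≤d) ⟩
      t ℕ.* d ℕ.+ d ℕ.+ d             ≡⟨ trans (ℕₚ.+-assoc (t ℕ.* d) d d) (cong (λ s → t ℕ.* d ℕ.+ (d ℕ.+ s)) (sym (ℕₚ.+-identityʳ d))) ⟩
      t ℕ.* d ℕ.+ 2 ℕ.* d             ≡⟨ ℕₚ.*-distribʳ-+ d t 2 ⟨
      (t ℕ.+ 2) ℕ.* d                 ∎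
      where open ℕₚ.≤-Reasoning

    -- The `t + 2` steps lose `(T + 2) y`, which times `T` is at most `10 R`. So `x` loses
    -- `10 R / T`, besides terms that do not grow with `R`.
    Tx≥ : T * (# 2 * R) ≤ T * x + # 10 * R + T * (T + # 3) * error
    Tx≥ = begin
      T * (# 2 * R)
        ≤⟨ *-monoˡ 0≤T (Scale.2R≤M₁+v₁ scale) ⟩
      T * (R + D + v m₁)
        ≡⟨ cong (T *_) (trans (solve 4 (λ r d k v → r :+ d :+ v := r :+ d :- k :+ v :+ k) refl R D K (v m₁)) (cong (_+ K) (sym U₁≡u))) ⟩
      T * (U m₁ k n + K)
        ≤⟨ *-monoˡ 0≤T (+-monoˡ-≤ K (by-diff {U m₁ k n} {F m₁ k n + error} (≤⇒0≤- F₁≥) (solve 3 (λ a b e → b :+ e := a :+ (e :- (a :- b))) refl (U m₁ k n) (F m₁ k n) error))) ⟩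
      T * (F m₁ k n + error + K)
        ≤⟨ *-monoˡ 0≤T (+-monoˡ-≤ K (+-monoˡ-≤ error (≤-trans (F-steps (t ℕ.+ 2) m₁ m₁≤ ℕₚ.≤-refl)
             (+-monoʳ-≤ (F 0 k n) (≤-trans (≤-reflexive (cong (_* δ) (ι-+# t 2))) (*-monoˡ (0≤+ 0≤T (0≤# 2)) δ≤)))))) ⟩
      T * (F 0 k n + (T + # 2) * (y + error) + error + K)
        ≡⟨ solve 5 (λ t f e y k → t :* (f :+ (t :+ c# 2) :* (y :+ e) :+ e :+ k) := t :* (f :+ k) :+ (t :+ c# 2) :* (t :* y) :+ t :* (t :+ c# 3) :* e) refl T (F 0 k n) error y K ⟩
      T * x + (T + # 2) * (T * y) + T * (T + # 3) * error
        ≤⟨ +-monoˡ-≤ (T * (T + # 3) * error) (+-monoʳ-≤ (T * x) (begin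
             (T + # 2) * (T * y)    ≤⟨ *-monoˡ (0≤+ 0≤T (0≤# 2)) (Scale.Ty≤5D scale) ⟩
             (T + # 2) * (# 5 * D)  ≤⟨ by-diff (0≤* (≤⇒0≤- (ι-# 2≤t)) (0≤* (0≤# 5) 0≤D))
                                         (solve 2 (λ t d → c# 10 :* (t :* d) := (t :+ c# 2) :* (c# 5 :* d) :+ (t :- c# 2) :* (c# 5 :* d)) refl T D) ⟩
             # 10 * (T * D)         ≤⟨ *-monoˡ (0≤# 10) TD≤R ⟩
             # 10 * R               ∎)) ⟩
      T * x + # 10 * R + T * (T + # 3) * error ∎
      where open ≤-Reasoning

    0≤x : 0ℚ ≤ x
    0≤x = 0≤+ (0≤F 0 k n) (0≤ι (suc k))

    -- `20 ≤ T ε` makes the loss `10 R / T` at most `ε R / 2`; the other half of `ε R` absorbs the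
    -- terms collected in `large`.
    module _ {ε : ℚ} (0<ε : 0ℚ < ε) (20≤Tε : # 20 ≤ T * ε) (t≤r : t ℕ.≤ r)
      (large : # 2 * T + T * (T + # 3) * error ≤ R) where

      open ≤-Reasoning

      Q≤[R+1]² : Q ≤ (R + 1ℚ) * (R + 1ℚ)
      Q≤[R+1]² = begin
        Q                       ≤⟨ Q≤R²+2R ⟩
        R * (R + # 2)           ≤⟨ by-diff (0≤# 1) (solve 1 (λ r → (r :+ con 1ℚ) :* (r :+ con 1ℚ) := r :* (r :+ c# 2) :+ c# 1) refl R) ⟩
        (R + 1ℚ) * (R + 1ℚ)     ∎

      2≤εR : # 2 ≤ ε * R
      2≤εR = begin
        # 2        ≤⟨ by-diff {# 2} {# 20} {# 18} (0≤# 18) refl ⟩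
        # 20       ≤⟨ 20≤Tε ⟩
        T * ε      ≡⟨ *-comm T ε ⟩
        ε * T      ≤⟨ *-monoˡ (<⇒≤ 0<ε) (ι-mono t≤r) ⟩
        ε * R      ∎

      0≤2+ε : 0ℚ ≤ # 2 + ε
      0≤2+ε = 0≤+ {# 2} {ε} (0≤# 2) (<⇒≤ 0<ε)

      upper : x * x ≤ (# 2 + ε) * (# 2 + ε) * Q
      upper = begin
        x * x                                      ≤⟨ square-mono 0≤x (≤-trans x≤ (≤-trans (+-monoʳ-≤ (# 2 * R) 2≤εR) (≤-reflexive (sym (*-distribʳ-+ R (# 2) ε))))) ⟩
        (# 2 + ε) * R * ((# 2 + ε) * R)            ≡⟨ solve 2 (λ e r → e :* r :* (e :* r) := e :* e :* (r :* r)) refl (# 2 + ε) R ⟩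
        (# 2 + ε) * (# 2 + ε) * (R * R)            ≤⟨ *-monoˡ (0≤sq (# 2 + ε)) R²≤Q ⟩
        (# 2 + ε) * (# 2 + ε) * Q                  ∎

      [2-ε][R+1]≤x : (# 2 - ε) * (R + 1ℚ) ≤ x
      [2-ε][R+1]≤x = *-cancel-≤-0< (Scale.0<T scale) (begin
        T * ((# 2 - ε) * (R + 1ℚ))
          ≡⟨ solve 3 (λ t e r → t :* ((c# 2 :- e) :* (r :+ con 1ℚ)) := t :* (c# 2 :* r) :+ c# 2 :* t :- (t :* e) :* (r :+ con 1ℚ)) refl T ε R ⟩
        T * (# 2 * R) + # 2 * T - T * ε * (R + 1ℚ)
          ≤⟨ +-mono-≤ (+-monoˡ-≤ (# 2 * T) Tx≥) (neg-antimono-≤ (*-monoʳ (0≤+ 0≤R (0≤# 1)) 20≤Tε)) ⟩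
        T * x + # 10 * R + T * (T + # 3) * error + # 2 * T - # 20 * (R + 1ℚ)
          ≤⟨ by-diff (0≤+ (0≤* (0≤# 9) 0≤R) (0≤+ (0≤# 20) (≤⇒0≤- large)))
               (solve 4 (λ a b t r → a := a :+ c# 10 :* r :+ b :+ c# 2 :* t :- c# 20 :* (r :+ con 1ℚ) :+ (c# 9 :* r :+ (c# 20 :+ (r :- (c# 2 :* t :+ b)))))
                 refl (T * x) (T * (T + # 3) * error) T R) ⟩
        T * x ∎)

      lower : 0ℚ ≤ # 2 - ε → (# 2 - ε) * (# 2 - ε) * Q ≤ x * x
      lower 0≤2-ε = begin
        (# 2 - ε) * (# 2 - ε) * Q                          ≤⟨ *-monoˡ (0≤sq (# 2 - ε)) Q≤[R+1]² ⟩
        (# 2 - ε) * (# 2 - ε) * ((R + 1ℚ) * (R + 1ℚ))      ≡⟨ solve 2 (λ e r → e :* e :* (r :* r) := e :* r :* (e :* r)) refl (# 2 - ε) (R + 1ℚ) ⟩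
        (# 2 - ε) * (R + 1ℚ) * ((# 2 - ε) * (R + 1ℚ))      ≤⟨ square-mono (0≤* 0≤2-ε (0≤+ 0≤R (0≤# 1))) [2-ε][R+1]≤x ⟩
        x * x                                              ∎

      bounds : x ≤[ # 2 + ε √ q ] × [ # 2 - ε √ q ]≤ x
      bounds =
        ≤[√]-intro x (# 2 + ε) q 0≤2+ε (subst (λ s → x * x ≤ (# 2 + ε) * (# 2 + ε) * s) (ι≡ℕ→ℚ q) upper) ,
        [√]≤-intro x (# 2 - ε) q 0≤x (λ 0≤2-ε → subst (λ s → (# 2 - ε) * (# 2 - ε) * s ≤ x * x) (ι≡ℕ→ℚ q) (lower 0≤2-ε))

-- Choice of the constants, uniformly in the multiplicity.

module Conclusion where

  open import Defs using (ℕ→ℚ; expectedLIS; _≤[_√_]; [_√_]≤_)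
  open Rationals
  open Counting using (expectedLIS≡F)
  open Estimates using (#_)
  open Bounding
  open import Data.Nat as ℕ using (ℕ; zero; suc; z≤n; s≤s; _+_; _*_; _≤_; _<_; _∸_)
  open import Data.Nat.DivMod using (_/_; _%_; m/n*n≤m; m≡m%n+[m/n]*n; m%n<n)
  open import Data.Nat.Properties
  open import Data.Nat.Solver using (module +-*-Solver)
  open import Data.Product using (∃-syntax; _×_; _,_)
  import Data.Rational as ℚ
  import Data.Rational.Properties as ℚₚ
  open import Relation.Binary.PropositionalEquality


  -- The first two summands serve the hypothesis `large`, `4608 t⁴` being `error`. The last one
  -- forces `r / t ≥ t + 4`, hence both `4 ≤ d` and `t ≤ d`.
  threshold : ℕ → ℕ
  threshold t = 2 * t + t * (t + 3) * (4608 * (t * t * (t * t))) + t * (t + 4)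

  ≤-sqrt : ∀ {q r s} → q ≤ r * (r + 2) → s * s ≤ q → s ≤ r
  ≤-sqrt {q} {r} {s} q≤ s²≤q = ≮⇒≥ λ r<s → <-irrefl refl (begin-strict
    q                 ≤⟨ q≤ ⟩
    r * (r + 2)       <⟨ ≤-reflexive (solve 1 (λ r → con 1 :+ r :* (r :+ con 2) := (con 1 :+ r) :* (con 1 :+ r)) refl r) ⟩
    suc r * suc r     ≤⟨ *-mono-≤ r<s r<s ⟩
    s * s             ≤⟨ s²≤q ⟩
    q                 ∎)
    where
    open ≤-Reasoning
    open +-*-Solver

  r<t[r/t+1] : ∀ r t .{{_ : ℕ.NonZero t}} → r < t * (r / t + 1)
  r<t[r/t+1] r t = begin-strict
    r                       ≡⟨ m≡m%n+[m/n]*n r t ⟩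
    r % t + r / t * t       <⟨ +-monoˡ-< (r / t * t) (m%n<n r t) ⟩
    t + r / t * t           ≡⟨ trans (+-comm t _) (cong₂ _+_ (*-comm (r / t) t) (sym (*-identityʳ t))) ⟩
    t * (r / t) + t * 1     ≡⟨ *-distribˡ-+ t (r / t) 1 ⟨
    t * (r / t + 1)         ∎
    where open ≤-Reasoning

  expectedLIS-bounds : ∀ ε → ℚ.0ℚ ℚ.< ε → ∃[ N ] ∀ n k → N ≤ n → suc k ≤ n →
    (expectedLIS (suc k) n ℚ.+ ℕ→ℚ (suc k)) ≤[ ℕ→ℚ 2 ℚ.+ ε √ n * suc k ]
    × [ ℕ→ℚ 2 ℚ.- ε √ n * suc k ]≤ (expectedLIS (suc k) n ℚ.+ ℕ→ℚ (suc k))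
  expectedLIS-bounds ε 0<ε with archimedean ε 0<ε
  -- `n ≥ ρ²` gives `n * suc k ≥ ρ²` and so `r ≥ ρ` for every `k`; this uniformity lets the
  -- multiplicity vary with `n`.
  ... | d₀ , 1≤ = ρ * ρ , λ n k ρ²≤n k<n →
    let (r , r²≤q , q≤) = integer-sqrt (n * suc k) in
    -- `suc k ≤ n` gives `(suc k)² ≤ n * suc k`, so `suc k ≤ r` and `r ∸ suc k` is a genuine number
    -- of particles.
    let k<r = ≤-sqrt q≤ (*-monoˡ-≤ (suc k) k<n) in
    go n k r (r ∸ suc k) (m∸n+n≡m k<r) r²≤q q≤ (≤-sqrt q≤ (≤-trans ρ²≤n (m≤m*n n (suc k))))
    where
    t ρ : ℕ
    -- With `1 ≤ suc d₀ * ε` this yields `20 ≤ t ε`.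
    t = 20 * suc d₀
    ρ = threshold t
    20≤t : 20 ≤ t
    20≤t = m≤m*n 20 (suc d₀)
    20≤tε : # 20 ℚ.≤ ι t ℚ.* ε
    20≤tε = begin
      # 20                          ≡⟨ ι≡ℕ→ℚ 20 ⟨
      ι 20                          ≡⟨ ℚₚ.*-identityʳ (ι 20) ⟨
      ι 20 ℚ.* ℚ.1ℚ                 ≤⟨ *-monoˡ (0≤ι 20) 1≤ ⟩
      ι 20 ℚ.* (ι (suc d₀) ℚ.* ε)   ≡⟨ ℚₚ.*-assoc (ι 20) (ι (suc d₀)) ε ⟨
      ι 20 ℚ.* ι (suc d₀) ℚ.* ε     ≡⟨ cong (ℚ._* ε) (ι-* 20 (suc d₀)) ⟨
      ι t ℚ.* ε                     ∎
      where open ℚₚ.≤-Reasoning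
    go : ∀ n k r m → m + suc k ≡ r → r * r ≤ n * suc k → n * suc k ≤ r * (r + 2) → ρ ≤ r →
      (expectedLIS (suc k) n ℚ.+ ℕ→ℚ (suc k)) ≤[ ℕ→ℚ 2 ℚ.+ ε √ n * suc k ]
      × [ ℕ→ℚ 2 ℚ.- ε √ n * suc k ]≤ (expectedLIS (suc k) n ℚ.+ ℕ→ℚ (suc k))
    go n k r m refl r²≤q q≤ ρ≤r =
      subst (λ x → x ≤[ ℕ→ℚ 2 ℚ.+ ε √ n * suc k ] × [ ℕ→ℚ 2 ℚ.- ε √ n * suc k ]≤ x)
        (cong₂ ℚ._+_ (sym (expectedLIS≡F k n)) (ι≡ℕ→ℚ (suc k)))
        (Bounds.bounds t n k m d (≤-trans (≤-trans (s≤s (s≤s z≤n)) 20≤t) t≤r) (≤-trans (m≤n+m 4 t) t+4≤d)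
          (≤-trans (s≤s (s≤s z≤n)) 20≤t) (≤-trans (m≤m+n t 4) t+4≤d) (subst (_≤ r) (*-comm d t) (m/n*n≤m r t))
          (<⇒≤ (r<t[r/t+1] r t)) r²≤q q≤ 0<ε 20≤tε t≤r large)
      where
      d : ℕ
      d = r / t
      t[t+4]≤r : t * (t + 4) ≤ r
      t[t+4]≤r = ≤-trans (m≤n+m (t * (t + 4)) (2 * t + t * (t + 3) * (4608 * (t * t * (t * t))))) ρ≤r
      t+4≤d : t + 4 ≤ d
      t+4≤d = ≤-pred (*-cancelˡ-< t (t + 4) (suc d) (subst (λ s → t * (t + 4) < t * s) (+-comm d 1) (≤-<-trans t[t+4]≤r (r<t[r/t+1] r t))))
      t≤r : t ≤ r
      t≤r = ≤-trans (m≤m*n t (t + 4) {{ℕ.>-nonZero (≤-trans (s≤s z≤n) (m≤n+m 4 t))}}) t[t+4]≤r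
      T : ℚ.ℚ
      T = ι t
      large : # 2 ℚ.* T ℚ.+ T ℚ.* (T ℚ.+ # 3) ℚ.* (# 4608 ℚ.* (T ℚ.* T ℚ.* (T ℚ.* T))) ℚ.≤ ι r
      large = subst (ℚ._≤ ι r) ι-threshold (ι-mono (≤-trans (m≤m+n (2 * t + t * (t + 3) * (4608 * (t * t * (t * t)))) (t * (t + 4))) ρ≤r))
        where
        ι-#* : ∀ a b → ι (a * b) ≡ # a ℚ.* ι b
        ι-#* a b = trans (ι-* a b) (cong (ℚ._* ι b) (ι≡ℕ→ℚ a))
        ι-threshold : ι (2 * t + t * (t + 3) * (4608 * (t * t * (t * t)))) ≡
          # 2 ℚ.* T ℚ.+ T ℚ.* (T ℚ.+ # 3) ℚ.* (# 4608 ℚ.* (T ℚ.* T ℚ.* (T ℚ.* T)))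
        ι-threshold = trans (ι-+ (2 * t) (t * (t + 3) * (4608 * (t * t * (t * t))))) (cong₂ ℚ._+_ (ι-#* 2 t)
          (trans (ι-* (t * (t + 3)) (4608 * (t * t * (t * t)))) (cong₂ ℚ._*_
            (trans (ι-* t (t + 3)) (cong (T ℚ.*_) (trans (ι-+ t 3) (cong (T ℚ.+_) (ι≡ℕ→ℚ 3)))))
            (trans (ι-#* 4608 (t * t * (t * t))) (cong (# 4608 ℚ.*_) (trans (ι-* (t * t) (t * t)) (cong₂ ℚ._*_ (ι-* t t) (ι-* t t))))))))

open import Defs
open import Data.Nat using (ℕ; _≤_; _*_)
open import Data.Rational using (ℚ; 0ℚ; _<_; _+_; _-_)
open import Data.Product using (_×_; ∃-syntax)
open import Data.Nat using (suc; s≤s; z≤n)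
open import Data.Nat.Properties using (≤-trans; n≤1+n)
open import Data.Product using (_,_; proj₁; proj₂)
open Conclusion using (expectedLIS-bounds)

theorem1 : (k : ℕ → ℕ)
    → (∀ n → 1 ≤ n → 1 ≤ k n × k n ≤ n)
    → ∀ (ε : ℚ) → 0ℚ < ε
    → ∃[ N ] ∀ n → N ≤ n
      → (expectedLIS (k n) n + ℕ→ℚ (k n)) ≤[ ℕ→ℚ 2 + ε √ n * k n ]
        × [ ℕ→ℚ 2 - ε √ n * k n ]≤ (expectedLIS (k n) n + ℕ→ℚ (k n))
-- The `suc` excludes `n = 0`, about which the hypothesis on `k` says nothing.
theorem1 k hk ε 0<ε = suc (proj₁ bounds) , λ n N<n →
  let 1≤k , k≤n = hk n (≤-trans (s≤s z≤n) N<n) in for-positive n N<n (k n) 1≤k k≤n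
  where
  bounds = expectedLIS-bounds ε 0<ε
  for-positive : ∀ n → suc (proj₁ bounds) ≤ n → ∀ κ → 1 ≤ κ → κ ≤ n →
    (expectedLIS κ n + ℕ→ℚ κ) ≤[ ℕ→ℚ 2 + ε √ n * κ ] × [ ℕ→ℚ 2 - ε √ n * κ ]≤ (expectedLIS κ n + ℕ→ℚ κ)
  for-positive n N<n (suc κ) _ κ≤n = proj₂ bounds n κ (≤-trans (n≤1+n (proj₁ bounds)) N<n) κ≤n
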